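{- Let $\alpha$ be a monotone self-dual non-projection connective, let $n$ be even, and let the support of $\mu$ comprise exactly the $n$ projection functions. Then the limiting distribution of the growth process $(\mu,\alpha)$ is uniform on the self-dual functions in $\mathcal S_{n/2,n}$.
   Context: A connective is a $k$-adic Boolean function $\alpha:\{0,1\}^k\to\{0,1\}$. The initial distribution $\mu$ is uniform on its support, here $\{x_1,\dots,x_n\}$. The growth process $(\mu,\alpha)$ gives distributions $\pi_i$ on $n$-adic Boolean functions: $\pi_0=\mu$, and for $i\ge1$, $\pi_i(f)$ is the probability that $\alpha(g_1,\dots,g_k)=f$ where $g_1,\dots,g_k$ are independent random functions distributed according to $\pi_{i-1}$. The limiting distribution is $\pi=\lim_{i\to\infty}\pi_i$ (pointwise). A Boolean function $f$ of $m$ variables is self-dual if $f(y_1,\dots,y_m)=\overline{f(\bar y_1,\dots,\bar y_m)}$ for all $y$. The family $\mathcal S_{m,n}$ of slice functions consists of the $n$-adic Boolean functions that take the value 1 on all assignments of weight greater than $m$, the value 0 on all assignments of weight less than $m$, and either value on assignments of weight exactly $m$ (weight = number of ones). -}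

module Defs where

open import Data.Bool using (Bool; true; false; not; if_then_else_; _≟_; _≤_)
open import Data.List as List using (List; []; _∷_; cartesianProductWith; filter)
open import Data.Nat as ℕ using (ℕ; zero; suc)
open import Data.Product using (_×_; _,_; ∃-syntax)
open import Data.Rational as ℚ using (ℚ; 0ℚ; 1ℚ)
open import Data.Vec as Vec using (Vec; []; _∷_; lookup; count)
open import Data.Vec.Relation.Binary.Pointwise.Inductive using (Pointwise)
open import Level using (0ℓ)
open import Relation.Binary using (_Preserves_⟶_)
open import Relation.Binary.PropositionalEquality using (_≡_; _≢_; _≗_)
open import Relation.Nullary using (Dec)
open import Relation.Nullary.Decidable using (map′; _×-dec_)
open import Relation.Unary using (Pred; _≐_)

-- Functional extensionality is not available, so Boolean functions are
-- identified when they are pointwise equal (_≗_).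
BoolFun : ℕ → Set
BoolFun n = Vec Bool n → Bool

Monotone : ∀ {n} → BoolFun n → Set
Monotone f = f Preserves Pointwise _≤_ ⟶ _≤_

SelfDual : ∀ {n} → BoolFun n → Set
SelfDual f = ∀ y → f y ≡ not (f (Vec.map not y))

IsProjection : ∀ {n} → BoolFun n → Set
IsProjection {n} f = ∃[ i ] f ≗ λ (y : Vec Bool n) → lookup y i

weight : ∀ {n} → Vec Bool n → ℕ
weight = count (_≟ true)

Slice : ∀ m {n} → BoolFun n → Set
Slice m f = (∀ y → m ℕ.< weight y → f y ≡ true)
          × (∀ y → weight y ℕ.< m → f y ≡ false)

_≗?_ : ∀ {n} (f g : BoolFun n) → Dec (f ≗ g)
_≗?_ {zero} f g = map′ (λ { e [] → e }) (λ e → e []) (f [] ≟ g [])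
_≗?_ {suc n} f g =
  map′ (λ { (e₀ , e₁) (false ∷ y) → e₀ y ; (e₀ , e₁) (true ∷ y) → e₁ y })
       (λ e → (λ y → e (false ∷ y)) , (λ y → e (true ∷ y)))
       (((λ y → f (false ∷ y)) ≗? (λ y → g (false ∷ y)))
         ×-dec ((λ y → f (true ∷ y)) ≗? (λ y → g (true ∷ y))))

cofactors : ∀ {n} → BoolFun n → BoolFun n → BoolFun (suc n)
cofactors f₀ f₁ (b ∷ y) = if b then f₁ y else f₀ y

-- Each n-adic Boolean function occurs exactly once up to _≗_.
allFuns : ∀ n → List (BoolFun n)
allFuns zero    = (λ _ → false) ∷ (λ _ → true) ∷ []
allFuns (suc n) = cartesianProductWith cofactors (allFuns n) (allFuns n)

tuples : {A : Set} → List A → ∀ k → List (Vec A k)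
tuples xs zero    = [] ∷ []
tuples xs (suc k) = cartesianProductWith _∷_ xs (tuples xs k)

∑ : {A : Set} → List A → (A → ℚ) → ℚ
∑ xs h = List.foldr (λ x s → h x ℚ.+ s) 0ℚ xs

Mass : ℕ → Set
Mass n = BoolFun n → ℚ

record IsDistribution {n} (p : Mass n) : Set where
  field
    respects    : ∀ {f g} → f ≗ g → p f ≡ p g
    nonnegative : ∀ f → 0ℚ ℚ.≤ p f
    total       : ∑ (allFuns n) p ≡ 1ℚ

Support : ∀ {n} → Mass n → Pred (BoolFun n) 0ℓ
Support p f = p f ≢ 0ℚ

record UniformOn {n} (P : Pred (BoolFun n) 0ℓ) (p : Mass n) : Set where
  field
    isDistribution : IsDistribution p
    support        : Support p ≐ P
    constant       : ∀ {f g} → P f → P g → p f ≡ p g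

compose : ∀ {k n} → BoolFun k → Vec (BoolFun n) k → BoolFun n
compose α gs y = α (Vec.map (λ g → g y) gs)

-- The probability that independent draws from p are exactly gs.
joint : ∀ {k n} → Mass n → Vec (BoolFun n) k → ℚ
joint p gs = Vec.foldr _ (λ g q → p g ℚ.* q) 1ℚ gs

growth : ∀ {k n} → Mass n → BoolFun k → ℕ → Mass n
growth μ α zero f = μ f
growth {k} {n} μ α (suc i) f =
  ∑ (filter (λ gs → compose α gs ≗? f) (tuples (allFuns n) k))
    (joint (growth μ α i))

-- Limits are taken in ℚ; a rational limit is also the limit in ℝ.
IsLimit : ∀ {n} → (ℕ → Mass n) → Mass n → Set
IsLimit p q = ∀ f ε → 0ℚ ℚ.< ε →
  ∃[ N ] ∀ i → N ℕ.≤ i → ℚ.∣ p i f ℚ.- q f ∣ ℚ.< ε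

{-# OPTIONS --safe #-}
module Submission where

-- All functions that the process produces with positive probability are
-- self-dual, because α and the projections are.
--
-- Outside the middle layer.  At a point y the value is true with some
-- probability q, which a step replaces by amp α q, the probability that α is
-- true on independent inputs of bias q.  For monotone α the odds of amp α q
-- relative to the odds of q do not decrease with q (0≤oddsGap, a two-point form
-- of the Moore-Shannon inequality), strictly so unless α is constant or a
-- projection (0<oddsGap).  Self-duality makes 1/2 a fixed point, so below 1/2
-- amplification strictly decreases the odds, and below any given bias less than
-- 1/2 it does so by a factor bounded away from 1.  Initially q = weight y / n,
-- which is less than 1/2 below the middle layer; there q tends to 0
-- (amp-iterates-vanish), and by self-duality it tends to 1 above the middle layer.
--
-- In the middle layer.  Read truth values as signs, and let the moment of a list
-- of points be the mean of the product of the signs of the values there.  The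
-- claim is that the moment of any nonempty list of middle points, no two of them
-- equal or complementary, tends to 0 (moment-vanishes).  Expanding α into
-- characters with Fourier coefficients a_T, a step turns the moment ρ of m points
-- into the sum over T of a_T^m ρ^|T|, up to terms that contain the moment of a
-- nonempty proper sublist (moment-recurrence).  These terms are negligible by
-- induction on m.  Here a_∅ = 0 by self-duality and the a_T² sum to 1 by
-- Parseval, so for m ≥ 2 the sum is at most |ρ| in absolute value.  Since α is monotone and
-- neither constant nor a projection, some a_T with |T| ≥ 2 is nonzero
-- (nonlinear-coef), and it has absolute value below 1 (∣coef∣<1); this gives a
-- contraction if m ≥ 3, and also if m = 2 as long as |ρ| stays away from 1
-- (∣transfer∣≤).  Single middle points have moment exactly 0 at all times, so
-- for m = 2 the recurrence has no error term, and |ρ| never exceeds its initial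
-- value.  That value is less than 1 because two points that are neither equal nor
-- complementary agree in some coordinate and differ in another.
--
-- Conclusion.  Choose one point from each complementary pair of middle points.
-- By the above, the values at these representatives become independent and
-- unbiased, so each pattern of values has limiting probability u = 2^(-r), with r
-- the number of representatives.  A self-dual slice function is determined by its
-- pattern, and every other function has limiting mass 0; hence each self-dual
-- slice function has limiting mass u, and the limit has total mass 1.

open import Data.Bool as Bool using (Bool; true; false; not; if_then_else_)
open import Data.Bool.Properties using (not-involutive)
open import Data.Empty using (⊥-elim)
open import Data.Fin using (Fin; zero; suc)
open import Data.List as List using (List; []; _∷_; _++_; cartesianProductWith; filter; length)
open import Data.List.Membership.Propositional using (_∈_)
open import Data.List.Membership.Propositional.Properties using (∈-cartesianProductWith⁺; ∈-++⁻; ∈-map⁻; ∈-allFin)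
open import Data.List.Relation.Binary.Sublist.Heterogeneous.Properties using (length-mono-≤)
open import Data.List.Relation.Binary.Sublist.Propositional using (_⊆_; []; _∷_; _∷ʳ_)
open import Data.List.Relation.Binary.Sublist.Propositional.Properties using (All-resp-⊆)
open import Data.List.Relation.Unary.All as All using (All; []; _∷_)
open import Data.List.Relation.Unary.All.Properties using (¬Any⇒All¬)
open import Data.List.Relation.Unary.AllPairs using (AllPairs; []; _∷_)
open import Data.List.Relation.Unary.Any as Any using (Any; here; there)
open import Data.List.Properties using (map-tabulate)
open import Data.Maybe using (Maybe; just; nothing)
open import Data.Nat using (ℕ; zero; suc; _/_)
import Data.Nat as ℕ
import Data.Nat.Properties as ℕₚ
open import Data.Nat.Divisibility using (_∣_; divides)
open import Data.Nat.DivMod using (m*n/n≡m)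
open import Data.Product using (_×_; _,_; proj₁; proj₂; ∃-syntax)
open import Data.Rational using (ℚ; 0ℚ; 1ℚ; ½; _+_; _*_; _-_; -_; _≤_; _<_; ∣_∣; 1/_)
import Data.Rational as ℚ
open import Data.Rational.Properties
import Data.Rational.Unnormalised as ℚᵘ
import Data.Rational.Unnormalised.Properties as ℚᵘₚ
import Data.Integer as ℤ
import Data.Integer.Properties as ℤₚ
open import Data.Sum using (_⊎_; inj₁; inj₂; [_,_]′)
open import Data.Vec as Vec using (Vec; []; _∷_; lookup)
import Data.Vec.Properties as Vecₚ
open import Data.Vec.Relation.Binary.Pointwise.Inductive as Pointwise using (Pointwise; []; _∷_)
open import Function using (_∘_; id)
open import Level using (0ℓ)
open import Relation.Binary using (tri<; tri≈; tri>)
open import Relation.Binary.PropositionalEquality hiding ([_]; J)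
open import Relation.Nullary using (¬_; Dec; yes; no; does)
open import Relation.Nullary.Decidable using (toWitness; _×-dec_; _⊎-dec_)
open import Tactic.RingSolver using (solve-∀)
open import Tactic.RingSolver.Core.AlmostCommutativeRing using (AlmostCommutativeRing; fromCommutativeRing)
open import Defs

-- Rational arithmetic

ℚ-ring : AlmostCommutativeRing 0ℓ 0ℓ
ℚ-ring = fromCommutativeRing +-*-commutativeRing isZero
  where
  isZero : ∀ x → Maybe (0ℚ ≡ x)
  isZero x with 0ℚ ≟ x
  ... | yes 0≡x = just 0≡x
  ... | no  _   = nothing

0<1 : 0ℚ < 1ℚ
0<1 = toWitness {a? = 0ℚ <? 1ℚ} _

0≤1 : 0ℚ ≤ 1ℚ
0≤1 = <⇒≤ 0<1

0<½ : 0ℚ < ½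
0<½ = toWitness {a? = 0ℚ <? ½} _

½<1 : ½ < 1ℚ
½<1 = toWitness {a? = ½ <? 1ℚ} _

0≤a+b : ∀ {a b} → 0ℚ ≤ a → 0ℚ ≤ b → 0ℚ ≤ a + b
0≤a+b = +-mono-≤

0<a+b : ∀ {a b} → 0ℚ < a → 0ℚ ≤ b → 0ℚ < a + b
0<a+b = +-mono-<-≤

0≤a*b : ∀ {a b} → 0ℚ ≤ a → 0ℚ ≤ b → 0ℚ ≤ a * b
0≤a*b {a} {b} 0≤a 0≤b = subst (_≤ a * b) (*-zeroʳ a)
  (*-monoˡ-≤-nonNeg a {{ℚ.nonNegative 0≤a}} 0≤b)

0<a*b : ∀ {a b} → 0ℚ < a → 0ℚ < b → 0ℚ < a * b
0<a*b {a} {b} 0<a 0<b = subst (_< a * b) (*-zeroʳ a)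
  (*-monoʳ-<-pos a {{ℚ.positive 0<a}} 0<b)

0≤a² : ∀ a → 0ℚ ≤ a * a
0≤a² a with ≤-total 0ℚ a
... | inj₁ 0≤a = 0≤a*b 0≤a 0≤a
... | inj₂ a≤0 = subst (0ℚ ≤_) (lemma a) (0≤a*b (neg-antimono-≤ a≤0) (neg-antimono-≤ a≤0))
  where
  lemma : ∀ a → - a * - a ≡ a * a
  lemma = solve-∀ ℚ-ring

≤⇒0≤- : ∀ {a b} → a ≤ b → 0ℚ ≤ b - a
≤⇒0≤- {a} {b} a≤b = subst (_≤ b - a) (+-inverseʳ a) (+-monoˡ-≤ (- a) a≤b)

<⇒0<- : ∀ {a b} → a < b → 0ℚ < b - a
<⇒0<- {a} {b} a<b = subst (_< b - a) (+-inverseʳ a) (+-monoˡ-< (- a) a<b)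

-- Inequalities are mostly proved by exhibiting the difference of the two
-- sides as an expression that is visibly nonnegative.
≤-by : ∀ {a b d} → 0ℚ ≤ d → b ≡ a + d → a ≤ b
≤-by {a} {b} {d} 0≤d refl = subst (_≤ a + d) (+-identityʳ a) (+-monoʳ-≤ a 0≤d)

<-by : ∀ {a b d} → 0ℚ < d → b ≡ a + d → a < b
<-by {a} {b} {d} 0<d refl = subst (_< a + d) (+-identityʳ a) (+-monoʳ-< a 0<d)

0≤-⇒≤ : ∀ {a b} → 0ℚ ≤ b - a → a ≤ b
0≤-⇒≤ {a} {b} 0≤b-a = ≤-by 0≤b-a (lemma a b)
  where
  lemma : ∀ a b → b ≡ a + (b - a)
  lemma = solve-∀ ℚ-ring

0<-⇒< : ∀ {a b} → 0ℚ < b - a → a < b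
0<-⇒< {a} {b} 0<b-a = <-by 0<b-a (lemma a b)
  where
  lemma : ∀ a b → b ≡ a + (b - a)
  lemma = solve-∀ ℚ-ring

cancel-0≤ : ∀ {c a} → 0ℚ < c → 0ℚ ≤ c * a → 0ℚ ≤ a
cancel-0≤ {c} {a} 0<c 0≤ca =
  *-cancelˡ-≤-pos c {{ℚ.positive 0<c}} (subst (_≤ c * a) (sym (*-zeroʳ c)) 0≤ca)

cancel-0< : ∀ {c a} → 0ℚ < c → 0ℚ < c * a → 0ℚ < a
cancel-0< {c} {a} 0<c 0<ca =
  *-cancelˡ-<-nonNeg c {{ℚ.nonNegative (<⇒≤ 0<c)}} (subst (_< c * a) (sym (*-zeroʳ c)) 0<ca)

*-mono-≤ : ∀ {a b c d} → 0ℚ ≤ a → 0ℚ ≤ d → a ≤ b → c ≤ d → a * c ≤ b * d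
*-mono-≤ {a} {b} {c} {d} 0≤a 0≤d a≤b c≤d = ≤-trans
  (*-monoˡ-≤-nonNeg a {{ℚ.nonNegative 0≤a}} c≤d)
  (*-monoʳ-≤-nonNeg d {{ℚ.nonNegative 0≤d}} a≤b)

≢0∧0≤⇒0< : ∀ {a} → a ≢ 0ℚ → 0ℚ ≤ a → 0ℚ < a
≢0∧0≤⇒0< {a} a≢0 0≤a with 0ℚ <? a
... | yes 0<a = 0<a
... | no ¬0<a = ⊥-elim (a≢0 (≤-antisym (≮⇒≥ ¬0<a) 0≤a))

0<a² : ∀ {a} → a ≢ 0ℚ → 0ℚ < a * a
0<a² {a} a≢0 = ≢0∧0≤⇒0< a²≢0 (0≤a² a)
  where
  a²≢0 : a * a ≢ 0ℚ
  a²≢0 a²≡0 with <-cmp a 0ℚ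
  ... | tri< a<0 _ _ = <⇒≢ (0<a*b (neg-antimono-< a<0) (neg-antimono-< a<0))
                           (sym (trans (lemma a) a²≡0))
    where
    lemma : ∀ a → - a * - a ≡ a * a
    lemma = solve-∀ ℚ-ring
  ... | tri≈ _ a≡0 _ = a≢0 a≡0
  ... | tri> _ _ 0<a = <⇒≢ (0<a*b 0<a 0<a) (sym a²≡0)

∣∣-< : ∀ {x e} → x < e → - x < e → ∣ x ∣ < e
∣∣-< {x} {e} x<e -x<e with ∣p∣≡p∨∣p∣≡-p x
... | inj₁ ∣x∣≡x  = subst (_< e) (sym ∣x∣≡x) x<e
... | inj₂ ∣x∣≡-x = subst (_< e) (sym ∣x∣≡-x) -x<e

x≤∣x∣ : ∀ x → x ≤ ∣ x ∣
x≤∣x∣ x with ≤-total 0ℚ x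
... | inj₁ 0≤x = ≤-reflexive (sym (0≤p⇒∣p∣≡p 0≤x))
... | inj₂ x≤0 = ≤-trans x≤0 (0≤∣p∣ x)

∣x+y∣≤ : ∀ {x y c d} → ∣ x ∣ ≤ c → ∣ y ∣ ≤ d → ∣ x + y ∣ ≤ c + d
∣x+y∣≤ {x} {y} ∣x∣≤c ∣y∣≤d = ≤-trans (∣p+q∣≤∣p∣+∣q∣ x y) (+-mono-≤ ∣x∣≤c ∣y∣≤d)

∣x*y∣≤ : ∀ {x y c d} → ∣ x ∣ ≤ c → ∣ y ∣ ≤ d → ∣ x * y ∣ ≤ c * d
∣x*y∣≤ {x} {y} {c} {d} ∣x∣≤c ∣y∣≤d = subst (_≤ c * d) (sym (∣p*q∣≡∣p∣*∣q∣ x y))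
  (*-mono-≤ (0≤∣p∣ x) (≤-trans (0≤∣p∣ y) ∣y∣≤d) ∣x∣≤c ∣y∣≤d)

∣x*y∣≤1 : ∀ {x y} → ∣ x ∣ ≤ 1ℚ → ∣ y ∣ ≤ 1ℚ → ∣ x * y ∣ ≤ 1ℚ
∣x*y∣≤1 = ∣x*y∣≤

∣x∣≤y+z : ∀ {x y z} → ∣ x - y ∣ ≤ z → ∣ x ∣ ≤ ∣ y ∣ + z
∣x∣≤y+z {x} {y} {z} ∣x-y∣≤z =
  subst (λ t → ∣ t ∣ ≤ ∣ y ∣ + z) (lemma x y) (∣x+y∣≤ (≤-refl {∣ y ∣}) ∣x-y∣≤z)
  where
  lemma : ∀ x y → y + (x - y) ≡ x
  lemma = solve-∀ ℚ-ring

inverse : ∀ {c} → 0ℚ < c → ∃[ d ] 0ℚ < d × c * d ≡ 1ℚ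
inverse {c} 0<c = 1/c , positive⁻¹ 1/c {{1/pos⇒pos c}} , *-inverseʳ c
  where
  instance
    c-pos = ℚ.positive 0<c
    c≢0 = pos⇒nonZero c
  1/c = 1/ c

-- The multiple n · x = x + ... + x.
infixr 8 _·_

_·_ : ℕ → ℚ → ℚ
zero  · x = 0ℚ
suc n · x = x + n · x

·-assoc : ∀ n x → n · x ≡ (n · 1ℚ) * x
·-assoc zero    x = sym (*-zeroˡ x)
·-assoc (suc n) x = trans (cong (x +_) (·-assoc n x)) (lemma x (n · 1ℚ))
  where
  lemma : ∀ x a → x + a * x ≡ (1ℚ + a) * x
  lemma = solve-∀ ℚ-ring

·-+ : ∀ m n x → (m ℕ.+ n) · x ≡ m · x + n · x
·-+ zero    n x = sym (+-identityˡ _)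
·-+ (suc m) n x = trans (cong (x +_) (·-+ m n x)) (sym (+-assoc x (m · x) (n · x)))

0≤· : ∀ n {x} → 0ℚ ≤ x → 0ℚ ≤ n · x
0≤· zero    0≤x = ≤-refl
0≤· (suc n) 0≤x = 0≤a+b 0≤x (0≤· n 0≤x)

·-mono-< : ∀ {m n} → m ℕ.< n → m · 1ℚ < n · 1ℚ
·-mono-< {zero}  {suc n} _           = 0<a+b 0<1 (0≤· n 0≤1)
·-mono-< {suc m} {suc n} (ℕ.s≤s m<n) = +-monoʳ-< 1ℚ (·-mono-< m<n)

archimedean-1 : ∀ x → ∃[ n ] x ≤ n · 1ℚ
archimedean-1 x@(ℚ.mkℚ a d-1 _) = ℤ.∣ a ∣ , toℚᵘ-cancel-≤ (ℚᵘₚ.≤-respʳ-≃ (ℚᵘₚ.≃-sym (·1≃ ℤ.∣ a ∣)) x≤∣a∣)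
  where
  ·1≃ : ∀ n → ℚ.toℚᵘ (n · 1ℚ) ℚᵘ.≃ ℚᵘ.mkℚᵘ (ℤ.+ n) 0
  ·1≃ zero    = ℚᵘₚ.≃-refl
  ·1≃ (suc n) = ℚᵘₚ.≃-trans (toℚᵘ-homo-+ 1ℚ (n · 1ℚ))
    (ℚᵘₚ.≃-trans (ℚᵘₚ.+-congʳ (ℚ.toℚᵘ 1ℚ) (·1≃ n))
      (ℚᵘ.*≡* (cong (ℤ._* ℤ.1ℤ) (cong (λ t → ℤ.1ℤ ℤ.+ t) (ℤₚ.*-identityʳ (ℤ.+ n))))))

  x≤∣a∣ : ℚ.toℚᵘ x ℚᵘ.≤ ℚᵘ.mkℚᵘ (ℤ.+ ℤ.∣ a ∣) 0
  x≤∣a∣ = ℚᵘ.*≤* (ℤₚ.≤-trans (ℤₚ.*-monoʳ-≤-nonNeg ℤ.1ℤ (i≤∣i∣ a))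
                   (ℤₚ.*-monoˡ-≤-nonNeg (ℤ.+ ℤ.∣ a ∣) (ℤ.+≤+ (ℕ.s≤s ℕ.z≤n))))
    where
    i≤∣i∣ : ∀ i → i ℤ.≤ ℤ.+ ℤ.∣ i ∣
    i≤∣i∣ (ℤ.+ n)      = ℤₚ.≤-refl
    i≤∣i∣ (ℤ.-[1+ n ]) = ℤ.-≤+

archimedean : ∀ x {η} → 0ℚ < η → ∃[ n ] x < n · η
archimedean x {η} 0<η with inverse 0<η
... | θ , 0<θ , ηθ≡1 with archimedean-1 (x * θ)
... | n , xθ≤n = suc n , subst (_< suc n · η) (trans (lemma x θ η) (trans (cong (x *_) ηθ≡1) (*-identityʳ x)))
                   (≤-<-trans (*-monoʳ-≤-nonNeg η {{ℚ.nonNegative (<⇒≤ 0<η)}} xθ≤n)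
                     (<-by 0<η (trans (cong (η +_) (·-assoc n η)) (+-comm η _))))
  where
  lemma : ∀ x θ η → x * θ * η ≡ x * (η * θ)
  lemma = solve-∀ ℚ-ring

-- Sequences tending to zero

Vanishes : (ℕ → ℚ) → Set
Vanishes x = ∀ ε → 0ℚ < ε → ∃[ N ] ∀ i → N ℕ.≤ i → ∣ x i ∣ < ε

vanishes-0 : Vanishes (λ _ → 0ℚ)
vanishes-0 ε 0<ε = 0 , λ _ _ → 0<ε

½+½ : ∀ x → x ≡ ½ * x + ½ * x
½+½ = solve-∀ ℚ-ring

vanishes-+ : ∀ {x y} → Vanishes x → Vanishes y → Vanishes (λ i → x i + y i)
vanishes-+ {x} {y} vx vy ε 0<ε with vx (½ * ε) (0<a*b 0<½ 0<ε) | vy (½ * ε) (0<a*b 0<½ 0<ε)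
... | M , x< | N , y< = M ℕ.⊔ N , λ i M⊔N≤i → ≤-<-trans (∣p+q∣≤∣p∣+∣q∣ (x i) (y i))
  (subst (∣ x i ∣ + ∣ y i ∣ <_) (sym (½+½ ε))
    (+-mono-< (x< i (ℕₚ.≤-trans (ℕₚ.m≤m⊔n M N) M⊔N≤i)) (y< i (ℕₚ.≤-trans (ℕₚ.m≤n⊔m M N) M⊔N≤i))))

vanishes-≤ : ∀ {x y} → (∀ i → ∣ y i ∣ ≤ ∣ x i ∣) → Vanishes x → Vanishes y
vanishes-≤ y≤x vx ε 0<ε with vx ε 0<ε
... | N , x< = N , λ i N≤i → ≤-<-trans (y≤x i) (x< i N≤i)

vanishes-≡ : ∀ {x y} → (∀ i → y i ≡ x i) → Vanishes x → Vanishes y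
vanishes-≡ y≡x = vanishes-≤ λ i → ≤-reflexive (cong ∣_∣ (y≡x i))

vanishes-*ˡ : ∀ c {x} → Vanishes x → Vanishes (λ i → c * x i)
vanishes-*ˡ c {x} vx ε 0<ε with inverse (<-≤-trans 0<1 (≤-by {d = ∣ c ∣} (0≤∣p∣ c) refl))
... | θ , 0<θ , cθ≡1 with vx (ε * θ) (0<a*b 0<ε 0<θ)
... | N , x< = N , λ i N≤i → ≤-<-trans
  (≤-by {d = ∣ x i ∣} (0≤∣p∣ (x i)) (trans (lemma₁ ∣ c ∣ ∣ x i ∣) (cong (_+ ∣ x i ∣) (sym (∣p*q∣≡∣p∣*∣q∣ c (x i))))))
  (subst ((1ℚ + ∣ c ∣) * ∣ x i ∣ <_) (trans (lemma₂ (1ℚ + ∣ c ∣) ε θ) (trans (cong (ε *_) cθ≡1) (*-identityʳ ε)))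
    (*-monoʳ-<-pos (1ℚ + ∣ c ∣) {{ℚ.positive (<-≤-trans 0<1 (≤-by {d = ∣ c ∣} (0≤∣p∣ c) refl))}} (x< i N≤i)))
  where
  lemma₁ : ∀ a b → (1ℚ + a) * b ≡ a * b + b
  lemma₁ = solve-∀ ℚ-ring

  lemma₂ : ∀ a ε θ → a * (ε * θ) ≡ ε * (a * θ)
  lemma₂ = solve-∀ ℚ-ring

vanishing-constant : ∀ {c} → Vanishes (λ _ → c) → c ≡ 0ℚ
vanishing-constant {c} vc with c ≟ 0ℚ
... | yes c≡0 = c≡0
... | no  c≢0 = ⊥-elim (<-irrefl refl (proj₂ (vc ∣ c ∣ (≢0∧0≤⇒0< (λ z → c≢0 (∣p∣≡0⇒p≡0 c z)) (0≤∣p∣ c))) _ ℕₚ.≤-refl))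

-- A sequence that falls by at least η while it is above t, and does not cross t
-- upwards, ends up below t.
eventually-below : ∀ {x : ℕ → ℚ} {t η} N → 0ℚ < η → (∀ i → 0ℚ ≤ x i) →
  (∀ i → N ℕ.≤ i → x i ≤ t → x (suc i) ≤ t) →
  (∀ i → N ℕ.≤ i → t ≤ x i → x (suc i) + η ≤ x i) →
  ∃[ M ] ∀ i → M ℕ.≤ i → x i ≤ t
eventually-below {x} {t} {η} N 0<η 0≤x stays falls with archimedean (x N) 0<η
... | J , xN<Jη = N ℕ.+ J , λ i N+J≤i →
  subst (λ i → x i ≤ t) (ℕₚ.m+[n∸m]≡n N+J≤i) (from (i ℕ.∸ (N ℕ.+ J)))
  where
  progress : ∀ j → x (N ℕ.+ j) ≤ t ⊎ x (N ℕ.+ j) + j · η ≤ x N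
  progress zero    rewrite ℕₚ.+-identityʳ N = inj₂ (≤-reflexive (+-identityʳ _))
  progress (suc j) rewrite ℕₚ.+-suc N j with progress j | ≤-total (x (N ℕ.+ j)) t
  ... | _         | inj₁ x≤t = inj₁ (stays _ (ℕₚ.m≤m+n N j) x≤t)
  ... | inj₁ x≤t  | inj₂ _   = inj₁ (stays _ (ℕₚ.m≤m+n N j) x≤t)
  ... | inj₂ prev | inj₂ t≤x = inj₂ (≤-trans
    (subst (_≤ x (N ℕ.+ j) + j · η) (+-assoc (x (suc (N ℕ.+ j))) η (j · η))
      (+-monoˡ-≤ (j · η) (falls _ (ℕₚ.m≤m+n N j) t≤x))) prev)

  reached : x (N ℕ.+ J) ≤ t
  reached with progress J
  ... | inj₁ x≤t  = x≤t
  ... | inj₂ fell = ⊥-elim (<-irrefl refl (≤-<-trans fell (<-≤-trans xN<Jη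
          (≤-by (0≤x (N ℕ.+ J)) (+-comm _ (J · η))))))

  from : ∀ j → x (N ℕ.+ J ℕ.+ j) ≤ t
  from zero    rewrite ℕₚ.+-identityʳ (N ℕ.+ J) = reached
  from (suc j) rewrite ℕₚ.+-suc (N ℕ.+ J) j =
    stays _ (ℕₚ.≤-trans (ℕₚ.m≤m+n N J) (ℕₚ.m≤m+n (N ℕ.+ J) j)) (from j)

-- Above the level t, a step lowers x by at least η as soon as e ≤ η = δt/2,
-- so x falls below t after finitely many steps and then stays there.
contraction : ∀ {x e : ℕ → ℚ} {δ} → 0ℚ < δ → δ ≤ 1ℚ → (∀ i → 0ℚ ≤ x i) → Vanishes e →
  (∀ i → x (suc i) ≤ x i - δ * x i + e i) → Vanishes x
contraction {x} {e} {δ} 0<δ δ≤1 0≤x ve step ε 0<ε = proj₁ eventually , λ i M≤i →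
  subst (_< ε) (sym (0≤p⇒∣p∣≡p (0≤x i))) (≤-<-trans (proj₂ eventually i M≤i) (<-by 0<t (½+½ ε)))
  where
  t = ½ * ε
  η = ½ * (δ * t)

  0<t : 0ℚ < t
  0<t = 0<a*b 0<½ 0<ε

  0<η : 0ℚ < η
  0<η = 0<a*b 0<½ (0<a*b 0<δ 0<t)

  stays : ∀ i → e i ≤ η → x i ≤ t → x (suc i) ≤ t
  stays i e≤η xi≤t = ≤-trans (step i) (≤-by
    (0≤a+b (0≤a*b (≤⇒0≤- δ≤1) (≤⇒0≤- xi≤t)) (0≤a+b (<⇒≤ 0<η) (≤⇒0≤- e≤η)))
    (lemma t δ (x i) (e i)))
    where
    lemma : ∀ t δ x e → t ≡ x - δ * x + e + ((1ℚ - δ) * (t - x) + (½ * (δ * t) + (½ * (δ * t) - e)))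
    lemma = solve-∀ ℚ-ring

  falls : ∀ i → e i ≤ η → t ≤ x i → x (suc i) + η ≤ x i
  falls i e≤η t≤xi = ≤-trans (+-monoˡ-≤ η (step i)) (≤-by
    (0≤a+b (0≤a*b (<⇒≤ 0<δ) (≤⇒0≤- t≤xi)) (≤⇒0≤- e≤η))
    (lemma t δ (x i) (e i)))
    where
    lemma : ∀ t δ x e → x ≡ x - δ * x + e + ½ * (δ * t) + (δ * (x - t) + (½ * (δ * t) - e))
    lemma = solve-∀ ℚ-ring

  eventually : ∃[ M ] ∀ i → M ℕ.≤ i → x i ≤ t
  eventually with ve η 0<η
  ... | N , ∣e∣<η = eventually-below N 0<η 0≤x
    (λ i N≤i → stays i (e≤η i N≤i)) (λ i N≤i → falls i (e≤η i N≤i))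
    where
    e≤η : ∀ i → N ℕ.≤ i → e i ≤ η
    e≤η i N≤i = ≤-trans (x≤∣x∣ (e i)) (<⇒≤ (∣e∣<η i N≤i))

-- Finite sums

∑-cong : {A : Set} (xs : List A) {h h′ : A → ℚ} → (∀ x → h x ≡ h′ x) → ∑ xs h ≡ ∑ xs h′
∑-cong []       h≡h′ = refl
∑-cong (x ∷ xs) h≡h′ = cong₂ _+_ (h≡h′ x) (∑-cong xs h≡h′)

∑-0 : {A : Set} (xs : List A) → ∑ xs (λ _ → 0ℚ) ≡ 0ℚ
∑-0 []       = refl
∑-0 (x ∷ xs) = trans (+-identityˡ _) (∑-0 xs)

∑-+ : {A : Set} (xs : List A) (h h′ : A → ℚ) → ∑ xs (λ x → h x + h′ x) ≡ ∑ xs h + ∑ xs h′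
∑-+ []       h h′ = refl
∑-+ (x ∷ xs) h h′ = trans (cong (h x + h′ x +_) (∑-+ xs h h′)) (lemma (h x) (h′ x) (∑ xs h) (∑ xs h′))
  where
  lemma : ∀ a b c d → a + b + (c + d) ≡ a + c + (b + d)
  lemma = solve-∀ ℚ-ring

∑-*ˡ : {A : Set} (c : ℚ) (xs : List A) (h : A → ℚ) → ∑ xs (λ x → c * h x) ≡ c * ∑ xs h
∑-*ˡ c []       h = sym (*-zeroʳ c)
∑-*ˡ c (x ∷ xs) h = trans (cong (c * h x +_) (∑-*ˡ c xs h)) (sym (*-distribˡ-+ c (h x) (∑ xs h)))

∑-*ʳ : {A : Set} (xs : List A) (h : A → ℚ) (c : ℚ) → ∑ xs (λ x → h x * c) ≡ ∑ xs h * c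
∑-*ʳ xs h c = trans (∑-cong xs (λ x → *-comm (h x) c)) (trans (∑-*ˡ c xs h) (*-comm c (∑ xs h)))

∑-++ : {A : Set} (xs ys : List A) (h : A → ℚ) → ∑ (xs ++ ys) h ≡ ∑ xs h + ∑ ys h
∑-++ []       ys h = sym (+-identityˡ _)
∑-++ (x ∷ xs) ys h = trans (cong (h x +_) (∑-++ xs ys h)) (sym (+-assoc (h x) (∑ xs h) (∑ ys h)))

∑-map : {A B : Set} (f : A → B) (xs : List A) (h : B → ℚ) → ∑ (List.map f xs) h ≡ ∑ xs (λ x → h (f x))
∑-map f []       h = refl
∑-map f (x ∷ xs) h = cong (h (f x) +_) (∑-map f xs h)

∑-cartesian : {A B C : Set} (f : A → B → C) (xs : List A) (ys : List B) (h : C → ℚ) →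
  ∑ (cartesianProductWith f xs ys) h ≡ ∑ xs (λ x → ∑ ys (λ y → h (f x y)))
∑-cartesian f []       ys h = refl
∑-cartesian f (x ∷ xs) ys h = trans (∑-++ (List.map (f x) ys) _ h)
  (cong₂ _+_ (∑-map (f x) ys h) (∑-cartesian f xs ys h))

∑-swap : {A B : Set} (xs : List A) (ys : List B) (h : A → B → ℚ) →
  ∑ xs (λ x → ∑ ys (h x)) ≡ ∑ ys (λ y → ∑ xs (λ x → h x y))
∑-swap []       ys h = sym (∑-0 ys)
∑-swap (x ∷ xs) ys h = trans (cong (∑ ys (h x) +_) (∑-swap xs ys h))
  (sym (∑-+ ys (h x) (λ y → ∑ xs (λ x → h x y))))

∑-mono : {A : Set} (xs : List A) {h h′ : A → ℚ} → (∀ x → h x ≤ h′ x) → ∑ xs h ≤ ∑ xs h′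
∑-mono []       h≤h′ = ≤-refl
∑-mono (x ∷ xs) h≤h′ = +-mono-≤ (h≤h′ x) (∑-mono xs h≤h′)

0≤∑ : {A : Set} (xs : List A) {h : A → ℚ} → (∀ x → 0ℚ ≤ h x) → 0ℚ ≤ ∑ xs h
0≤∑ xs {h} 0≤h = subst (_≤ ∑ xs h) (∑-0 xs) (∑-mono xs 0≤h)

∣∑∣≤∑∣∣ : {A : Set} (xs : List A) (h : A → ℚ) → ∣ ∑ xs h ∣ ≤ ∑ xs (λ x → ∣ h x ∣)
∣∑∣≤∑∣∣ []       h = ≤-refl
∣∑∣≤∑∣∣ (x ∷ xs) h = ∣x+y∣≤ {x = h x} ≤-refl (∣∑∣≤∑∣∣ xs h)

≤∑ : {A : Set} {xs : List A} {h : A → ℚ} → (∀ x → 0ℚ ≤ h x) → ∀ {x} → x ∈ xs → h x ≤ ∑ xs h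
≤∑ {xs = x ∷ xs} {h} 0≤h (here refl) = ≤-by (0≤∑ xs 0≤h) refl
≤∑ {xs = x ∷ xs} {h} 0≤h (there x∈)  = ≤-trans (≤∑ 0≤h x∈) (≤-by (0≤h x) (+-comm (h x) _))

∑-vanishes : {A : Set} (xs : List A) {h : ℕ → A → ℚ} → (∀ {x} → x ∈ xs → Vanishes (λ i → h i x)) →
  Vanishes (λ i → ∑ xs (h i))
∑-vanishes []       v = vanishes-0
∑-vanishes (x ∷ xs) v = vanishes-+ (v (here refl)) (∑-vanishes xs (v ∘ there))

-- The indicator of a decidable proposition.
[_] : {P : Set} → Dec P → ℚ
[ d ] = if does d then 1ℚ else 0ℚ

[yes] : {P : Set} (d : Dec P) → P → [ d ] ≡ 1ℚ
[yes] (yes _) p = refl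
[yes] (no ¬p) p = ⊥-elim (¬p p)

[no] : {P : Set} (d : Dec P) → ¬ P → [ d ] ≡ 0ℚ
[no] (yes p) ¬p = ⊥-elim (¬p p)
[no] (no _)  ¬p = refl

[]-cong : {P Q : Set} (d : Dec P) (d′ : Dec Q) → (P → Q) → (Q → P) → [ d ] ≡ [ d′ ]
[]-cong (yes p) d′ to from = sym ([yes] d′ (to p))
[]-cong (no ¬p) d′ to from = sym ([no] d′ (λ q → ¬p (from q)))

0≤[] : {P : Set} (d : Dec P) → 0ℚ ≤ [ d ]
0≤[] (yes _) = 0≤1
0≤[] (no _)  = ≤-refl

∑-filter : {A : Set} {P : A → Set} (P? : ∀ x → Dec (P x)) (xs : List A) (h : A → ℚ) →
  ∑ (filter P? xs) h ≡ ∑ xs (λ x → [ P? x ] * h x)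
∑-filter P? []       h = refl
∑-filter P? (x ∷ xs) h with P? x
... | yes _ = cong₂ _+_ (sym (*-identityˡ (h x))) (∑-filter P? xs h)
... | no  _ = trans (∑-filter P? xs h) (trans (sym (+-identityˡ _))
                (cong (_+ ∑ xs (λ x → [ P? x ] * h x)) (sym (*-zeroˡ (h x)))))

-- Weighted means

-- A finite family of nonnegative weights of total mass one.
record IsWeighting {A : Set} (xs : List A) (w : A → ℚ) : Set where
  field
    0≤w   : ∀ x → 0ℚ ≤ w x
    total : ∑ xs w ≡ 1ℚ

-- The expectation of F for the weights w on the list xs.
𝔼 : {A : Set} (xs : List A) (w : A → ℚ) (F : A → ℚ) → ℚ
𝔼 xs w F = ∑ xs (λ x → w x * F x)

module _ {A : Set} (xs : List A) (w : A → ℚ) where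

  𝔼-cong : ∀ {F G : A → ℚ} → (∀ x → F x ≡ G x) → 𝔼 xs w F ≡ 𝔼 xs w G
  𝔼-cong F≡G = ∑-cong xs (λ x → cong (w x *_) (F≡G x))

  𝔼-+ : ∀ (F G : A → ℚ) → 𝔼 xs w (λ x → F x + G x) ≡ 𝔼 xs w F + 𝔼 xs w G
  𝔼-+ F G = trans (∑-cong xs (λ x → *-distribˡ-+ (w x) (F x) (G x)))
    (∑-+ xs (λ x → w x * F x) (λ x → w x * G x))

  𝔼-*ˡ : ∀ c (F : A → ℚ) → 𝔼 xs w (λ x → c * F x) ≡ c * 𝔼 xs w F
  𝔼-*ˡ c F = trans (∑-cong xs (λ x → lemma (w x) c (F x))) (∑-*ˡ c xs (λ x → w x * F x))
    where
    lemma : ∀ a b c → a * (b * c) ≡ b * (a * c)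
    lemma = solve-∀ ℚ-ring

  𝔼-*ʳ : ∀ (F : A → ℚ) c → 𝔼 xs w (λ x → F x * c) ≡ 𝔼 xs w F * c
  𝔼-*ʳ F c = trans (𝔼-cong (λ x → *-comm (F x) c)) (trans (𝔼-*ˡ c F) (*-comm c (𝔼 xs w F)))

  𝔼-∑ : {B : Set} (ys : List B) (F : A → B → ℚ) →
    𝔼 xs w (λ x → ∑ ys (F x)) ≡ ∑ ys (λ y → 𝔼 xs w (λ x → F x y))
  𝔼-∑ ys F = trans (∑-cong xs (λ x → sym (∑-*ˡ (w x) ys (F x)))) (∑-swap xs ys (λ x y → w x * F x y))

  module _ (isW : IsWeighting xs w) where
    open IsWeighting isW

    𝔼-const : ∀ c → 𝔼 xs w (λ _ → c) ≡ c
    𝔼-const c = trans (∑-*ʳ xs w c) (trans (cong (_* c) total) (*-identityˡ c))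

    𝔼-mono : ∀ {F G : A → ℚ} → (∀ x → F x ≤ G x) → 𝔼 xs w F ≤ 𝔼 xs w G
    𝔼-mono F≤G = ∑-mono xs (λ x → *-monoˡ-≤-nonNeg (w x) {{ℚ.nonNegative (0≤w x)}} (F≤G x))

    ∣𝔼∣≤ : ∀ {F : A → ℚ} {c} → (∀ x → ∣ F x ∣ ≤ c) → ∣ 𝔼 xs w F ∣ ≤ c
    ∣𝔼∣≤ {F} {c} ∣F∣≤c = ≤-trans (∣∑∣≤∑∣∣ xs (λ x → w x * F x))
      (subst (∑ xs (λ x → ∣ w x * F x ∣) ≤_) (𝔼-const c) (∑-mono xs (λ x →
        subst (λ t → ∣ w x * F x ∣ ≤ t * c) (0≤p⇒∣p∣≡p (0≤w x)) (∣x*y∣≤ {x = w x} ≤-refl (∣F∣≤c x)))))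

-- Two means with weights v and w give the mean over pairs in either order.
𝔼-swap : {A B : Set} (xs : List A) (v : A → ℚ) (ys : List B) (w : B → ℚ) (F : A → B → ℚ) →
  𝔼 xs v (λ x → 𝔼 ys w (F x)) ≡ 𝔼 ys w (λ y → 𝔼 xs v (λ x → F x y))
𝔼-swap xs v ys w F = trans (𝔼-∑ xs v ys (λ x y → w y * F x y))
  (∑-cong ys (λ y → 𝔼-*ˡ xs v (w y) (λ x → F x y)))

-- The growth step

cofactor : ∀ {k} {A : Set} → Bool → (Vec Bool (suc k) → A) → Vec Bool k → A
cofactor b f z = f (b ∷ z)

-- Functionals that do not distinguish pointwise equal functions.
Respects : ∀ {n} → (BoolFun n → ℚ) → Set
Respects F = ∀ {f g} → f ≗ g → F f ≡ F g

cofactors-≗ : ∀ {n} {f₀ f₁ g₀ g₁ : BoolFun n} → f₀ ≗ g₀ → f₁ ≗ g₁ → cofactors f₀ f₁ ≗ cofactors g₀ g₁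
cofactors-≗ e₀ e₁ (false ∷ y) = e₀ y
cofactors-≗ e₀ e₁ (true ∷ y)  = e₁ y

cofactors-η : ∀ {n} (g : BoolFun (suc n)) → cofactors (cofactor false g) (cofactor true g) ≗ g
cofactors-η g (false ∷ y) = refl
cofactors-η g (true ∷ y)  = refl

[≗]-cofactors : ∀ {n} (g : BoolFun (suc n)) (f₀ f₁ : BoolFun n) →
  [ g ≗? cofactors f₀ f₁ ] ≡ [ cofactor false g ≗? f₀ ] * [ cofactor true g ≗? f₁ ]
[≗]-cofactors g f₀ f₁ = lemma (cofactor false g ≗? f₀) (cofactor true g ≗? f₁)
  where
  lemma : {P Q : Set} (d : Dec P) (d′ : Dec Q) → [ d ×-dec d′ ] ≡ [ d ] * [ d′ ]
  lemma (yes _) (yes _) = refl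
  lemma (yes _) (no _)  = refl
  lemma (no _)  (yes _) = refl
  lemma (no _)  (no _)  = refl

-- Every function is listed exactly once, up to pointwise equality.
∑-allFuns : ∀ {n} (g : BoolFun n) (F : BoolFun n → ℚ) → Respects F →
  ∑ (allFuns n) (λ f → [ g ≗? f ] * F f) ≡ F g
∑-allFuns {zero} g F resp with g [] in g[]
... | false = trans (lemma (F (λ _ → false)) (F (λ _ → true))) (resp λ { [] → sym g[] })
  where
  lemma : ∀ a b → 1ℚ * a + (0ℚ * b + 0ℚ) ≡ a
  lemma = solve-∀ ℚ-ring
... | true = trans (lemma (F (λ _ → false)) (F (λ _ → true))) (resp λ { [] → sym g[] })
  where
  lemma : ∀ a b → 0ℚ * a + (1ℚ * b + 0ℚ) ≡ b
  lemma = solve-∀ ℚ-ring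
∑-allFuns {suc n} g F resp = begin
  ∑ (allFuns (suc n)) (λ f → [ g ≗? f ] * F f)
    ≡⟨ ∑-cartesian cofactors (allFuns n) (allFuns n) (λ f → [ g ≗? f ] * F f) ⟩
  ∑ (allFuns n) (λ f₀ → ∑ (allFuns n) (λ f₁ → [ g ≗? cofactors f₀ f₁ ] * F (cofactors f₀ f₁)))
    ≡⟨ ∑-cong (allFuns n) (λ f₀ → trans (∑-cong (allFuns n) (λ f₁ → split f₀ f₁)) (∑-*ˡ [ g₀ ≗? f₀ ] (allFuns n) (λ f₁ → [ g₁ ≗? f₁ ] * F (cofactors f₀ f₁)))) ⟩
  ∑ (allFuns n) (λ f₀ → [ g₀ ≗? f₀ ] * ∑ (allFuns n) (λ f₁ → [ g₁ ≗? f₁ ] * F (cofactors f₀ f₁)))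
    ≡⟨ ∑-cong (allFuns n) (λ f₀ → cong ([ g₀ ≗? f₀ ] *_)
         (∑-allFuns g₁ (λ f₁ → F (cofactors f₀ f₁)) (λ e → resp (cofactors-≗ (λ _ → refl) e)))) ⟩
  ∑ (allFuns n) (λ f₀ → [ g₀ ≗? f₀ ] * F (cofactors f₀ g₁))
    ≡⟨ ∑-allFuns g₀ (λ f₀ → F (cofactors f₀ g₁)) (λ e → resp (cofactors-≗ e (λ _ → refl))) ⟩
  F (cofactors g₀ g₁)
    ≡⟨ resp (cofactors-η g) ⟩
  F g ∎
  where
  open ≡-Reasoning
  g₀ = cofactor false g
  g₁ = cofactor true g
  split : ∀ f₀ f₁ → [ g ≗? cofactors f₀ f₁ ] * F (cofactors f₀ f₁)
                  ≡ [ g₀ ≗? f₀ ] * ([ g₁ ≗? f₁ ] * F (cofactors f₀ f₁))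
  split f₀ f₁ = trans (cong (_* F (cofactors f₀ f₁)) ([≗]-cofactors g f₀ f₁)) 
    (*-assoc [ g₀ ≗? f₀ ] [ g₁ ≗? f₁ ] (F (cofactors f₀ f₁)))

-- The expectation of F g for g drawn from p.
E : ∀ {n} → Mass n → (BoolFun n → ℚ) → ℚ
E {n} p = 𝔼 (allFuns n) p

-- The expectation of F g₁ … gₖ for independent draws from p.
E^ : ∀ {n} → Mass n → ∀ k → (Vec (BoolFun n) k → ℚ) → ℚ
E^ {n} p k = 𝔼 (tuples (allFuns n) k) (joint p)

E^-suc : ∀ {n} (p : Mass n) k (F : Vec (BoolFun n) (suc k) → ℚ) →
  E^ p (suc k) F ≡ E p (λ g → E^ p k (λ gs → F (g ∷ gs)))
E^-suc {n} p k F = trans (∑-cartesian _∷_ (allFuns n) (tuples (allFuns n) k) (λ gs → joint p gs * F gs))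
  (∑-cong (allFuns n) (λ g → trans
    (∑-cong (tuples (allFuns n) k) (λ gs → *-assoc (p g) (joint p gs) (F (g ∷ gs))))
    (∑-*ˡ (p g) (tuples (allFuns n) k) (λ gs → joint p gs * F (g ∷ gs)))))

E^-suc′ : ∀ {n} (p : Mass n) k (F : Vec (BoolFun n) (suc k) → ℚ) →
  E^ p (suc k) F ≡ E^ p k (λ gs → E p (λ g → F (g ∷ gs)))
E^-suc′ {n} p k F = trans (E^-suc p k F)
  (𝔼-swap (allFuns n) p (tuples (allFuns n) k) (joint p) (λ g gs → F (g ∷ gs)))

isWeighting : ∀ {n} {p : Mass n} → IsDistribution p → IsWeighting (allFuns n) p
isWeighting isD = record { 0≤w = nonnegative ; total = total }
  where open IsDistribution isD

joint-isWeighting : ∀ {n} {p : Mass n} → IsDistribution p → ∀ k → IsWeighting (tuples (allFuns n) k) (joint p)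
joint-isWeighting {n} {p} isD k = record { 0≤w = 0≤joint ; total = trans (sym (E^1 k)) (total k) }
  where
  open IsDistribution isD using (nonnegative)
  0≤joint : ∀ {k} (gs : Vec (BoolFun n) k) → 0ℚ ≤ joint p gs
  0≤joint []       = 0≤1
  0≤joint (g ∷ gs) = 0≤a*b (nonnegative g) (0≤joint gs)

  E^1 : ∀ k → E^ p k (λ _ → 1ℚ) ≡ ∑ (tuples (allFuns n) k) (joint p)
  E^1 k = ∑-cong (tuples (allFuns n) k) (λ gs → *-identityʳ (joint p gs))

  total : ∀ k → E^ p k (λ _ → 1ℚ) ≡ 1ℚ
  total zero    = refl
  total (suc k) = trans (E^-suc p k (λ _ → 1ℚ)) (trans
    (𝔼-cong (allFuns n) p (λ _ → total k)) (𝔼-const (allFuns n) p (isWeighting isD) 1ℚ))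

-- One step of the growth process.
step : ∀ {k n} → BoolFun k → Mass n → Mass n
step {k} {n} α p f = ∑ (filter (λ gs → compose α gs ≗? f) (tuples (allFuns n) k)) (joint p)

step-[] : ∀ {k n} (α : BoolFun k) (p : Mass n) f → step α p f ≡ E^ p k (λ gs → [ compose α gs ≗? f ])
step-[] {k} {n} α p f = trans (∑-filter (λ gs → compose α gs ≗? f) (tuples (allFuns n) k) (joint p))
  (∑-cong (tuples (allFuns n) k) (λ gs → *-comm [ compose α gs ≗? f ] (joint p gs)))

-- The law after a step is the law of the composed function.
E-step : ∀ {k n} (α : BoolFun k) (p : Mass n) (F : BoolFun n → ℚ) → Respects F →
  E (step α p) F ≡ E^ p k (λ gs → F (compose α gs))
E-step {k} {n} α p F resp = begin
  E (step α p) F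
    ≡⟨ ∑-cong (allFuns n) (λ f → trans (cong (_* F f) (step-[] α p f))
         (sym (𝔼-*ʳ (tuples (allFuns n) k) (joint p) (λ gs → [ compose α gs ≗? f ]) (F f)))) ⟩
  ∑ (allFuns n) (λ f → E^ p k (λ gs → [ compose α gs ≗? f ] * F f))
    ≡⟨ sym (𝔼-∑ (tuples (allFuns n) k) (joint p) (allFuns n) (λ gs f → [ compose α gs ≗? f ] * F f)) ⟩
  E^ p k (λ gs → ∑ (allFuns n) (λ f → [ compose α gs ≗? f ] * F f))
    ≡⟨ 𝔼-cong (tuples (allFuns n) k) (joint p) (λ gs → ∑-allFuns (compose α gs) F resp) ⟩
  E^ p k (λ gs → F (compose α gs)) ∎
  where open ≡-Reasoning

step-isDistribution : ∀ {k n} (α : BoolFun k) {p : Mass n} → IsDistribution p → IsDistribution (step α p)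
step-isDistribution {k} {n} α {p} isD = record
  { respects    = λ {f} {g} f≗g → trans (step-[] α p f) (trans
      (𝔼-cong (tuples (allFuns n) k) (joint p) (λ gs → []-cong (compose α gs ≗? f) (compose α gs ≗? g)
        (λ e y → trans (e y) (f≗g y)) (λ e y → trans (e y) (sym (f≗g y)))))
      (sym (step-[] α p g)))
  ; nonnegative = λ f → subst (0ℚ ≤_) (sym (step-[] α p f))
      (0≤∑ (tuples (allFuns n) k) (λ gs → 0≤a*b (IsWeighting.0≤w jW gs) (0≤[] (compose α gs ≗? f))))
  ; total       = trans (∑-cong (allFuns n) (λ f → sym (*-identityʳ (step α p f)))) (trans
      (E-step α p (λ _ → 1ℚ) (λ _ → refl)) (𝔼-const (tuples (allFuns n) k) (joint p) jW 1ℚ))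
  }
  where
  jW = joint-isWeighting isD k

growth-isDistribution : ∀ {k n} {μ : Mass n} → IsDistribution μ → (α : BoolFun k) → ∀ i → IsDistribution (growth μ α i)
growth-isDistribution isD α zero    = isD
growth-isDistribution isD α (suc i) = step-isDistribution α (growth-isDistribution isD α i)

-- Self-duality is preserved

-- All functions outside Q have mass zero.
AlmostSurely : ∀ {n} → (BoolFun n → Set) → Mass n → Set
AlmostSurely Q p = ∀ f → Q f ⊎ p f ≡ 0ℚ

step-almostSurely : ∀ {k n} (α : BoolFun k) {p : Mass n} (Q : BoolFun n → Set) →
  (∀ {f g} → f ≗ g → Q f → Q g) →
  (∀ gs → (∀ j → Q (lookup gs j)) → Q (compose α gs)) →
  AlmostSurely Q p → AlmostSurely Q (step α p)
step-almostSurely {k} {n} α {p} Q resp closed asQ f = any (tuples (allFuns n) k)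
  where
  joint-Q : ∀ {k} (gs : Vec (BoolFun n) k) → (∀ j → Q (lookup gs j)) ⊎ joint p gs ≡ 0ℚ
  joint-Q []       = inj₁ λ ()
  joint-Q (g ∷ gs) with asQ g | joint-Q gs
  ... | inj₂ pg≡0 | _         = inj₂ (trans (cong (_* joint p gs) pg≡0) (*-zeroˡ (joint p gs)))
  ... | inj₁ _    | inj₂ js≡0 = inj₂ (trans (cong (p g *_) js≡0) (*-zeroʳ (p g)))
  ... | inj₁ Qg   | inj₁ Qgs  = inj₁ λ { zero → Qg ; (suc j) → Qgs j }

  any : ∀ xs → Q f ⊎ ∑ (filter (λ gs → compose α gs ≗? f) xs) (joint p) ≡ 0ℚ
  any []        = inj₂ refl
  any (gs ∷ xs) with compose α gs ≗? f | any xs | joint-Q gs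
  ... | _       | inj₁ Qf  | _         = inj₁ Qf
  ... | yes e   | inj₂ _   | inj₁ Qgs  = inj₁ (resp e (closed gs Qgs))
  ... | yes _   | inj₂ s≡0 | inj₂ j≡0  = inj₂ (cong₂ _+_ j≡0 s≡0)
  ... | no _    | inj₂ s≡0 | _         = inj₂ s≡0

SelfDual-resp : ∀ {n} {f g : BoolFun n} → f ≗ g → SelfDual f → SelfDual g
SelfDual-resp f≗g sd y = trans (sym (f≗g y)) (trans (sd y) (cong not (f≗g (Vec.map not y))))

SelfDual-compose : ∀ {k n} {α : BoolFun k} → SelfDual α → (gs : Vec (BoolFun n) k) →
  (∀ j → SelfDual (lookup gs j)) → SelfDual (compose α gs)
SelfDual-compose {α = α} sdα gs sd y = trans (sdα _) (cong (λ z → not (α z)) (flip gs sd))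
  where
  flip : ∀ {k} (gs : Vec (BoolFun _) k) → (∀ j → SelfDual (lookup gs j)) →
    Vec.map not (Vec.map (λ g → g y) gs) ≡ Vec.map (λ g → g (Vec.map not y)) gs
  flip []       sd = refl
  flip (g ∷ gs) sd = cong₂ _∷_
    (trans (cong not (sd zero y)) (not-involutive _)) (flip gs (λ j → sd (suc j)))

growth-selfDual : ∀ {k n} {μ : Mass n} {α : BoolFun k} → SelfDual α → AlmostSurely SelfDual μ →
  ∀ i → AlmostSurely SelfDual (growth μ α i)
growth-selfDual sdα as zero    = as
growth-selfDual {α = α} sdα as (suc i) =
  step-almostSurely α SelfDual SelfDual-resp (SelfDual-compose sdα) (growth-selfDual sdα as i)

-- Amplification

bit : Bool → ℚ
bit b = if b then 1ℚ else 0ℚ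

-- The probability that α outputs true on independent inputs, each true with
-- probability p.
amp : ∀ {k} → BoolFun k → ℚ → ℚ
amp {zero}  α p = bit (α [])
amp {suc k} α p = (1ℚ - p) * amp (cofactor false α) p + p * amp (cofactor true α) p

amp-cong : ∀ {k} {α β : BoolFun k} → α ≗ β → ∀ p → amp α p ≡ amp β p
amp-cong {zero}  α≗β p = cong bit (α≗β [])
amp-cong {suc k} α≗β p = cong₂ (λ a b → (1ℚ - p) * a + p * b)
  (amp-cong (α≗β ∘ (false ∷_)) p) (amp-cong (α≗β ∘ (true ∷_)) p)

amp-const : ∀ {k} b p → amp {k} (λ _ → b) p ≡ bit b
amp-const {zero}  b p = refl
amp-const {suc k} b p = trans (cong₂ (λ x y → (1ℚ - p) * x + p * y) (amp-const {k} b p) (amp-const {k} b p))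
  (lemma p (bit b))
  where
  lemma : ∀ p x → (1ℚ - p) * x + p * x ≡ x
  lemma = solve-∀ ℚ-ring

0≤amp : ∀ {k} (α : BoolFun k) {p} → 0ℚ ≤ p → p ≤ 1ℚ → 0ℚ ≤ amp α p
0≤amp {zero} α _ _ with α []
... | true  = 0≤1
... | false = ≤-refl
0≤amp {suc k} α 0≤p p≤1 = 0≤a+b (0≤a*b (≤⇒0≤- p≤1) (0≤amp (cofactor false α) 0≤p p≤1))
                                 (0≤a*b 0≤p (0≤amp (cofactor true α) 0≤p p≤1))

-- The dual of α is amplified symmetrically about p = 1/2.
amp-dual : ∀ {k} (α : BoolFun k) p → amp (λ z → not (α (Vec.map not z))) p ≡ 1ℚ - amp α (1ℚ - p)
amp-dual {zero} α p with α []
... | true  = refl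
... | false = refl
amp-dual {suc k} α p = trans
  (cong₂ (λ x y → (1ℚ - p) * x + p * y) (amp-dual (cofactor true α) p) (amp-dual (cofactor false α) p))
  (lemma p (amp (cofactor false α) (1ℚ - p)) (amp (cofactor true α) (1ℚ - p)))
  where
  lemma : ∀ p a b → (1ℚ - p) * (1ℚ - b) + p * (1ℚ - a) ≡ 1ℚ - ((1ℚ - (1ℚ - p)) * a + (1ℚ - p) * b)
  lemma = solve-∀ ℚ-ring

amp≤1 : ∀ {k} (α : BoolFun k) {p} → 0ℚ ≤ p → p ≤ 1ℚ → amp α p ≤ 1ℚ
amp≤1 {zero} α _ _ with α []
... | true  = ≤-refl
... | false = 0≤1
amp≤1 {suc k} α {p} 0≤p p≤1 = ≤-by
  (0≤a+b (0≤a*b (≤⇒0≤- p≤1) (≤⇒0≤- (amp≤1 (cofactor false α) 0≤p p≤1)))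
         (0≤a*b 0≤p (≤⇒0≤- (amp≤1 (cofactor true α) 0≤p p≤1))))
  (lemma p (amp (cofactor false α) p) (amp (cofactor true α) p))
  where
  lemma : ∀ p a b → 1ℚ ≡ (1ℚ - p) * a + p * b + ((1ℚ - p) * (1ℚ - a) + p * (1ℚ - b))
  lemma = solve-∀ ℚ-ring

amp-0 : ∀ {k} (α : BoolFun k) → amp α 0ℚ ≡ bit (α (Vec.replicate k false))
amp-0 {zero}  α = refl
amp-0 {suc k} α = trans (lemma (amp (cofactor false α) 0ℚ) (amp (cofactor true α) 0ℚ)) (amp-0 (cofactor false α))
  where
  lemma : ∀ a b → (1ℚ - 0ℚ) * a + 0ℚ * b ≡ a
  lemma = solve-∀ ℚ-ring

-- Pointwise order; a pointwise strictly larger function is amplified more.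
_⊑_ : ∀ {k} → BoolFun k → BoolFun k → Set
α ⊑ β = ∀ z → α z Bool.≤ β z

≗-or-amp< : ∀ {k} {α β : BoolFun k} → α ⊑ β →
  α ≗ β ⊎ (∀ p → 0ℚ < p → p < 1ℚ → amp α p < amp β p)
≗-or-amp< {zero} {α} {β} α⊑β with α [] in eqα | β [] in eqβ | α⊑β []
... | false | true  | _ = inj₂ λ _ _ _ → 0<1
... | false | false | _ = inj₁ λ { [] → trans eqα (sym eqβ) }
... | true  | true  | _ = inj₁ λ { [] → trans eqα (sym eqβ) }
≗-or-amp< {suc k} {α} {β} α⊑β
  with ≗-or-amp< {α = cofactor false α} {cofactor false β} (α⊑β ∘ (false ∷_))
     | ≗-or-amp< {α = cofactor true α} {cofactor true β} (α⊑β ∘ (true ∷_))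
... | inj₁ e₀ | inj₁ e₁ = inj₁ λ { (false ∷ z) → e₀ z ; (true ∷ z) → e₁ z }
... | inj₁ e₀ | inj₂ l₁ = inj₂ λ p 0<p p<1 → +-mono-≤-<
        (≤-reflexive (cong ((1ℚ - p) *_) (amp-cong e₀ p)))
        (*-monoʳ-<-pos p {{ℚ.positive 0<p}} (l₁ p 0<p p<1))
... | inj₂ l₀ | inj₁ e₁ = inj₂ λ p 0<p p<1 → +-mono-<-≤
        (*-monoʳ-<-pos (1ℚ - p) {{ℚ.positive (<⇒0<- p<1)}} (l₀ p 0<p p<1))
        (≤-reflexive (cong (p *_) (amp-cong e₁ p)))
... | inj₂ l₀ | inj₂ l₁ = inj₂ λ p 0<p p<1 → +-mono-<
        (*-monoʳ-<-pos (1ℚ - p) {{ℚ.positive (<⇒0<- p<1)}} (l₀ p 0<p p<1))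
        (*-monoʳ-<-pos p {{ℚ.positive 0<p}} (l₁ p 0<p p<1))

amp-mono : ∀ {k} {α β : BoolFun k} → α ⊑ β → ∀ {p} → 0ℚ < p → p < 1ℚ → amp α p ≤ amp β p
amp-mono α⊑β {p} 0<p p<1 with ≗-or-amp< α⊑β
... | inj₁ e = ≤-reflexive (amp-cong e p)
... | inj₂ l = <⇒≤ (l p 0<p p<1)

≤ᵇ-refl : ∀ {k} {z : Vec Bool k} → Pointwise Bool._≤_ z z
≤ᵇ-refl = Pointwise.refl Bool.b≤b

Monotone-cofactor : ∀ {k} {α : BoolFun (suc k)} → Monotone α → ∀ b → Monotone (cofactor b α)
Monotone-cofactor mono b z≤z′ = mono (Bool.b≤b ∷ z≤z′)

cofactors-⊑ : ∀ {k} {α : BoolFun (suc k)} → Monotone α → cofactor false α ⊑ cofactor true α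
cofactors-⊑ mono z = mono (Bool.f≤t ∷ ≤ᵇ-refl)

-- Odds under amplification

-- For r = p(1-q) and t = q(1-p), nonnegativity of oddsGap r t x y says that
-- the odds ratio of y to x is at least that of q to p.
oddsGap : ℚ → ℚ → ℚ → ℚ → ℚ
oddsGap r t x y = r * (1ℚ - x) * y - t * x * (1ℚ - y)

-- The part of the gap that comes from a first input on which the two copies
-- disagree.
mixedGap : ℚ → ℚ → ℚ → ℚ → ℚ → ℚ → ℚ
mixedGap r t a₀ a₁ b₀ b₁ =
  t * (b₁ * (r * (1ℚ - a₀) + t * a₀) - t * a₀) + r * (b₀ * (r * (1ℚ - a₁) + t * a₁) - t * a₁)

oddsGap-split : ∀ p q a₀ a₁ b₀ b₁ →
  oddsGap (p * (1ℚ - q)) (q * (1ℚ - p)) ((1ℚ - p) * a₀ + p * a₁) ((1ℚ - q) * b₀ + q * b₁)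
  ≡ (1ℚ - p) * (1ℚ - q) * oddsGap (p * (1ℚ - q)) (q * (1ℚ - p)) a₀ b₀
    + p * q * oddsGap (p * (1ℚ - q)) (q * (1ℚ - p)) a₁ b₁
    + mixedGap (p * (1ℚ - q)) (q * (1ℚ - p)) a₀ a₁ b₀ b₁
oddsGap-split = expanded
  where
  expanded : ∀ p q a₀ a₁ b₀ b₁ →
    p * (1ℚ - q) * (1ℚ - ((1ℚ - p) * a₀ + p * a₁)) * ((1ℚ - q) * b₀ + q * b₁)
      - q * (1ℚ - p) * ((1ℚ - p) * a₀ + p * a₁) * (1ℚ - ((1ℚ - q) * b₀ + q * b₁))
    ≡ (1ℚ - p) * (1ℚ - q) * (p * (1ℚ - q) * (1ℚ - a₀) * b₀ - q * (1ℚ - p) * a₀ * (1ℚ - b₀))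
      + p * q * (p * (1ℚ - q) * (1ℚ - a₁) * b₁ - q * (1ℚ - p) * a₁ * (1ℚ - b₁))
      + (q * (1ℚ - p) * (b₁ * (p * (1ℚ - q) * (1ℚ - a₀) + q * (1ℚ - p) * a₀) - q * (1ℚ - p) * a₀)
        + p * (1ℚ - q) * (b₀ * (p * (1ℚ - q) * (1ℚ - a₁) + q * (1ℚ - p) * a₁) - q * (1ℚ - p) * a₁))
  expanded = solve-∀ ℚ-ring

-- With d = r(1-a) + ta, a nonnegative gap between a and b means b ≥ ta/d.
-- Substituting these bounds makes d₀d₁ times the mixed gap a sum of
-- nonnegative terms.
mixedGap-certificate : ∀ r t a₀ a₁ b₀ b₁ →
  (r * (1ℚ - a₀) + t * a₀) * (r * (1ℚ - a₁) + t * a₁) * mixedGap r t a₀ a₁ b₀ b₁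
  ≡ t * ((r * (1ℚ - a₀) + t * a₀) * (r * (1ℚ - a₀) + t * a₀)) * oddsGap r t a₁ b₁
    + r * ((r * (1ℚ - a₁) + t * a₁) * (r * (1ℚ - a₁) + t * a₁)) * oddsGap r t a₀ b₀
    + t * r * (t - r) * (a₁ - a₀) * (r * (1ℚ - a₁) + (r * a₀ + (t - r) * a₀))
mixedGap-certificate = expanded
  where
  expanded : ∀ r t a₀ a₁ b₀ b₁ →
    (r * (1ℚ - a₀) + t * a₀) * (r * (1ℚ - a₁) + t * a₁)
      * (t * (b₁ * (r * (1ℚ - a₀) + t * a₀) - t * a₀) + r * (b₀ * (r * (1ℚ - a₁) + t * a₁) - t * a₁))
    ≡ t * ((r * (1ℚ - a₀) + t * a₀) * (r * (1ℚ - a₀) + t * a₀)) * (r * (1ℚ - a₁) * b₁ - t * a₁ * (1ℚ - b₁))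
      + r * ((r * (1ℚ - a₁) + t * a₁) * (r * (1ℚ - a₁) + t * a₁)) * (r * (1ℚ - a₀) * b₀ - t * a₀ * (1ℚ - b₀))
      + t * r * (t - r) * (a₁ - a₀) * (r * (1ℚ - a₁) + (r * a₀ + (t - r) * a₀))
  expanded = solve-∀ ℚ-ring

module _ {r t a₀ a₁ b₀ b₁ : ℚ} (0<r : 0ℚ < r) (r≤t : r ≤ t) (0≤a₀ : 0ℚ ≤ a₀) (a₀≤a₁ : a₀ ≤ a₁) (a₁≤1 : a₁ ≤ 1ℚ)
  (gap₀ : 0ℚ ≤ oddsGap r t a₀ b₀) (gap₁ : 0ℚ ≤ oddsGap r t a₁ b₁) where

  private
    0<t : 0ℚ < t
    0<t = <-≤-trans 0<r r≤t

    0<d : ∀ {a} → 0ℚ ≤ a → 0ℚ < r * (1ℚ - a) + t * a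
    0<d {a} 0≤a = subst (0ℚ <_) (lemma r t a) (0<a+b 0<r (0≤a*b (≤⇒0≤- r≤t) 0≤a))
      where
      lemma : ∀ r t a → r + (t - r) * a ≡ r * (1ℚ - a) + t * a
      lemma = solve-∀ ℚ-ring

    0<d₀d₁ : 0ℚ < (r * (1ℚ - a₀) + t * a₀) * (r * (1ℚ - a₁) + t * a₁)
    0<d₀d₁ = 0<a*b (0<d 0≤a₀) (0<d (≤-trans 0≤a₀ a₀≤a₁))

    0≤first : 0ℚ ≤ t * ((r * (1ℚ - a₀) + t * a₀) * (r * (1ℚ - a₀) + t * a₀)) * oddsGap r t a₁ b₁
                   + r * ((r * (1ℚ - a₁) + t * a₁) * (r * (1ℚ - a₁) + t * a₁)) * oddsGap r t a₀ b₀
    0≤first = 0≤a+b (0≤a*b (0≤a*b (<⇒≤ 0<t) (0≤a² (r * (1ℚ - a₀) + t * a₀))) gap₁)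
                    (0≤a*b (0≤a*b (<⇒≤ 0<r) (0≤a² (r * (1ℚ - a₁) + t * a₁))) gap₀)

  0≤mixedGap : 0ℚ ≤ mixedGap r t a₀ a₁ b₀ b₁
  0≤mixedGap = cancel-0≤ 0<d₀d₁ (subst (0ℚ ≤_) (sym (mixedGap-certificate r t a₀ a₁ b₀ b₁))
    (0≤a+b 0≤first
      (0≤a*b (0≤a*b (0≤a*b (0≤a*b (<⇒≤ 0<t) (<⇒≤ 0<r)) (≤⇒0≤- r≤t)) (≤⇒0≤- a₀≤a₁))
        (0≤a+b (0≤a*b (<⇒≤ 0<r) (≤⇒0≤- a₁≤1)) (0≤a+b (0≤a*b (<⇒≤ 0<r) 0≤a₀) (0≤a*b (≤⇒0≤- r≤t) 0≤a₀))))))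

  0<mixedGap : r < t → a₀ < a₁ → 0ℚ < a₀ ⊎ a₁ < 1ℚ → 0ℚ < mixedGap r t a₀ a₁ b₀ b₁
  0<mixedGap r<t a₀<a₁ a₀≢0⊎a₁≢1 = cancel-0< 0<d₀d₁ (subst (0ℚ <_) (sym (mixedGap-certificate r t a₀ a₁ b₀ b₁))
    (+-mono-≤-< 0≤first
      (0<a*b (0<a*b (0<a*b (0<a*b 0<t 0<r) (<⇒0<- r<t)) (<⇒0<- a₀<a₁)) (last a₀≢0⊎a₁≢1))))
    where
    last : 0ℚ < a₀ ⊎ a₁ < 1ℚ → 0ℚ < r * (1ℚ - a₁) + (r * a₀ + (t - r) * a₀)
    last (inj₁ 0<a₀) = +-mono-≤-< (0≤a*b (<⇒≤ 0<r) (≤⇒0≤- a₁≤1)) (0<a+b (0<a*b 0<r 0<a₀) (0≤a*b (≤⇒0≤- r≤t) 0≤a₀))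
    last (inj₂ a₁<1) = 0<a+b (0<a*b 0<r (<⇒0<- a₁<1)) (0≤a+b (0≤a*b (<⇒≤ 0<r) 0≤a₀) (0≤a*b (≤⇒0≤- r≤t) 0≤a₀))

module _ {p q : ℚ} (0<p : 0ℚ < p) (p≤q : p ≤ q) (q<1 : q < 1ℚ) where

  private
    r = p * (1ℚ - q)
    t = q * (1ℚ - p)
    p<1 = ≤-<-trans p≤q q<1
    0<q = <-≤-trans 0<p p≤q

    t-r : ∀ p q → q * (1ℚ - p) ≡ p * (1ℚ - q) + (q - p)
    t-r = solve-∀ ℚ-ring

    0<r : 0ℚ < r
    0<r = 0<a*b 0<p (<⇒0<- q<1)

    r≤t : r ≤ t
    r≤t = ≤-by (≤⇒0≤- p≤q) (t-r p q)

    0≤weights : ∀ {x y} → 0ℚ ≤ x → 0ℚ ≤ y → 0ℚ ≤ (1ℚ - p) * (1ℚ - q) * x + p * q * y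
    0≤weights 0≤x 0≤y = 0≤a+b (0≤a*b (0≤a*b (<⇒≤ (<⇒0<- p<1)) (<⇒≤ (<⇒0<- q<1))) 0≤x)
                              (0≤a*b (0≤a*b (<⇒≤ 0<p) (<⇒≤ 0<q)) 0≤y)

  -- The odds of a monotone function grow at least as fast as the odds of its
  -- inputs: the two-point form of the Moore-Shannon inequality.
  0≤oddsGap : ∀ {k} {α : BoolFun k} → Monotone α → 0ℚ ≤ oddsGap r t (amp α p) (amp α q)
  0≤oddsGap {zero} {α} mono with α []
  ... | true  = ≤-reflexive (lemma r t)
    where
    lemma : ∀ r t → 0ℚ ≡ r * (1ℚ - 1ℚ) * 1ℚ - t * 1ℚ * (1ℚ - 1ℚ)
    lemma = solve-∀ ℚ-ring
  ... | false = ≤-reflexive (lemma r t)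
    where
    lemma : ∀ r t → 0ℚ ≡ r * (1ℚ - 0ℚ) * 0ℚ - t * 0ℚ * (1ℚ - 0ℚ)
    lemma = solve-∀ ℚ-ring
  0≤oddsGap {suc k} {α} mono =
    subst (0ℚ ≤_) (sym (oddsGap-split p q (a₀ p) (a₁ p) (a₀ q) (a₁ q)))
      (0≤a+b (0≤weights gap₀ gap₁)
        (0≤mixedGap 0<r r≤t (0≤amp (cofactor false α) (<⇒≤ 0<p) (<⇒≤ p<1)) (amp-mono (cofactors-⊑ mono) 0<p p<1)
          (amp≤1 (cofactor true α) (<⇒≤ 0<p) (<⇒≤ p<1)) gap₀ gap₁))
    where
    a₀ = amp (cofactor false α)
    a₁ = amp (cofactor true α)
    gap₀ = 0≤oddsGap (Monotone-cofactor {α = α} mono false)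
    gap₁ = 0≤oddsGap (Monotone-cofactor {α = α} mono true)

  -- The growth is strict unless α is constant or a projection.  The cofactors
  -- for the first input are equal, or are the two constants, or differ in a way
  -- that makes the mixed gap positive.
  0<oddsGap : ∀ {k} {α : BoolFun k} → p < q → Monotone α →
    (∃[ b ] (∀ z → α z ≡ b)) ⊎ IsProjection α ⊎ 0ℚ < oddsGap r t (amp α p) (amp α q)
  0<oddsGap {zero} {α} p<q mono = inj₁ (α [] , λ { [] → refl })
  0<oddsGap {suc k} {α} p<q mono with ≗-or-amp< (cofactors-⊑ mono)
  ... | inj₁ α₀≗α₁ = lift (0<oddsGap p<q (Monotone-cofactor {α = α} mono false))
    where
    α≗α₀ : ∀ b z → α (b ∷ z) ≡ α (false ∷ z)
    α≗α₀ false z = refl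
    α≗α₀ true  z = sym (α₀≗α₁ z)

    amp-α₀ : ∀ p → amp (cofactor false α) p ≡ amp α p
    amp-α₀ p = trans (lemma p (amp (cofactor false α) p))
      (cong (λ x → (1ℚ - p) * amp (cofactor false α) p + p * x) (amp-cong α₀≗α₁ p))
      where
      lemma : ∀ p a → a ≡ (1ℚ - p) * a + p * a
      lemma = solve-∀ ℚ-ring

    lift : (∃[ b ] (∀ z → α (false ∷ z) ≡ b)) ⊎ IsProjection (cofactor false α)
             ⊎ 0ℚ < oddsGap r t (amp (cofactor false α) p) (amp (cofactor false α) q) →
           (∃[ b ] (∀ z → α z ≡ b)) ⊎ IsProjection α ⊎ 0ℚ < oddsGap r t (amp α p) (amp α q)
    lift (inj₁ (b , const))      = inj₁ (b , λ { (b′ ∷ z) → trans (α≗α₀ b′ z) (const z) })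
    lift (inj₂ (inj₁ (j , proj))) = inj₂ (inj₁ (suc j , λ { (b′ ∷ z) → trans (α≗α₀ b′ z) (proj z) }))
    lift (inj₂ (inj₂ 0<gap))     = inj₂ (inj₂ (subst₂ (λ x y → 0ℚ < oddsGap r t x y) (amp-α₀ p) (amp-α₀ q) 0<gap))
  ... | inj₂ α₀<α₁ = outer (≗-or-amp< {α = λ _ → false} {cofactor false α} (λ z → false-least (α (false ∷ z))))
                           (≗-or-amp< {α = cofactor true α} {λ _ → true} (λ z → true-greatest (α (true ∷ z))))
    where
    false-least : ∀ b → false Bool.≤ b
    false-least false = Bool.b≤b
    false-least true  = Bool.f≤t

    true-greatest : ∀ b → b Bool.≤ true
    true-greatest false = Bool.f≤t
    true-greatest true  = Bool.b≤b

    a₀ = amp (cofactor false α)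
    a₁ = amp (cofactor true α)

    strict : 0ℚ < a₀ p ⊎ a₁ p < 1ℚ → 0ℚ < oddsGap r t (amp α p) (amp α q)
    strict nondegenerate = subst (0ℚ <_) (sym (oddsGap-split p q (a₀ p) (a₁ p) (a₀ q) (a₁ q)))
      (+-mono-≤-< (0≤weights gap₀ gap₁)
        (0<mixedGap 0<r r≤t (0≤amp (cofactor false α) (<⇒≤ 0<p) (<⇒≤ p<1)) (<⇒≤ (α₀<α₁ p 0<p p<1))
          (amp≤1 (cofactor true α) (<⇒≤ 0<p) (<⇒≤ p<1)) gap₀ gap₁
          (<-by (<⇒0<- p<q) (t-r p q)) (α₀<α₁ p 0<p p<1) nondegenerate))
      where
      gap₀ = 0≤oddsGap (Monotone-cofactor {α = α} mono false)
      gap₁ = 0≤oddsGap (Monotone-cofactor {α = α} mono true)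

    outer : ((λ _ → false) ≗ cofactor false α) ⊎ (∀ p → 0ℚ < p → p < 1ℚ → amp {k} (λ _ → false) p < a₀ p) →
            (cofactor true α ≗ (λ _ → true)) ⊎ (∀ p → 0ℚ < p → p < 1ℚ → a₁ p < amp {k} (λ _ → true) p) →
            (∃[ b ] (∀ z → α z ≡ b)) ⊎ IsProjection α ⊎ 0ℚ < oddsGap r t (amp α p) (amp α q)
    outer (inj₁ e₀) (inj₁ e₁) = inj₂ (inj₁ (zero , λ { (false ∷ z) → sym (e₀ z) ; (true ∷ z) → e₁ z }))
    outer (inj₂ l₀) _         = inj₂ (inj₂ (strict (inj₁ (subst (_< a₀ p) (amp-const {k} false p) (l₀ p 0<p p<1)))))
    outer _         (inj₂ l₁) = inj₂ (inj₂ (strict (inj₂ (subst (a₁ p <_) (amp-const {k} true p) (l₁ p 0<p p<1)))))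

-- Iterated amplification of a probability below one half

zeros-least : ∀ {k} (z : Vec Bool k) → Pointwise Bool._≤_ (Vec.replicate k false) z
zeros-least []          = []
zeros-least (false ∷ z) = Bool.b≤b ∷ zeros-least z
zeros-least (true ∷ z)  = Bool.f≤t ∷ zeros-least z

selfDual-nonconstant : ∀ {k} {α : BoolFun k} → SelfDual α → ¬ (∃[ b ] (∀ z → α z ≡ b))
selfDual-nonconstant {k} sd (b , const) = b≢not-b b
  (trans (sym (const (Vec.replicate k false))) (trans (sd _) (cong not (const _))))
  where
  b≢not-b : ∀ b → b ≢ not b
  b≢not-b true  ()
  b≢not-b false ()

selfDual-zeros : ∀ {k} {α : BoolFun k} → Monotone α → SelfDual α → α (Vec.replicate k false) ≡ false
selfDual-zeros {k} {α} mono sd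
  with α (Vec.replicate k false) | α (Vec.map not (Vec.replicate k false))
     | mono (zeros-least (Vec.map not (Vec.replicate k false))) | sd (Vec.replicate k false)
... | false | _    | _        | _  = refl
... | true  | true | Bool.b≤b | ()

amp-½ : ∀ {k} {α : BoolFun k} → SelfDual α → amp α ½ ≡ ½
amp-½ {α = α} sd = trans (lemma₁ (amp α ½)) (trans (cong (λ x → ½ * (amp α ½ + x))
  (trans (amp-cong sd ½) (amp-dual α ½))) (lemma₂ (amp α ½)))
  where
  lemma₁ : ∀ x → x ≡ ½ * (x + x)
  lemma₁ = solve-∀ ℚ-ring
  lemma₂ : ∀ x → ½ * (x + (1ℚ - x)) ≡ ½
  lemma₂ = solve-∀ ℚ-ring

module Amplification {k} {α : BoolFun k} (mono : Monotone α) (sd : SelfDual α) (¬proj : ¬ IsProjection α) where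

  -- Comparison with the fixed point 1/2.
  amp-< : ∀ {p} → 0ℚ < p → p < ½ → amp α p < p
  amp-< {p} 0<p p<½ with 0<oddsGap 0<p (<⇒≤ p<½) ½<1 p<½ mono
  ... | inj₁ const       = ⊥-elim (selfDual-nonconstant sd const)
  ... | inj₂ (inj₁ proj) = ⊥-elim (¬proj proj)
  ... | inj₂ (inj₂ 0<gap) = 0<-⇒< (cancel-0< {½ * ½} (0<a*b 0<½ 0<½)
      (subst (0ℚ <_) (trans (cong (oddsGap (p * (1ℚ - ½)) (½ * (1ℚ - p)) (amp α p)) (amp-½ sd)) (lemma p (amp α p))) 0<gap))
    where
    lemma : ∀ p A → p * (1ℚ - ½) * (1ℚ - A) * ½ - ½ * (1ℚ - p) * A * (1ℚ - ½) ≡ ½ * ½ * (p - A)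
    lemma = solve-∀ ℚ-ring

  amp-0≡0 : amp α 0ℚ ≡ 0ℚ
  amp-0≡0 = trans (amp-0 α) (cong bit (selfDual-zeros mono sd))

  -- Below q the odds contract at least by the factor they contract by at q, so
  -- that the bias loses a fixed fraction of itself.
  amp-contracts : ∀ {p q} → 0ℚ ≤ p → p ≤ q → 0ℚ < q → q < ½ → amp α p ≤ p - ½ * (q - amp α q) * p
  amp-contracts {p} {q} 0≤p p≤q 0<q q<½ with p ≟ 0ℚ
  ... | yes refl = ≤-reflexive (trans amp-0≡0 (lemma (½ * (q - amp α q))))
    where
    lemma : ∀ x → 0ℚ ≡ 0ℚ - x * 0ℚ
    lemma = solve-∀ ℚ-ring
  ... | no p≢0 = ≤-by
      (0≤a+b (0≤a+b (0≤oddsGap 0<p p≤q q<1 mono)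
        (0≤a*b (0≤a*b (0≤amp α 0≤p p≤1) (<⇒≤ (<⇒0<- (amp-< 0<q q<½)))) (<⇒≤ (<⇒0<- p<½))))
        (0≤a*b (0≤a*b (<⇒≤ 0<½) (0≤a+b (0≤a+b (≤⇒0≤- (amp≤1 α (<⇒≤ 0<q) (<⇒≤ q<1))) (<⇒≤ (<⇒0<- q<1)))
                 (0≤a+b 0≤qB 0≤qB)))
          (<⇒≤ (<⇒0<- (amp-< 0<p p<½)))))
      (lemma p q (amp α p) (amp α q))
    where
    0<p = ≢0∧0≤⇒0< p≢0 0≤p
    q<1 = <-trans q<½ ½<1
    p<½ = ≤-<-trans p≤q q<½
    p≤1 = <⇒≤ (<-trans p<½ ½<1)
    0≤qB = 0≤a*b (<⇒≤ 0<q) (0≤amp α (<⇒≤ 0<q) (<⇒≤ q<1))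
    lemma : ∀ p q A B → p - ½ * (q - B) * p ≡ A + (p * (1ℚ - q) * (1ℚ - A) * B - q * (1ℚ - p) * A * (1ℚ - B)
      + A * (q - B) * (½ - p) + ½ * (1ℚ - B + (1ℚ - q) + (q * B + q * B)) * (p - A))
    lemma = solve-∀ ℚ-ring

  amp-iterates-vanish : ∀ {q : ℕ → ℚ} → (∀ i → q (suc i) ≡ amp α (q i)) → 0ℚ ≤ q 0 → q 0 < ½ → Vanishes q
  amp-iterates-vanish {q} q-suc 0≤q₀ q₀<½ with q 0 ≟ 0ℚ
  ... | yes q₀≡0 = vanishes-≡ q≡0 vanishes-0
    where
    q≡0 : ∀ i → q i ≡ 0ℚ
    q≡0 zero    = q₀≡0
    q≡0 (suc i) = trans (q-suc i) (trans (cong (amp α) (q≡0 i)) amp-0≡0)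
  ... | no q₀≢0 = contraction {e = λ _ → 0ℚ} 0<δ δ≤1 (proj₁ ∘ bounds) vanishes-0
      (λ i → subst (q (suc i) ≤_) (sym (+-identityʳ _))
        (subst (_≤ q i - δ * q i) (sym (q-suc i))
          (amp-contracts (proj₁ (bounds i)) (proj₂ (bounds i)) 0<q₀ q₀<½)))
    where
    0<q₀ = ≢0∧0≤⇒0< q₀≢0 0≤q₀
    δ = ½ * (q 0 - amp α (q 0))
    0<δ : 0ℚ < δ
    0<δ = 0<a*b 0<½ (<⇒0<- (amp-< 0<q₀ q₀<½))
    δ≤1 : δ ≤ 1ℚ
    δ≤1 = ≤-by (0≤a+b (<⇒≤ 0<½) (0≤a*b (<⇒≤ 0<½) (0≤a+b (<⇒≤ (<⇒0<- (<-trans q₀<½ ½<1)))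
                 (0≤amp α 0≤q₀ (<⇒≤ (<-trans q₀<½ ½<1)))))) (lemma (q 0) (amp α (q 0)))
      where
      lemma : ∀ q B → 1ℚ ≡ ½ * (q - B) + (½ + ½ * (1ℚ - q + B))
      lemma = solve-∀ ℚ-ring
    bounds : ∀ i → 0ℚ ≤ q i × q i ≤ q 0
    bounds zero    = 0≤q₀ , ≤-refl
    bounds (suc i) with bounds i
    ... | 0≤qi , qi≤q₀ = subst (0ℚ ≤_) (sym (q-suc i)) (0≤amp α 0≤qi qi≤1)
                       , subst (_≤ q 0) (sym (q-suc i)) (≤-trans (amp-contracts 0≤qi qi≤q₀ 0<q₀ q₀<½)
                           (≤-trans (≤-by (0≤a*b (<⇒≤ 0<δ) 0≤qi) (lemma (q i) (δ * q i))) qi≤q₀))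
      where
      qi≤1 = ≤-trans qi≤q₀ (<⇒≤ (<-trans q₀<½ ½<1))
      lemma : ∀ a b → a ≡ a - b + b
      lemma = solve-∀ ℚ-ring

-- Fourier analysis on the Boolean cube

-- Truth values as signs, with false sent to 1 and true to -1.
sgn : Bool → ℚ
sgn b = if b then - 1ℚ else 1ℚ

∣sgn∣≤1 : ∀ b → ∣ sgn b ∣ ≤ 1ℚ
∣sgn∣≤1 true  = ≤-refl
∣sgn∣≤1 false = ≤-refl

sgn² : ∀ b → sgn b * sgn b ≡ 1ℚ
sgn² true  = refl
sgn² false = refl

-- The even part (false) and the odd part (true) of φ in its first input.
part : ∀ {k} → Bool → (Vec Bool (suc k) → ℚ) → Vec Bool k → ℚ
part false φ z = ½ * (φ (false ∷ z) + φ (true ∷ z))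
part true  φ z = ½ * (φ (false ∷ z) - φ (true ∷ z))

φ-parts : ∀ {k} (φ : Vec Bool (suc k) → ℚ) b z → φ (b ∷ z) ≡ part false φ z + sgn b * part true φ z
φ-parts φ false z = lemma (φ (false ∷ z)) (φ (true ∷ z))
  where
  lemma : ∀ a b → a ≡ ½ * (a + b) + 1ℚ * (½ * (a - b))
  lemma = solve-∀ ℚ-ring
φ-parts φ true z = lemma (φ (false ∷ z)) (φ (true ∷ z))
  where
  lemma : ∀ a b → b ≡ ½ * (a + b) + - 1ℚ * (½ * (a - b))
  lemma = solve-∀ ℚ-ring

∣part∣≤1 : ∀ {k} {φ : Vec Bool (suc k) → ℚ} → (∀ z → ∣ φ z ∣ ≤ 1ℚ) → ∀ b z → ∣ part b φ z ∣ ≤ 1ℚ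
∣part∣≤1 {φ = φ} ∣φ∣≤1 false z = ∣x*y∣≤ {½} {c = ½} {d = 1ℚ + 1ℚ} ≤-refl (∣x+y∣≤ {φ (false ∷ z)} (∣φ∣≤1 _) (∣φ∣≤1 _))
∣part∣≤1 {φ = φ} ∣φ∣≤1 true  z = ∣x*y∣≤ {½} {c = ½} {d = 1ℚ + 1ℚ} ≤-refl (∣x+y∣≤ {φ (false ∷ z)} (∣φ∣≤1 _)
  (subst (_≤ 1ℚ) (sym (∣-p∣≡∣p∣ (φ (true ∷ z)))) (∣φ∣≤1 _)))

-- The Fourier coefficient of φ at the set of inputs with indicator T.
coef : ∀ {k} → (Vec Bool k → ℚ) → Vec Bool k → ℚ
coef φ []      = φ []
coef φ (b ∷ T) = coef (part b φ) T

coef-cong : ∀ {k} {φ ψ : Vec Bool k → ℚ} → (∀ z → φ z ≡ ψ z) → ∀ T → coef φ T ≡ coef ψ T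
coef-cong φ≡ψ []          = φ≡ψ []
coef-cong φ≡ψ (false ∷ T) = coef-cong (λ z → cong₂ (λ x y → ½ * (x + y)) (φ≡ψ _) (φ≡ψ _)) T
coef-cong φ≡ψ (true ∷ T)  = coef-cong (λ z → cong₂ (λ x y → ½ * (x - y)) (φ≡ψ _) (φ≡ψ _)) T

coef-linear : ∀ {k} a b (φ ψ : Vec Bool k → ℚ) T →
  coef (λ z → a * φ z + b * ψ z) T ≡ a * coef φ T + b * coef ψ T
coef-linear a b φ ψ []      = refl
coef-linear a b φ ψ (c ∷ T) = trans (coef-cong (part-linear c) T) (coef-linear a b (part c φ) (part c ψ) T)
  where
  even : ∀ a b x y u v → ½ * (a * x + b * y + (a * u + b * v)) ≡ a * (½ * (x + u)) + b * (½ * (y + v))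
  even = solve-∀ ℚ-ring
  odd : ∀ a b x y u v → ½ * (a * x + b * y - (a * u + b * v)) ≡ a * (½ * (x - u)) + b * (½ * (y - v))
  odd = solve-∀ ℚ-ring
  part-linear : ∀ c z → part c (λ z → a * φ z + b * ψ z) z ≡ a * part c φ z + b * part c ψ z
  part-linear false z = even a b (φ (false ∷ z)) (ψ (false ∷ z)) (φ (true ∷ z)) (ψ (true ∷ z))
  part-linear true  z = odd a b (φ (false ∷ z)) (ψ (false ∷ z)) (φ (true ∷ z)) (ψ (true ∷ z))

coef-false : ∀ {k} (φ : Vec Bool (suc k) → ℚ) T →
  coef φ (false ∷ T) ≡ ½ * (coef (cofactor false φ) T + coef (cofactor true φ) T)
coef-false φ T = trans (coef-cong (λ z → *-distribˡ-+ ½ (φ (false ∷ z)) (φ (true ∷ z))) T)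
  (trans (coef-linear ½ ½ (cofactor false φ) (cofactor true φ) T) 
    (sym (*-distribˡ-+ ½ (coef (cofactor false φ) T) (coef (cofactor true φ) T))))

coef-true : ∀ {k} (φ : Vec Bool (suc k) → ℚ) T →
  coef φ (true ∷ T) ≡ ½ * (coef (cofactor false φ) T - coef (cofactor true φ) T)
coef-true φ T = trans (coef-cong (λ z → lemma (φ (false ∷ z)) (φ (true ∷ z))) T)
  (trans (coef-linear ½ (- ½) (cofactor false φ) (cofactor true φ) T)
    (sym (lemma (coef (cofactor false φ) T) (coef (cofactor true φ) T))))
  where
  lemma : ∀ a b → ½ * (a - b) ≡ ½ * a + - ½ * b
  lemma = solve-∀ ℚ-ring

∣coef∣≤1 : ∀ {k} {φ : Vec Bool k → ℚ} → (∀ z → ∣ φ z ∣ ≤ 1ℚ) → ∀ T → ∣ coef φ T ∣ ≤ 1ℚ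
∣coef∣≤1 ∣φ∣≤1 []      = ∣φ∣≤1 []
∣coef∣≤1 ∣φ∣≤1 (b ∷ T) = ∣coef∣≤1 (∣part∣≤1 ∣φ∣≤1 b) T

-- All vectors of truth values.
cube : ∀ k → List (Vec Bool k)
cube = tuples (false ∷ true ∷ [])

∑-cube : ∀ k (h : Vec Bool (suc k) → ℚ) →
  ∑ (cube (suc k)) h ≡ ∑ (cube k) (cofactor false h) + ∑ (cube k) (cofactor true h)
∑-cube k h = trans (∑-cartesian _∷_ (false ∷ true ∷ []) (cube k) h)
  (cong (∑ (cube k) (cofactor false h) +_) (+-identityʳ (∑ (cube k) (cofactor true h))))

∈-cube : ∀ {k} (z : Vec Bool k) → z ∈ cube k
∈-cube []      = here refl
∈-cube (b ∷ z) = ∈-cartesianProductWith⁺ _∷_ (∈-bools b) (∈-cube z)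
  where
  ∈-bools : ∀ b → b ∈ (false ∷ true ∷ [])
  ∈-bools false = here refl
  ∈-bools true  = there (here refl)

parseval : ∀ {k} (φ : Vec Bool k → ℚ) → (∀ z → φ z * φ z ≡ 1ℚ) →
  ∑ (cube k) (λ T → coef φ T * coef φ T) ≡ 1ℚ
parseval {zero}  φ φ² = trans (+-identityʳ (φ [] * φ [])) (φ² [])
parseval {suc k} φ φ² = begin
  ∑ (cube (suc k)) (λ T → coef φ T * coef φ T)
    ≡⟨ ∑-cube k (λ T → coef φ T * coef φ T) ⟩
  ∑ (cube k) (λ T → coef φ (false ∷ T) * coef φ (false ∷ T)) + ∑ (cube k) (λ T → coef φ (true ∷ T) * coef φ (true ∷ T))
    ≡⟨ sym (∑-+ (cube k) (λ T → coef φ (false ∷ T) * coef φ (false ∷ T)) (λ T → coef φ (true ∷ T) * coef φ (true ∷ T))) ⟩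
  ∑ (cube k) (λ T → coef φ (false ∷ T) * coef φ (false ∷ T) + coef φ (true ∷ T) * coef φ (true ∷ T))
    ≡⟨ ∑-cong (cube k) (λ T → trans
         (cong₂ (λ x y → x * x + y * y) (coef-false φ T) (coef-true φ T)) (lemma (a₀ T) (a₁ T))) ⟩
  ∑ (cube k) (λ T → ½ * (a₀ T * a₀ T + a₁ T * a₁ T))
    ≡⟨ ∑-*ˡ ½ (cube k) (λ T → a₀ T * a₀ T + a₁ T * a₁ T) ⟩
  ½ * ∑ (cube k) (λ T → a₀ T * a₀ T + a₁ T * a₁ T)
    ≡⟨ cong (½ *_) (trans (∑-+ (cube k) (λ T → a₀ T * a₀ T) (λ T → a₁ T * a₁ T))
         (cong₂ _+_ (parseval (cofactor false φ) (φ² ∘ (false ∷_))) (parseval (cofactor true φ) (φ² ∘ (true ∷_))))) ⟩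
  1ℚ ∎
  where
  open ≡-Reasoning
  a₀ = coef (cofactor false φ)
  a₁ = coef (cofactor true φ)
  lemma : ∀ a b → ½ * (a + b) * (½ * (a + b)) + ½ * (a - b) * (½ * (a - b)) ≡ ½ * (a * a + b * b)
  lemma = solve-∀ ℚ-ring

-- The spectrum of a monotone function

-- The coefficient at the empty set is the mean.
coef-∅ : ∀ {k} (α : BoolFun k) T → weight T ≡ 0 → coef (sgn ∘ α) T ≡ 1ℚ - (amp α ½ + amp α ½)
coef-∅ α [] _ with α []
... | true  = refl
... | false = refl
coef-∅ α (false ∷ T) w≡0 = trans (coef-false (sgn ∘ α) T) (trans
  (cong₂ (λ x y → ½ * (x + y)) (coef-∅ (cofactor false α) T w≡0) (coef-∅ (cofactor true α) T w≡0))
  (lemma (amp (cofactor false α) ½) (amp (cofactor true α) ½)))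
  where
  lemma : ∀ a b → ½ * (1ℚ - (a + a) + (1ℚ - (b + b)))
                ≡ 1ℚ - ((1ℚ - ½) * a + ½ * b + ((1ℚ - ½) * a + ½ * b))
  lemma = solve-∀ ℚ-ring

∣∣≤1⇒≤1 : ∀ {x} → ∣ x ∣ ≤ 1ℚ → x ≤ 1ℚ
∣∣≤1⇒≤1 {x} = ≤-trans (x≤∣x∣ x)

coef≤1 : ∀ {k} (α : BoolFun k) T → coef (sgn ∘ α) T ≤ 1ℚ
coef≤1 α T = ∣∣≤1⇒≤1 (∣coef∣≤1 (∣sgn∣≤1 ∘ α) T)

-1<coef : ∀ {k} {α : BoolFun k} → Monotone α → ∀ T → 1 ℕ.≤ weight T → 0ℚ < 1ℚ + coef (sgn ∘ α) T
-1<coef {α = α} mono (false ∷ T) 1≤w = subst (0ℚ <_)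
  (trans (lemma (coef (sgn ∘ cofactor false α) T) (coef (sgn ∘ cofactor true α) T))
    (cong (1ℚ +_) (sym (coef-false (sgn ∘ α) T))))
  (+-mono-< (0<a*b 0<½ (-1<coef (Monotone-cofactor {α = α} mono false) T 1≤w))
            (0<a*b 0<½ (-1<coef (Monotone-cofactor {α = α} mono true) T 1≤w)))
  where
  lemma : ∀ a b → ½ * (1ℚ + a) + ½ * (1ℚ + b) ≡ 1ℚ + ½ * (a + b)
  lemma = solve-∀ ℚ-ring
-1<coef {α = α} mono (true ∷ T) _ with weight T in wT
... | suc _ = subst (0ℚ <_)
  (trans (lemma (coef (sgn ∘ cofactor false α) T) (coef (sgn ∘ cofactor true α) T))
    (cong (1ℚ +_) (sym (coef-true (sgn ∘ α) T))))
  (0<a+b (0<a*b 0<½ (-1<coef (Monotone-cofactor {α = α} mono false) T (subst (1 ℕ.≤_) (sym wT) (ℕ.s≤s ℕ.z≤n))))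
         (0≤a*b (<⇒≤ 0<½) (≤⇒0≤- (coef≤1 (cofactor true α) T))))
  where
  lemma : ∀ a b → ½ * (1ℚ + a) + ½ * (1ℚ - b) ≡ 1ℚ + ½ * (a - b)
  lemma = solve-∀ ℚ-ring
... | zero = subst (0ℚ <_)
  (trans (lemma (amp (cofactor false α) ½) (amp (cofactor true α) ½))
    (cong (1ℚ +_) (trans (sym (cong₂ (λ x y → ½ * (x - y)) (coef-∅ (cofactor false α) T wT) (coef-∅ (cofactor true α) T wT)))
      (sym (coef-true (sgn ∘ α) T)))))
  (0<a+b 0<1 (≤⇒0≤- (amp-mono (cofactors-⊑ mono) 0<½ ½<1)))
  where
  lemma : ∀ a b → 1ℚ + (b - a) ≡ 1ℚ + ½ * (1ℚ - (a + a) - (1ℚ - (b + b)))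
  lemma = solve-∀ ℚ-ring

coef<1 : ∀ {k} {α : BoolFun k} → Monotone α → ∀ T → 2 ℕ.≤ weight T → 0ℚ < 1ℚ - coef (sgn ∘ α) T
coef<1 {α = α} mono (false ∷ T) 2≤w = subst (0ℚ <_)
  (trans (lemma (coef (sgn ∘ cofactor false α) T) (coef (sgn ∘ cofactor true α) T))
    (cong (λ x → 1ℚ - x) (sym (coef-false (sgn ∘ α) T))))
  (+-mono-< (0<a*b 0<½ (coef<1 (Monotone-cofactor {α = α} mono false) T 2≤w))
            (0<a*b 0<½ (coef<1 (Monotone-cofactor {α = α} mono true) T 2≤w)))
  where
  lemma : ∀ a b → ½ * (1ℚ - a) + ½ * (1ℚ - b) ≡ 1ℚ - ½ * (a + b)
  lemma = solve-∀ ℚ-ring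
coef<1 {α = α} mono (true ∷ T) (ℕ.s≤s 1≤w) = subst (0ℚ <_)
  (trans (lemma (coef (sgn ∘ cofactor false α) T) (coef (sgn ∘ cofactor true α) T))
    (cong (λ x → 1ℚ - x) (sym (coef-true (sgn ∘ α) T))))
  (0<a+b (0<a*b 0<½ (-1<coef (Monotone-cofactor {α = α} mono true) T 1≤w))
         (0≤a*b (<⇒≤ 0<½) (≤⇒0≤- (coef≤1 (cofactor false α) T))))
  where
  lemma : ∀ a b → ½ * (1ℚ + b) + ½ * (1ℚ - a) ≡ 1ℚ - ½ * (a - b)
  lemma = solve-∀ ℚ-ring

∣coef∣<1 : ∀ {k} {α : BoolFun k} → Monotone α → ∀ T → 2 ℕ.≤ weight T → ∣ coef (sgn ∘ α) T ∣ < 1ℚ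
∣coef∣<1 {α = α} mono T 2≤w = ∣∣-<
  (0<-⇒< (coef<1 mono T 2≤w))
  (<-by (-1<coef mono T (ℕₚ.≤-trans (ℕ.s≤s ℕ.z≤n) 2≤w)) (lemma (coef (sgn ∘ α) T)))
  where
  lemma : ∀ a → 1ℚ ≡ - a + (1ℚ + a)
  lemma = solve-∀ ℚ-ring

zero-or-coef : ∀ {k} (φ : Vec Bool k → ℚ) → (∀ z → φ z ≡ 0ℚ) ⊎ ∃[ T ] coef φ T ≢ 0ℚ
zero-or-coef {zero} φ with φ [] ≟ 0ℚ
... | yes φ≡0 = inj₁ λ { [] → φ≡0 }
... | no  φ≢0 = inj₂ ([] , φ≢0)
zero-or-coef {suc k} φ with zero-or-coef (part false φ) | zero-or-coef (part true φ)
... | inj₂ (T , a≢0) | _              = inj₂ (false ∷ T , a≢0)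
... | _              | inj₂ (T , a≢0) = inj₂ (true ∷ T , a≢0)
... | inj₁ even≡0    | inj₁ odd≡0     = inj₁ λ { (b ∷ z) → trans (φ-parts φ b z)
        (trans (cong₂ (λ x y → x + sgn b * y) (even≡0 z) (odd≡0 z)) (lemma (sgn b))) }
  where
  lemma : ∀ x → 0ℚ + x * 0ℚ ≡ 0ℚ
  lemma = solve-∀ ℚ-ring

constant-or-coef : ∀ {k} (φ : Vec Bool k → ℚ) →
  (∀ z z′ → φ z ≡ φ z′) ⊎ ∃[ T ] 1 ℕ.≤ weight T × coef φ T ≢ 0ℚ
constant-or-coef {zero}  φ = inj₁ λ { [] [] → refl }
constant-or-coef {suc k} φ with constant-or-coef (part false φ) | zero-or-coef (part true φ)
... | inj₂ (T , 1≤w , a≢0) | _              = inj₂ (false ∷ T , 1≤w , a≢0)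
... | _                    | inj₂ (T , a≢0) = inj₂ (true ∷ T , ℕ.s≤s ℕ.z≤n , a≢0)
... | inj₁ even            | inj₁ odd≡0     = inj₁ λ { (b ∷ z) (b′ ∷ z′) →
        trans (φ≡even b z) (trans (even z z′) (sym (φ≡even b′ z′))) }
  where
  lemma : ∀ x y → x + y * 0ℚ ≡ x
  lemma = solve-∀ ℚ-ring
  φ≡even : ∀ b z → φ (b ∷ z) ≡ part false φ z
  φ≡even b z = trans (φ-parts φ b z) (trans (cong (λ y → part false φ z + sgn b * y) (odd≡0 z)) (lemma _ (sgn b)))

-- A monotone function without coefficients at sets of two or more inputs has a
-- constant odd part in its first input: either that input is irrelevant, or
-- flipping it always flips the value.
nonlinear-coef : ∀ {k} {α : BoolFun k} → Monotone α →
  (∃[ b ] (∀ z → α z ≡ b)) ⊎ IsProjection α ⊎ ∃[ T ] 2 ℕ.≤ weight T × coef (sgn ∘ α) T ≢ 0ℚ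
nonlinear-coef {zero} {α} mono = inj₁ (α [] , λ { [] → refl })
nonlinear-coef {suc k} {α} mono with constant-or-coef (part true (sgn ∘ α))
... | inj₂ (T , 1≤w , a≢0) = inj₂ (inj₂ (true ∷ T , ℕ.s≤s 1≤w , a≢0))
... | inj₁ odd = go (α (false ∷ 0⃗)) (α (true ∷ 0⃗)) (cofactors-⊑ mono 0⃗) (λ z → odd z 0⃗)
  where
  0⃗ = Vec.replicate k false

  oddValue : Bool → Bool → ℚ
  oddValue b c = ½ * (sgn b - sgn c)

  agree : ∀ b c → oddValue b c ≡ 0ℚ → c ≡ b
  agree true  true  _ = refl
  agree false false _ = refl
  agree true  false ()
  agree false true  ()

  disagree : ∀ b c → oddValue b c ≡ 1ℚ → b ≡ false × c ≡ true
  disagree false true  _ = refl , refl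
  disagree true  true  ()
  disagree true  false ()
  disagree false false ()

  irrelevant : (∀ z → α (true ∷ z) ≡ α (false ∷ z)) → ∀ b z → α (b ∷ z) ≡ α (false ∷ z)
  irrelevant e false z = refl
  irrelevant e true  z = e z

  lift : (∀ z → α (true ∷ z) ≡ α (false ∷ z)) →
    (∃[ b ] (∀ z → α (false ∷ z) ≡ b)) ⊎ IsProjection (cofactor false α)
      ⊎ ∃[ T ] 2 ℕ.≤ weight T × coef (sgn ∘ cofactor false α) T ≢ 0ℚ →
    (∃[ b ] (∀ z → α z ≡ b)) ⊎ IsProjection α ⊎ ∃[ T ] 2 ℕ.≤ weight T × coef (sgn ∘ α) T ≢ 0ℚ
  lift e (inj₁ (b , const))       = inj₁ (b , λ { (c ∷ z) → trans (irrelevant e c z) (const z) })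
  lift e (inj₂ (inj₁ (j , proj))) = inj₂ (inj₁ (suc j , λ { (c ∷ z) → trans (irrelevant e c z) (proj z) }))
  lift e (inj₂ (inj₂ (T , 2≤w , a≢0))) = inj₂ (inj₂ (false ∷ T , 2≤w , λ a≡0 → a≢0 (trans
    (coef-cong (λ z → trans (doubled (sgn (α (false ∷ z)))) (cong (λ b → ½ * (sgn (α (false ∷ z)) + sgn b)) (sym (e z)))) T) a≡0)))
    where
    doubled : ∀ x → x ≡ ½ * (x + x)
    doubled = solve-∀ ℚ-ring

  go : ∀ b c → b Bool.≤ c → (∀ z → part true (sgn ∘ α) z ≡ oddValue b c) →
    (∃[ b ] (∀ z → α z ≡ b)) ⊎ IsProjection α ⊎ ∃[ T ] 2 ℕ.≤ weight T × coef (sgn ∘ α) T ≢ 0ℚ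
  go false true Bool.f≤t oddIs = inj₂ (inj₁ (zero , λ
    { (false ∷ z) → proj₁ (disagree (α (false ∷ z)) (α (true ∷ z)) (oddIs z))
    ; (true ∷ z)  → proj₂ (disagree (α (false ∷ z)) (α (true ∷ z)) (oddIs z)) }))
  go true  true  Bool.b≤b oddIs = lift (λ z → agree (α (false ∷ z)) (α (true ∷ z)) (oddIs z)) (nonlinear-coef (Monotone-cofactor {α = α} mono false))
  go false false Bool.b≤b oddIs = lift (λ z → agree (α (false ∷ z)) (α (true ∷ z)) (oddIs z)) (nonlinear-coef (Monotone-cofactor {α = α} mono false))

-- The contraction of moments

infixr 8 _^_

_^_ : ℚ → ℕ → ℚ
x ^ zero  = 1ℚ
x ^ suc m = x * x ^ m

∣^∣ : ∀ x m → ∣ x ^ m ∣ ≡ ∣ x ∣ ^ m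
∣^∣ x zero    = refl
∣^∣ x (suc m) = trans (∣p*q∣≡∣p∣*∣q∣ x (x ^ m)) (cong (∣ x ∣ *_) (∣^∣ x m))

0≤^ : ∀ {x} → 0ℚ ≤ x → ∀ m → 0ℚ ≤ x ^ m
0≤^ 0≤x zero    = 0≤1
0≤^ 0≤x (suc m) = 0≤a*b 0≤x (0≤^ 0≤x m)

^≤1 : ∀ {x} → 0ℚ ≤ x → x ≤ 1ℚ → ∀ m → x ^ m ≤ 1ℚ
^≤1 0≤x x≤1 zero    = ≤-refl
^≤1 0≤x x≤1 (suc m) = *-mono-≤ 0≤x 0≤1 x≤1 (^≤1 0≤x x≤1 m)

^-suc≤ : ∀ {x} → 0ℚ ≤ x → x ≤ 1ℚ → ∀ m → x ^ suc m ≤ x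
^-suc≤ {x} 0≤x x≤1 m = subst (x ^ suc m ≤_) (*-identityʳ x) (*-mono-≤ 0≤x 0≤1 ≤-refl (^≤1 0≤x x≤1 m))

-- If g₁, …, gₖ are independent and all correlations between the values at m
-- points vanish, except that the product of all m signs has mean ρ, then the
-- product of the m signs φ(g₁, …, gₖ) has mean transfer φ m ρ.
transfer : ∀ {k} → (Vec Bool k → ℚ) → ℕ → ℚ → ℚ
transfer {k} φ m ρ = ∑ (cube k) (λ T → coef φ T ^ m * ρ ^ weight T)

-- Termwise domination of h by w, with a margin d at one term.
∑-gap : {A : Set} (xs : List A) {h w : A → ℚ} {d : ℚ} → (∀ x → h x ≤ w x) →
  ∀ {x} → x ∈ xs → h x + d ≤ w x → ∑ xs h ≤ ∑ xs w - d
∑-gap xs {h} {w} {d} h≤w {x} x∈xs gap = 0≤-⇒≤ (subst (0ℚ ≤_)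
  (trans (cong (_- d) (trans (∑-+ xs w (λ x → - h x)) (cong (∑ xs w +_) (∑-neg xs)))) (lemma₂ (∑ xs w) d (∑ xs h)))
  (≤⇒0≤- (≤-trans (≤-by (≤⇒0≤- gap) (lemma₁ (w x) (h x) d)) (≤∑ (λ x → ≤⇒0≤- (h≤w x)) x∈xs))))
  where
  lemma₁ : ∀ w h d → w - h ≡ d + (w - (h + d))
  lemma₁ = solve-∀ ℚ-ring
  lemma₂ : ∀ w d h → w + - h - d ≡ w - d - h
  lemma₂ = solve-∀ ℚ-ring
  ∑-neg : ∀ xs → ∑ xs (λ x → - h x) ≡ - ∑ xs h
  ∑-neg []       = refl
  ∑-neg (x ∷ xs) = trans (cong (- h x +_) (∑-neg xs)) (sym (neg-distrib-+ (h x) (∑ xs h)))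

-- The term at T is at most a_T²|ρ|, and by Parseval these bounds add up to |ρ|;
-- the term at T* falls short of its bound by a definite amount.
∣transfer∣≤ : ∀ {k} (φ : Vec Bool k → ℚ) → (∀ z → φ z * φ z ≡ 1ℚ) → (∀ z → ∣ φ z ∣ ≤ 1ℚ) →
  (∀ T → weight T ≡ 0 → coef φ T ≡ 0ℚ) →
  ∀ m {ρ} → ∣ ρ ∣ ≤ 1ℚ → ∀ T* w* → weight T* ≡ suc w* → ∀ {κ} → ∣ coef φ T* ∣ ^ m * ∣ ρ ∣ ^ w* ≤ κ →
  ∣ transfer φ (2 ℕ.+ m) ρ ∣ ≤ ∣ ρ ∣ - coef φ T* * coef φ T* * (1ℚ - κ) * ∣ ρ ∣
∣transfer∣≤ {k} φ φ² ∣φ∣≤1 coef-∅≡0 m {ρ} ∣ρ∣≤1 T* w* wT* {κ} loss = ≤-trans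
  (∣∑∣≤∑∣∣ (cube k) (λ T → coef φ T ^ (2 ℕ.+ m) * ρ ^ weight T))
  (subst (λ x → ∑ (cube k) (λ T → ∣ coef φ T ^ (2 ℕ.+ m) * ρ ^ weight T ∣) ≤ x - coef φ T* * coef φ T* * (1ℚ - κ) * ∣ ρ ∣)
    (trans (∑-*ʳ (cube k) (λ T → coef φ T * coef φ T) ∣ ρ ∣) (trans (cong (_* ∣ ρ ∣) (parseval φ φ²)) (*-identityˡ ∣ ρ ∣)))
    (∑-gap (cube k) bound (∈-cube T*) bound*))
  where
  ∣term∣ : ∀ a w → ∣ a ^ (2 ℕ.+ m) * ρ ^ suc w ∣ ≡ a * a * ∣ ρ ∣ * (∣ a ∣ ^ m * ∣ ρ ∣ ^ w)
  ∣term∣ a w = trans (∣p*q∣≡∣p∣*∣q∣ (a ^ (2 ℕ.+ m)) (ρ ^ suc w))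
    (trans (cong₂ _*_ (∣^∣ a (2 ℕ.+ m)) (∣^∣ ρ (suc w)))
    (trans (lemma (∣ a ∣) (∣ a ∣ ^ m) (∣ ρ ∣) (∣ ρ ∣ ^ w))
      (cong (λ x → x * ∣ ρ ∣ * (∣ a ∣ ^ m * ∣ ρ ∣ ^ w)) (trans (sym (∣p*q∣≡∣p∣*∣q∣ a a)) (0≤p⇒∣p∣≡p (0≤a² a))))))
    where
    lemma : ∀ x y u v → x * (x * y) * (u * v) ≡ x * x * u * (y * v)
    lemma = solve-∀ ℚ-ring

  bound : ∀ T → ∣ coef φ T ^ (2 ℕ.+ m) * ρ ^ weight T ∣ ≤ coef φ T * coef φ T * ∣ ρ ∣
  bound T with weight T in wT
  ... | zero  rewrite coef-∅≡0 T wT = ≤-reflexive (trans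
          (cong ∣_∣ (trans (cong (_* 1ℚ) (*-zeroˡ (0ℚ * 0ℚ ^ m))) (*-zeroˡ 1ℚ))) (lemma ∣ ρ ∣))
    where
    lemma : ∀ x → 0ℚ ≡ 0ℚ * 0ℚ * x
    lemma = solve-∀ ℚ-ring
  ... | suc w = subst₂ _≤_ (sym (∣term∣ (coef φ T) w)) (*-identityʳ (coef φ T * coef φ T * ∣ ρ ∣))
          (*-mono-≤ (0≤a*b (0≤a² (coef φ T)) (0≤∣p∣ ρ)) 0≤1 ≤-refl
            (*-mono-≤ (0≤^ (0≤∣p∣ _) m) 0≤1 (^≤1 (0≤∣p∣ _) (∣coef∣≤1 ∣φ∣≤1 T) m) (^≤1 (0≤∣p∣ ρ) ∣ρ∣≤1 w)))

  bound* : ∣ coef φ T* ^ (2 ℕ.+ m) * ρ ^ weight T* ∣ + coef φ T* * coef φ T* * (1ℚ - κ) * ∣ ρ ∣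
             ≤ coef φ T* * coef φ T* * ∣ ρ ∣
  bound* rewrite wT* = ≤-by (0≤a*b (0≤a*b (0≤a² (coef φ T*)) (0≤∣p∣ ρ)) (≤⇒0≤- loss))
    (trans (lemma (coef φ T*) (∣ ρ ∣) κ (∣ coef φ T* ∣ ^ m * ∣ ρ ∣ ^ w*))
      (cong (λ x → x + coef φ T* * coef φ T* * (1ℚ - κ) * ∣ ρ ∣
                   + coef φ T* * coef φ T* * ∣ ρ ∣ * (κ - ∣ coef φ T* ∣ ^ m * ∣ ρ ∣ ^ w*))
        (sym (∣term∣ (coef φ T*) w*))))
    where
    lemma : ∀ a ρ κ x → a * a * ρ ≡ a * a * ρ * x + a * a * (1ℚ - κ) * ρ + a * a * ρ * (κ - x)
    lemma = solve-∀ ℚ-ring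

module Contraction {k} {α : BoolFun k} (mono : Monotone α) (sd : SelfDual α) (¬proj : ¬ IsProjection α) where

  coef-∅≡0 : ∀ T → weight T ≡ 0 → coef (sgn ∘ α) T ≡ 0ℚ
  coef-∅≡0 T w≡0 = trans (coef-∅ α T w≡0) (cong (λ x → 1ℚ - (x + x)) (amp-½ sd))

  nonlinear : ∃[ T ] 2 ℕ.≤ weight T × coef (sgn ∘ α) T ≢ 0ℚ
  nonlinear with nonlinear-coef mono
  ... | inj₁ const       = ⊥-elim (selfDual-nonconstant sd const)
  ... | inj₂ (inj₁ proj) = ⊥-elim (¬proj proj)
  ... | inj₂ (inj₂ T)    = T

  -- If |a_T|^m |ρ|^(|T|-1) is at most κ < 1 for all ρ in P, where |T| ≥ 2 and a_T
  -- is nonzero, then a step contracts every ρ in P.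
  loss-contracts : ∀ m (P : ℚ → Set) T w → weight T ≡ 2 ℕ.+ w → coef (sgn ∘ α) T ≢ 0ℚ →
    ∀ κ → 0ℚ ≤ κ → κ < 1ℚ →
    (∀ {ρ} → P ρ → ∣ ρ ∣ ≤ 1ℚ × ∣ coef (sgn ∘ α) T ∣ ^ m * ∣ ρ ∣ ^ suc w ≤ κ) →
    ∃[ δ ] 0ℚ < δ × δ ≤ 1ℚ × (∀ {ρ} → P ρ → ∣ transfer (sgn ∘ α) (2 ℕ.+ m) ρ ∣ ≤ ∣ ρ ∣ - δ * ∣ ρ ∣)
  loss-contracts m P T w wT a≢0 κ 0≤κ κ<1 loss = a * a * (1ℚ - κ)
    , 0<a*b (0<a² a≢0) (<⇒0<- κ<1)
    , *-mono-≤ {b = 1ℚ} {d = 1ℚ} (0≤a² a) 0≤1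
        (subst (_≤ 1ℚ) (0≤p⇒∣p∣≡p (0≤a² a)) (∣x*y∣≤1 {a} {a} ∣a∣≤1 ∣a∣≤1)) (≤-by 0≤κ (lemma κ))
    , λ {ρ} Pρ → ∣transfer∣≤ (sgn ∘ α) (sgn² ∘ α) (∣sgn∣≤1 ∘ α) coef-∅≡0 m (proj₁ (loss Pρ)) T (suc w) wT (proj₂ (loss Pρ))
    where
    a = coef (sgn ∘ α) T
    ∣a∣≤1 : ∣ a ∣ ≤ 1ℚ
    ∣a∣≤1 = ∣coef∣≤1 (∣sgn∣≤1 ∘ α) T
    lemma : ∀ κ → 1ℚ ≡ 1ℚ - κ + κ
    lemma = solve-∀ ℚ-ring

  -- A step moves the correlation ρ of two values strictly towards zero if ρ is
  -- bounded away from 1.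
  pair-contracts : ∀ {c} → 0ℚ ≤ c → c < 1ℚ → ∃[ δ ] 0ℚ < δ × δ ≤ 1ℚ × (∀ {ρ} → ∣ ρ ∣ ≤ c →
    ∣ transfer (sgn ∘ α) 2 ρ ∣ ≤ ∣ ρ ∣ - δ * ∣ ρ ∣)
  pair-contracts {c} 0≤c c<1 = go nonlinear
    where
    go : ∃[ T ] 2 ℕ.≤ weight T × coef (sgn ∘ α) T ≢ 0ℚ → ∃[ δ ] 0ℚ < δ × δ ≤ 1ℚ × (∀ {ρ} → ∣ ρ ∣ ≤ c →
      ∣ transfer (sgn ∘ α) 2 ρ ∣ ≤ ∣ ρ ∣ - δ * ∣ ρ ∣)
    go (T , 2≤w , a≢0) = loss-contracts 0 (λ ρ → ∣ ρ ∣ ≤ c) T w (sym (ℕₚ.m+[n∸m]≡n 2≤w)) a≢0 c 0≤c c<1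
      λ {ρ} ∣ρ∣≤c → ≤-trans ∣ρ∣≤c (<⇒≤ c<1) , subst (_≤ c) (sym (*-identityˡ (∣ ρ ∣ ^ suc w)))
        (≤-trans (^-suc≤ (0≤∣p∣ ρ) (≤-trans ∣ρ∣≤c (<⇒≤ c<1)) w) ∣ρ∣≤c)
      where
      w = weight T ℕ.∸ 2

  -- For three or more values no such bound is needed, since the coefficient at T
  -- is itself less than 1 in absolute value.
  many-contracts : ∀ m → ∃[ δ ] 0ℚ < δ × δ ≤ 1ℚ × (∀ {ρ} → ∣ ρ ∣ ≤ 1ℚ →
    ∣ transfer (sgn ∘ α) (3 ℕ.+ m) ρ ∣ ≤ ∣ ρ ∣ - δ * ∣ ρ ∣)
  many-contracts m = go nonlinear
    where
    go : ∃[ T ] 2 ℕ.≤ weight T × coef (sgn ∘ α) T ≢ 0ℚ → ∃[ δ ] 0ℚ < δ × δ ≤ 1ℚ × (∀ {ρ} → ∣ ρ ∣ ≤ 1ℚ →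
      ∣ transfer (sgn ∘ α) (3 ℕ.+ m) ρ ∣ ≤ ∣ ρ ∣ - δ * ∣ ρ ∣)
    go (T , 2≤w , a≢0) = loss-contracts (suc m) (λ ρ → ∣ ρ ∣ ≤ 1ℚ) T w (sym (ℕₚ.m+[n∸m]≡n 2≤w)) a≢0 (∣ a ∣) (0≤∣p∣ a) ∣a∣<1
      λ {ρ} ∣ρ∣≤1 → ∣ρ∣≤1 , subst (∣ a ∣ ^ suc m * ∣ ρ ∣ ^ suc w ≤_) (*-identityʳ (∣ a ∣))
        (*-mono-≤ (0≤^ (0≤∣p∣ a) (suc m)) 0≤1 (^-suc≤ (0≤∣p∣ a) (<⇒≤ ∣a∣<1) m) (^≤1 (0≤∣p∣ ρ) ∣ρ∣≤1 (suc w)))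
      where
      a = coef (sgn ∘ α) T
      w = weight T ℕ.∸ 2
      ∣a∣<1 = ∣coef∣<1 mono T 2≤w

-- Subsets of a list of points

∏ : {A : Set} → List A → (A → ℚ) → ℚ
∏ []       h = 1ℚ
∏ (x ∷ xs) h = h x * ∏ xs h

∏-cong : {A : Set} (xs : List A) {h h′ : A → ℚ} → (∀ x → h x ≡ h′ x) → ∏ xs h ≡ ∏ xs h′
∏-cong []       h≡h′ = refl
∏-cong (x ∷ xs) h≡h′ = cong₂ _*_ (h≡h′ x) (∏-cong xs h≡h′)

∣∏∣≤1 : {A : Set} (xs : List A) {h : A → ℚ} → (∀ x → ∣ h x ∣ ≤ 1ℚ) → ∣ ∏ xs h ∣ ≤ 1ℚ
∣∏∣≤1 []       ∣h∣≤1 = ≤-refl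
∣∏∣≤1 (x ∷ xs) {h} ∣h∣≤1 = ∣x*y∣≤1 {h x} (∣h∣≤1 x) (∣∏∣≤1 xs ∣h∣≤1)

module _ {A : Set} where

  omit choose : A → List A × List A → List A × List A
  omit   x (S , R) = S , x ∷ R
  choose x (S , R) = x ∷ S , R

  -- All ways of splitting a list into a chosen sublist and the rest; those with
  -- a nonempty chosen part; those with a nonempty rest; those with both.
  splits nonempty nonfull proper : List A → List (List A × List A)
  splits []       = ([] , []) ∷ []
  splits (x ∷ xs) = List.map (omit x) (splits xs) ++ List.map (choose x) (splits xs)

  nonempty []       = []
  nonempty (x ∷ xs) = List.map (omit x) (nonempty xs) ++ List.map (choose x) (splits xs)

  nonfull []       = []
  nonfull (x ∷ xs) = List.map (omit x) (splits xs) ++ List.map (choose x) (nonfull xs)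

  proper []       = []
  proper (x ∷ xs) = List.map (omit x) (nonempty xs) ++ List.map (choose x) (nonfull xs)

  ∑-omit-choose : ∀ x (ss ts : List (List A × List A)) h →
    ∑ (List.map (omit x) ss ++ List.map (choose x) ts) h ≡ ∑ ss (h ∘ omit x) + ∑ ts (h ∘ choose x)
  ∑-omit-choose x ss ts h = trans (∑-++ (List.map (omit x) ss) (List.map (choose x) ts) h)
    (cong₂ _+_ (∑-map (omit x) ss h) (∑-map (choose x) ts h))

  ∑-splits-∅ : ∀ xs h → ∑ (splits xs) h ≡ h ([] , xs) + ∑ (nonempty xs) h
  ∑-splits-∅ []       h = refl
  ∑-splits-∅ (x ∷ xs) h = begin
    ∑ (splits (x ∷ xs)) h
      ≡⟨ ∑-omit-choose x (splits xs) (splits xs) h ⟩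
    ∑ (splits xs) (h ∘ omit x) + ∑ (splits xs) (h ∘ choose x)
      ≡⟨ cong (_+ ∑ (splits xs) (h ∘ choose x)) (∑-splits-∅ xs (h ∘ omit x)) ⟩
    h ([] , x ∷ xs) + ∑ (nonempty xs) (h ∘ omit x) + ∑ (splits xs) (h ∘ choose x)
      ≡⟨ +-assoc (h ([] , x ∷ xs)) (∑ (nonempty xs) (h ∘ omit x)) (∑ (splits xs) (h ∘ choose x)) ⟩
    h ([] , x ∷ xs) + (∑ (nonempty xs) (h ∘ omit x) + ∑ (splits xs) (h ∘ choose x))
      ≡⟨ cong (h ([] , x ∷ xs) +_) (sym (∑-omit-choose x (nonempty xs) (splits xs) h)) ⟩
    h ([] , x ∷ xs) + ∑ (nonempty (x ∷ xs)) h ∎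
    where open ≡-Reasoning

  ∑-splits-full : ∀ xs h → ∑ (splits xs) h ≡ ∑ (nonfull xs) h + h (xs , [])
  ∑-splits-full []       h = +-comm (h ([] , [])) 0ℚ
  ∑-splits-full (x ∷ xs) h = begin
    ∑ (splits (x ∷ xs)) h
      ≡⟨ ∑-omit-choose x (splits xs) (splits xs) h ⟩
    ∑ (splits xs) (h ∘ omit x) + ∑ (splits xs) (h ∘ choose x)
      ≡⟨ cong (∑ (splits xs) (h ∘ omit x) +_) (∑-splits-full xs (h ∘ choose x)) ⟩
    ∑ (splits xs) (h ∘ omit x) + (∑ (nonfull xs) (h ∘ choose x) + h (x ∷ xs , []))
      ≡⟨ sym (+-assoc (∑ (splits xs) (h ∘ omit x)) (∑ (nonfull xs) (h ∘ choose x)) (h (x ∷ xs , []))) ⟩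
    ∑ (splits xs) (h ∘ omit x) + ∑ (nonfull xs) (h ∘ choose x) + h (x ∷ xs , [])
      ≡⟨ cong (_+ h (x ∷ xs , [])) (sym (∑-omit-choose x (splits xs) (nonfull xs) h)) ⟩
    ∑ (nonfull (x ∷ xs)) h + h (x ∷ xs , []) ∎
    where open ≡-Reasoning

  ∑-splits-proper : ∀ x xs h →
    ∑ (splits (x ∷ xs)) h ≡ h ([] , x ∷ xs) + ∑ (proper (x ∷ xs)) h + h (x ∷ xs , [])
  ∑-splits-proper x xs h = begin
    ∑ (splits (x ∷ xs)) h
      ≡⟨ ∑-omit-choose x (splits xs) (splits xs) h ⟩
    ∑ (splits xs) (h ∘ omit x) + ∑ (splits xs) (h ∘ choose x)
      ≡⟨ cong₂ _+_ (∑-splits-∅ xs (h ∘ omit x)) (∑-splits-full xs (h ∘ choose x)) ⟩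
    h ([] , x ∷ xs) + ∑ (nonempty xs) (h ∘ omit x) + (∑ (nonfull xs) (h ∘ choose x) + h (x ∷ xs , []))
      ≡⟨ lemma (h ([] , x ∷ xs)) (∑ (nonempty xs) (h ∘ omit x)) (∑ (nonfull xs) (h ∘ choose x)) (h (x ∷ xs , [])) ⟩
    h ([] , x ∷ xs) + (∑ (nonempty xs) (h ∘ omit x) + ∑ (nonfull xs) (h ∘ choose x)) + h (x ∷ xs , [])
      ≡⟨ cong (λ s → h ([] , x ∷ xs) + s + h (x ∷ xs , [])) (sym (∑-omit-choose x (nonempty xs) (nonfull xs) h)) ⟩
    h ([] , x ∷ xs) + ∑ (proper (x ∷ xs)) h + h (x ∷ xs , []) ∎
    where
    open ≡-Reasoning
    lemma : ∀ a b c d → a + b + (c + d) ≡ a + (b + c) + d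
    lemma = solve-∀ ℚ-ring

  ∏-expand : ∀ xs (a b s : A → ℚ) →
    ∏ xs (λ x → a x + s x * b x) ≡ ∑ (splits xs) (λ (S , R) → ∏ S s * (∏ S b * ∏ R a))
  ∏-expand []       a b s = refl
  ∏-expand (x ∷ xs) a b s = begin
    (a x + s x * b x) * ∏ xs (λ x → a x + s x * b x)
      ≡⟨ cong ((a x + s x * b x) *_) (∏-expand xs a b s) ⟩
    (a x + s x * b x) * ∑ (splits xs) term
      ≡⟨ *-distribʳ-+ (∑ (splits xs) term) (a x) (s x * b x) ⟩
    a x * ∑ (splits xs) term + s x * b x * ∑ (splits xs) term
      ≡⟨ cong₂ _+_
           (trans (sym (∑-*ˡ (a x) (splits xs) term)) (∑-cong (splits xs) λ (S , R) → lemma₁ (a x) (∏ S s) (∏ S b) (∏ R a)))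
           (trans (sym (∑-*ˡ (s x * b x) (splits xs) term))
             (∑-cong (splits xs) λ (S , R) → lemma₂ (s x) (b x) (∏ S s) (∏ S b) (∏ R a))) ⟩
    ∑ (splits xs) (term ∘ omit x) + ∑ (splits xs) (term ∘ choose x)
      ≡⟨ sym (∑-omit-choose x (splits xs) (splits xs) term) ⟩
    ∑ (splits (x ∷ xs)) term ∎
    where
    open ≡-Reasoning
    term : List A × List A → ℚ
    term (S , R) = ∏ S s * (∏ S b * ∏ R a)
    lemma₁ : ∀ a s t u → a * (s * (t * u)) ≡ s * (t * (a * u))
    lemma₁ = solve-∀ ℚ-ring
    lemma₂ : ∀ x y s t u → x * y * (s * (t * u)) ≡ x * s * (y * t * u)
    lemma₂ = solve-∀ ℚ-ring

  ∈-omit-choose : ∀ {x} (ss ts : List (List A × List A)) {r} → r ∈ List.map (omit x) ss ++ List.map (choose x) ts →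
    (∃[ s ] s ∈ ss × r ≡ omit x s) ⊎ (∃[ t ] t ∈ ts × r ≡ choose x t)
  ∈-omit-choose {x} ss ts r∈ with ∈-++⁻ (List.map (omit x) ss) r∈
  ... | inj₁ r∈ss = inj₁ (∈-map⁻ (omit x) r∈ss)
  ... | inj₂ r∈ts = inj₂ (∈-map⁻ (choose x) r∈ts)

  splits-⊆ : ∀ xs {S R} → (S , R) ∈ splits xs → S ⊆ xs
  splits-⊆ []       (here refl) = []
  splits-⊆ (x ∷ xs) r∈ with ∈-omit-choose (splits xs) (splits xs) r∈
  ... | inj₁ (_ , s∈ , refl) = x ∷ʳ splits-⊆ xs s∈
  ... | inj₂ (_ , s∈ , refl) = refl ∷ splits-⊆ xs s∈

  nonempty-⊆ : ∀ xs {S R} → (S , R) ∈ nonempty xs → S ⊆ xs × 1 ℕ.≤ length S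
  nonempty-⊆ (x ∷ xs) r∈ with ∈-omit-choose (nonempty xs) (splits xs) r∈
  ... | inj₁ (_ , s∈ , refl) = let S⊆ , 1≤ = nonempty-⊆ xs s∈ in x ∷ʳ S⊆ , 1≤
  ... | inj₂ (_ , s∈ , refl) = refl ∷ splits-⊆ xs s∈ , ℕ.s≤s ℕ.z≤n

  nonfull-⊆ : ∀ xs {S R} → (S , R) ∈ nonfull xs → S ⊆ xs × length S ℕ.< length xs
  nonfull-⊆ (x ∷ xs) r∈ with ∈-omit-choose (splits xs) (nonfull xs) r∈
  ... | inj₁ (_ , s∈ , refl) = x ∷ʳ splits-⊆ xs s∈ , ℕ.s≤s (length-mono-≤ (splits-⊆ xs s∈))
  ... | inj₂ (_ , s∈ , refl) = let S⊆ , < = nonfull-⊆ xs s∈ in refl ∷ S⊆ , ℕ.s≤s <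

  proper-⊆ : ∀ xs {S R} → (S , R) ∈ proper xs → S ⊆ xs × 1 ℕ.≤ length S × length S ℕ.< length xs
  proper-⊆ (x ∷ xs) r∈ with ∈-omit-choose (nonempty xs) (nonfull xs) r∈
  ... | inj₁ (_ , s∈ , refl) = let S⊆ , 1≤ = nonempty-⊆ xs s∈ in x ∷ʳ S⊆ , 1≤ , ℕ.s≤s (length-mono-≤ S⊆)
  ... | inj₂ (_ , s∈ , refl) = let S⊆ , < = nonfull-⊆ xs s∈ in refl ∷ S⊆ , ℕ.s≤s ℕ.z≤n , ℕ.s≤s <

  AllPairs-resp-⊆ : {R : A → A → Set} → ∀ {xs ys} → xs ⊆ ys → AllPairs R ys → AllPairs R xs
  AllPairs-resp-⊆ []         []         = []
  AllPairs-resp-⊆ (y ∷ʳ τ)   (_ ∷ Rys)  = AllPairs-resp-⊆ τ Rys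
  AllPairs-resp-⊆ (refl ∷ τ) (Ry ∷ Rys) = All-resp-⊆ τ Ry ∷ AllPairs-resp-⊆ τ Rys

∣∑∣≤length : {A : Set} (xs : List A) {h : A → ℚ} {e : ℚ} → (∀ {x} → x ∈ xs → ∣ h x ∣ ≤ e) →
  ∣ ∑ xs h ∣ ≤ length xs · 1ℚ * e
∣∑∣≤length []       {h} {e} _ = ≤-reflexive (sym (*-zeroˡ e))
∣∑∣≤length (x ∷ xs) {h} {e} ∣h∣≤e = subst (∣ ∑ (x ∷ xs) h ∣ ≤_) (lemma e (length xs · 1ℚ))
  (∣x+y∣≤ {h x} (∣h∣≤e (here refl)) (∣∑∣≤length xs (∣h∣≤e ∘ there)))
  where
  lemma : ∀ e l → e + l * e ≡ (1ℚ + l) * e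
  lemma = solve-∀ ℚ-ring

-- Moments

-- The mean of the product of the signs of the values at the points ys.
moment : ∀ {n} → Mass n → List (Vec Bool n) → ℚ
moment p ys = E p (λ g → ∏ ys (λ y → sgn (g y)))

∏sgn-resp : ∀ {n} (ys : List (Vec Bool n)) → Respects (λ g → ∏ ys (λ y → sgn (g y)))
∏sgn-resp ys f≗g = ∏-cong ys (λ y → cong sgn (f≗g y))

module _ {n} {p : Mass n} (isD : IsDistribution p) where

  moment-∅ : moment p [] ≡ 1ℚ
  moment-∅ = 𝔼-const (allFuns n) p (isWeighting isD) 1ℚ

  ∣moment∣≤1 : ∀ ys → ∣ moment p ys ∣ ≤ 1ℚ
  ∣moment∣≤1 ys = ∣𝔼∣≤ (allFuns n) p (isWeighting isD) (λ g → ∣∏∣≤1 ys (λ y → ∣sgn∣≤1 (g y)))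

E-∏ : ∀ {n} (p : Mass n) (ys : List (Vec Bool n)) (a b : Vec Bool n → ℚ) →
  E p (λ g → ∏ ys (λ y → a y + sgn (g y) * b y)) ≡ ∑ (splits ys) (λ (S , R) → moment p S * (∏ S b * ∏ R a))
E-∏ {n} p ys a b = trans (𝔼-cong (allFuns n) p (λ g → ∏-expand ys a b (λ y → sgn (g y))))
  (trans (𝔼-∑ (allFuns n) p (splits ys) (λ g (S , R) → ∏ S (λ y → sgn (g y)) * (∏ S b * ∏ R a)))
    (∑-cong (splits ys) λ (S , R) → 𝔼-*ʳ (allFuns n) p (λ g → ∏ S (λ y → sgn (g y))) (∏ S b * ∏ R a)))

transfer-suc : ∀ {k} (φ : Vec Bool (suc k) → ℚ) m ρ →
  transfer φ m ρ ≡ transfer (part false φ) m ρ + ρ * transfer (part true φ) m ρ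
transfer-suc {k} φ m ρ = trans (∑-cube k (λ T → coef φ T ^ m * ρ ^ weight T))
  (cong (transfer (part false φ) m ρ +_)
    (trans (∑-cong (cube k) (λ T → lemma (coef (part true φ) T ^ m) ρ (ρ ^ weight T)))
      (∑-*ˡ ρ (cube k) (λ T → coef (part true φ) T ^ m * ρ ^ weight T))))
  where
  lemma : ∀ a ρ x → a * (ρ * x) ≡ ρ * (a * x)
  lemma = solve-∀ ℚ-ring

∏-const : {A : Set} (xs : List A) (c : ℚ) → ∏ xs (λ _ → c) ≡ c ^ length xs
∏-const []       c = refl
∏-const (x ∷ xs) c = cong (c *_) (∏-const xs c)

-- The error allowed after treating k arguments, in units of the bound on the
-- proper submoments, when there are l of them.
errorFactor : ℚ → ℕ → ℚ
errorFactor l zero    = 0ℚ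
errorFactor l (suc k) = errorFactor l k + (l + errorFactor l k)

-- Averaging over one argument g of φ turns φ(g y, …) into its even part plus
-- the sign of g y times its odd part.  Multiplying out over the points y, the
-- terms that use no point or all points build up the transfer; the others
-- contain a proper submoment.
moment-recurrence : ∀ {n} {p : Mass n} → IsDistribution p → ∀ y ys {e} →
  (∀ {S R} → (S , R) ∈ proper (y ∷ ys) → ∣ moment p S ∣ ≤ e) →
  ∀ k (φ : Vec Bool k → ℚ) → (∀ z → ∣ φ z ∣ ≤ 1ℚ) →
  ∣ E^ p k (λ gs → ∏ (y ∷ ys) (λ y → φ (Vec.map (λ g → g y) gs))) - transfer φ (suc (length ys)) (moment p (y ∷ ys)) ∣
    ≤ errorFactor (length (proper (y ∷ ys)) · 1ℚ) k * e
moment-recurrence {n} {p} isD y₀ ys₀ {e} small zero φ ∣φ∣≤1 = ≤-reflexive (trans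
  (cong (λ x → ∣ x - transfer φ (length ys) ρ ∣) (trans (lemma₁ (∏ ys (λ _ → φ []))) (cong (λ x → x * 1ℚ + 0ℚ) (∏-const ys (φ [])))))
  (trans (cong ∣_∣ (+-inverseʳ (transfer φ (length ys) ρ))) (sym (*-zeroˡ e))))
  where
  ys = y₀ ∷ ys₀
  ρ = moment p ys
  lemma₁ : ∀ x → 1ℚ * x + 0ℚ ≡ x * 1ℚ + 0ℚ
  lemma₁ = solve-∀ ℚ-ring
moment-recurrence {n} {p} isD y₀ ys₀ {e} small (suc k) φ ∣φ∣≤1 = subst₂ (λ x y → ∣ x ∣ ≤ y)
  (trans (lemma₂ (Eᵏ (∏A)) (transfer (part false φ) m ρ) (Eᵏ rest) ρ (Eᵏ (∏B)) (transfer (part true φ) m ρ))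
    (cong₂ _-_ (sym expectation) (sym (transfer-suc φ m ρ))))
  (lemma₃ (errorFactor l k) l e)
  (∣x+y∣≤ {Eᵏ ∏A - transfer (part false φ) m ρ} (moment-recurrence isD y₀ ys₀ small k (part false φ) (∣part∣≤1 ∣φ∣≤1 false))
    (∣x+y∣≤ {Eᵏ rest} (∣𝔼∣≤ (tuples (allFuns n) k) (joint p) (joint-isWeighting isD k) ∣rest∣≤)
      (∣x*y∣≤ {ρ} (∣moment∣≤1 isD ys) (moment-recurrence isD y₀ ys₀ small k (part true φ) (∣part∣≤1 ∣φ∣≤1 true)))))
  where
  ys = y₀ ∷ ys₀
  m = length ys
  ρ = moment p ys
  l = length (proper ys) · 1ℚ
  Eᵏ = E^ p k

  A B : Vec (BoolFun n) k → Vec Bool n → ℚ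
  A gs y = part false φ (Vec.map (λ g → g y) gs)
  B gs y = part true φ (Vec.map (λ g → g y) gs)

  ∏A ∏B rest : Vec (BoolFun n) k → ℚ
  ∏A gs = ∏ ys (A gs)
  ∏B gs = ∏ ys (B gs)
  rest gs = ∑ (proper ys) (λ (S , R) → moment p S * (∏ S (B gs) * ∏ R (A gs)))

  ∣rest∣≤ : ∀ gs → ∣ rest gs ∣ ≤ l * e
  ∣rest∣≤ gs = ∣∑∣≤length (proper ys) λ { {S , R} SR∈ → subst (∣ moment p S * (∏ S (B gs) * ∏ R (A gs)) ∣ ≤_) (*-identityʳ e)
    (∣x*y∣≤ {moment p S} (small SR∈) (∣x*y∣≤1 {∏ S (B gs)}
      (∣∏∣≤1 S (λ y → ∣part∣≤1 ∣φ∣≤1 true _)) (∣∏∣≤1 R (λ y → ∣part∣≤1 ∣φ∣≤1 false _)))) }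

  average : ∀ gs → E p (λ g → ∏ ys (λ y → φ (g y ∷ Vec.map (λ g → g y) gs))) ≡ ∏A gs + (rest gs + ρ * ∏B gs)
  average gs = begin
    E p (λ g → ∏ ys (λ y → φ (g y ∷ Vec.map (λ g → g y) gs)))
      ≡⟨ 𝔼-cong (allFuns n) p (λ g → ∏-cong ys (λ y → φ-parts φ (g y) (Vec.map (λ g → g y) gs))) ⟩
    E p (λ g → ∏ ys (λ y → A gs y + sgn (g y) * B gs y))
      ≡⟨ E-∏ p ys (A gs) (B gs) ⟩
    ∑ (splits ys) (λ (S , R) → moment p S * (∏ S (B gs) * ∏ R (A gs)))
      ≡⟨ ∑-splits-proper y₀ ys₀ (λ (S , R) → moment p S * (∏ S (B gs) * ∏ R (A gs))) ⟩
    moment p [] * (1ℚ * ∏A gs) + rest gs + ρ * (∏B gs * 1ℚ)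
      ≡⟨ trans (cong (λ x → x * (1ℚ * ∏A gs) + rest gs + ρ * (∏B gs * 1ℚ)) (moment-∅ isD))
           (lemma₁ (∏A gs) (rest gs) ρ (∏B gs)) ⟩
    ∏A gs + (rest gs + ρ * ∏B gs) ∎
    where
    open ≡-Reasoning
    lemma₁ : ∀ a r ρ b → 1ℚ * (1ℚ * a) + r + ρ * (b * 1ℚ) ≡ a + (r + ρ * b)
    lemma₁ = solve-∀ ℚ-ring

  expectation : E^ p (suc k) (λ gs → ∏ ys (λ y → φ (Vec.map (λ g → g y) gs))) ≡ Eᵏ ∏A + (Eᵏ rest + ρ * Eᵏ ∏B)
  expectation = begin
    E^ p (suc k) (λ gs → ∏ ys (λ y → φ (Vec.map (λ g → g y) gs)))
      ≡⟨ E^-suc′ p k (λ gs → ∏ ys (λ y → φ (Vec.map (λ g → g y) gs))) ⟩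
    Eᵏ (λ gs → E p (λ g → ∏ ys (λ y → φ (g y ∷ Vec.map (λ g → g y) gs))))
      ≡⟨ 𝔼-cong (tuples (allFuns n) k) (joint p) average ⟩
    Eᵏ (λ gs → ∏A gs + (rest gs + ρ * ∏B gs))
      ≡⟨ 𝔼-+ (tuples (allFuns n) k) (joint p) ∏A (λ gs → rest gs + ρ * ∏B gs) ⟩
    Eᵏ ∏A + Eᵏ (λ gs → rest gs + ρ * ∏B gs)
      ≡⟨ cong (Eᵏ ∏A +_) (trans (𝔼-+ (tuples (allFuns n) k) (joint p) rest (λ gs → ρ * ∏B gs))
           (cong (Eᵏ rest +_) (𝔼-*ˡ (tuples (allFuns n) k) (joint p) ρ ∏B))) ⟩
    Eᵏ ∏A + (Eᵏ rest + ρ * Eᵏ ∏B) ∎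
    where open ≡-Reasoning

  lemma₂ : ∀ a a′ r ρ b b′ → a - a′ + (r + ρ * (b - b′)) ≡ a + (r + ρ * b) - (a′ + ρ * b′)
  lemma₂ = solve-∀ ℚ-ring
  lemma₃ : ∀ c l e → c * e + (l * e + 1ℚ * (c * e)) ≡ (c + (l + c)) * e
  lemma₃ = solve-∀ ℚ-ring

moment-step : ∀ {k n} (α : BoolFun k) {p : Mass n} → IsDistribution p → ∀ y ys {e} →
  (∀ {S R} → (S , R) ∈ proper (y ∷ ys) → ∣ moment p S ∣ ≤ e) →
  ∣ moment (step α p) (y ∷ ys) - transfer (sgn ∘ α) (suc (length ys)) (moment p (y ∷ ys)) ∣
    ≤ errorFactor (length (proper (y ∷ ys)) · 1ℚ) k * e
moment-step {k} α {p} isD y ys {e} small = subst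
  (λ x → ∣ x - transfer (sgn ∘ α) (suc (length ys)) (moment p (y ∷ ys)) ∣ ≤ errorFactor (length (proper (y ∷ ys)) · 1ℚ) k * e)
  (sym (E-step α p (λ g → ∏ (y ∷ ys) (λ y → sgn (g y))) (∏sgn-resp (y ∷ ys))))
  (moment-recurrence isD y ys small k (sgn ∘ α) (∣sgn∣≤1 ∘ α))

moment-step-exact : ∀ {k n} (α : BoolFun k) {p : Mass n} → IsDistribution p → ∀ y ys →
  (∀ {S R} → (S , R) ∈ proper (y ∷ ys) → moment p S ≡ 0ℚ) →
  moment (step α p) (y ∷ ys) ≡ transfer (sgn ∘ α) (suc (length ys)) (moment p (y ∷ ys))
moment-step-exact {k} α {p} isD y ys zeros = trans (lemma (moment (step α p) (y ∷ ys)) t) (trans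
  (cong (_+ t) (∣p∣≡0⇒p≡0 (moment (step α p) (y ∷ ys) - t) (≤-antisym
    (subst (∣ moment (step α p) (y ∷ ys) - t ∣ ≤_) (*-zeroʳ (errorFactor (length (proper (y ∷ ys)) · 1ℚ) k))
      (moment-step α isD y ys (λ SR∈ → ≤-reflexive (cong ∣_∣ (zeros SR∈)))))
    (0≤∣p∣ _)))) (+-identityˡ t))
  where
  t = transfer (sgn ∘ α) (suc (length ys)) (moment p (y ∷ ys))
  lemma : ∀ x t → x ≡ x - t + t
  lemma = solve-∀ ℚ-ring

transfer-0 : ∀ {k} (φ : Vec Bool k → ℚ) → (∀ T → weight T ≡ 0 → coef φ T ≡ 0ℚ) → ∀ m → transfer φ (suc m) 0ℚ ≡ 0ℚ
transfer-0 {k} φ coef-∅≡0 m = trans (∑-cong (cube k) term) (∑-0 (cube k))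
  where
  term : ∀ T → coef φ T ^ suc m * 0ℚ ^ weight T ≡ 0ℚ
  term T with weight T in wT
  ... | zero  = trans (cong (λ a → a * coef φ T ^ m * 1ℚ) (coef-∅≡0 T wT)) (lemma (coef φ T ^ m))
    where
    lemma : ∀ x → 0ℚ * x * 1ℚ ≡ 0ℚ
    lemma = solve-∀ ℚ-ring
  ... | suc w = trans (cong (coef φ T ^ suc m *_) (*-zeroˡ (0ℚ ^ w))) (*-zeroʳ (coef φ T ^ suc m))

-- Let single values be unbiased and pairs of values not be fully correlated
-- initially, for points from P pairwise related by R.  Then the moments of
-- nonempty lists of points from P pairwise related by R vanish in the limit.
module Moments {k n} {α : BoolFun k} (mono : Monotone α) (sd : SelfDual α) (¬proj : ¬ IsProjection α)
  {μ : Mass n} (isD : IsDistribution μ) (P : Vec Bool n → Set) (R : Vec Bool n → Vec Bool n → Set)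
  (unbiased : ∀ {y} → P y → moment μ (y ∷ []) ≡ 0ℚ)
  (uncorrelated : ∀ {y y′} → P y → P y′ → R y y′ → ∣ moment μ (y ∷ y′ ∷ []) ∣ < 1ℚ) where

  open Contraction mono sd ¬proj

  private
    p : ℕ → Mass n
    p = growth μ α

    isDᵢ : ∀ i → IsDistribution (p i)
    isDᵢ = growth-isDistribution isD α

  single-moment : ∀ {y} → P y → ∀ i → moment (p i) (y ∷ []) ≡ 0ℚ
  single-moment Py zero = unbiased Py
  single-moment {y} Py (suc i) = trans (moment-step-exact α (isDᵢ i) y [] (λ ()))
    (trans (cong (transfer (sgn ∘ α) 1) (single-moment Py i)) (transfer-0 (sgn ∘ α) coef-∅≡0 0))

  pair-moment-vanishes : ∀ {y y′} → P y → P y′ → R y y′ → Vanishes (λ i → moment (p i) (y ∷ y′ ∷ []))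
  pair-moment-vanishes {y} {y′} Py Py′ Ryy′ =
    vanishes-≤ {x = λ i → ∣ ρ i ∣} (λ i → ≤-reflexive (sym (∣∣p∣∣≡∣p∣ (ρ i))))
      (contraction {x = λ i → ∣ ρ i ∣} {e = λ _ → 0ℚ} 0<δ δ≤1 (λ i → 0≤∣p∣ (ρ i)) vanishes-0
        (λ i → subst (∣ ρ (suc i) ∣ ≤_) (sym (+-identityʳ (∣ ρ i ∣ - δ * ∣ ρ i ∣))) (shrinks i)))
    where
    ρ : ℕ → ℚ
    ρ i = moment (p i) (y ∷ y′ ∷ [])

    δ-contracts = pair-contracts (0≤∣p∣ (ρ 0)) (uncorrelated Py Py′ Ryy′)
    δ = proj₁ δ-contracts
    0<δ = proj₁ (proj₂ δ-contracts)
    δ≤1 = proj₁ (proj₂ (proj₂ δ-contracts))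
    contracts = proj₂ (proj₂ (proj₂ δ-contracts))

    -- A proper part of a pair is a single point.
    proper-zero : ∀ i {S R} → (S , R) ∈ proper (y ∷ y′ ∷ []) → moment (p i) S ≡ 0ℚ
    proper-zero i {S} SR∈ = singleton S (proper-⊆ (y ∷ y′ ∷ []) SR∈)
      where
      singleton : ∀ S → S ⊆ (y ∷ y′ ∷ []) × 1 ℕ.≤ length S × length S ℕ.< 2 → moment (p i) S ≡ 0ℚ
      singleton (z ∷ [])    (S⊆ , _ , _) = single-moment (All.head (All-resp-⊆ S⊆ (Py ∷ Py′ ∷ []))) i
      singleton (_ ∷ _ ∷ _) (_ , _ , ℕ.s≤s (ℕ.s≤s ()))

    ρ-suc : ∀ i → ρ (suc i) ≡ transfer (sgn ∘ α) 2 (ρ i)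
    ρ-suc i = moment-step-exact α (isDᵢ i) y (y′ ∷ []) (proper-zero i)

    ρ≤ρ₀ : ∀ i → ∣ ρ i ∣ ≤ ∣ ρ 0 ∣
    shrinks : ∀ i → ∣ ρ (suc i) ∣ ≤ ∣ ρ i ∣ - δ * ∣ ρ i ∣

    shrinks i = subst (λ x → ∣ x ∣ ≤ ∣ ρ i ∣ - δ * ∣ ρ i ∣) (sym (ρ-suc i)) (contracts (ρ≤ρ₀ i))

    ρ≤ρ₀ zero    = ≤-refl
    ρ≤ρ₀ (suc i) = ≤-trans (shrinks i) (≤-trans
      (≤-by (0≤a*b (<⇒≤ 0<δ) (0≤∣p∣ (ρ i))) (lemma (∣ ρ i ∣) (δ * ∣ ρ i ∣))) (ρ≤ρ₀ i))
      where
      lemma : ∀ a b → a ≡ a - b + b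
      lemma = solve-∀ ℚ-ring

  many-moment-vanishes : ∀ y₁ y₂ y₃ ys → let zs = y₁ ∷ y₂ ∷ y₃ ∷ ys in
    (∀ {S R} → (S , R) ∈ proper zs → Vanishes (λ i → moment (p i) S)) → Vanishes (λ i → moment (p i) zs)
  many-moment-vanishes y₁ y₂ y₃ ys smaller =
    vanishes-≤ {x = λ i → ∣ ρ i ∣} (λ i → ≤-reflexive (sym (∣∣p∣∣≡∣p∣ (ρ i))))
      (contraction {x = λ i → ∣ ρ i ∣} {e = λ i → C * e i} 0<δ δ≤1 (λ i → 0≤∣p∣ (ρ i)) (vanishes-*ˡ C e-vanishes)
        (λ i → ≤-trans (∣x∣≤y+z {ρ (suc i)} (moment-step α (isDᵢ i) y₁ (y₂ ∷ y₃ ∷ ys) (∣S∣≤e i)))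
          (+-monoˡ-≤ (C * e i) (contracts (∣moment∣≤1 (isDᵢ i) zs)))))
    where
    zs = y₁ ∷ y₂ ∷ y₃ ∷ ys
    C = errorFactor (length (proper zs) · 1ℚ) k

    δ-contracts = many-contracts (length ys)
    δ = proj₁ δ-contracts
    0<δ = proj₁ (proj₂ δ-contracts)
    δ≤1 = proj₁ (proj₂ (proj₂ δ-contracts))
    contracts = proj₂ (proj₂ (proj₂ δ-contracts))

    ρ e : ℕ → ℚ
    ρ i = moment (p i) zs
    e i = ∑ (proper zs) (λ (S , R) → ∣ moment (p i) S ∣)

    ∣S∣≤e : ∀ i {S R} → (S , R) ∈ proper zs → ∣ moment (p i) S ∣ ≤ e i
    ∣S∣≤e i = ≤∑ (λ (S , R) → 0≤∣p∣ (moment (p i) S))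

    e-vanishes : Vanishes e
    e-vanishes = ∑-vanishes (proper zs) λ { {S , R} SR∈ →
      vanishes-≤ {x = λ i → moment (p i) S} (λ i → ≤-reflexive (∣∣p∣∣≡∣p∣ (moment (p i) S))) (smaller SR∈) }

  moment-vanishes : ∀ ys → 1 ℕ.≤ length ys → All P ys → AllPairs R ys → Vanishes (λ i → moment (p i) ys)
  moment-vanishes ys = induction (length ys) ys ℕₚ.≤-refl
    where
    induction : ∀ L ys → length ys ℕ.≤ L → 1 ℕ.≤ length ys → All P ys → AllPairs R ys → Vanishes (λ i → moment (p i) ys)
    induction _ (y ∷ [])      _ _ (Py ∷ [])       _                = vanishes-≡ (single-moment Py) vanishes-0
    induction _ (y ∷ y′ ∷ []) _ _ (Py ∷ Py′ ∷ []) ((Ryy′ ∷ []) ∷ _) = pair-moment-vanishes Py Py′ Ryy′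
    induction (suc L) zs@(y₁ ∷ y₂ ∷ y₃ ∷ ys) (ℕ.s≤s len≤L) _ Pzs Rzs = many-moment-vanishes y₁ y₂ y₃ ys λ {S} SR∈ →
      let S⊆ , 1≤S , S<zs = proper-⊆ zs SR∈ in
      induction L S (ℕₚ.≤-trans (ℕₚ.≤-pred S<zs) len≤L) 1≤S (All-resp-⊆ S⊆ Pzs) (AllPairs-resp-⊆ S⊆ Rzs)

-- The initial distribution

projection : ∀ {n} → Fin n → BoolFun n
projection j y = lookup y j

projection-injective : ∀ {n} {i j : Fin n} → projection i ≗ projection j → i ≡ j
projection-injective {i = zero}  {zero}  e = refl
projection-injective {i = zero}  {suc j} e with trans (e (true ∷ Vec.replicate _ false)) (Vecₚ.lookup-replicate j false)
... | ()
projection-injective {i = suc i} {zero}  e with trans (sym (e (true ∷ Vec.replicate _ false))) (Vecₚ.lookup-replicate i false)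
... | ()
projection-injective {i = suc i} {suc j} e = cong suc (projection-injective (λ z → e (false ∷ z)))

∑-Fin-suc : ∀ {n} (h : Fin (suc n) → ℚ) → ∑ (List.allFin (suc n)) h ≡ h zero + ∑ (List.allFin n) (h ∘ suc)
∑-Fin-suc {n} h = cong (h zero +_) (trans (cong (λ js → ∑ js h) (sym (map-tabulate id suc))) (∑-map suc (List.allFin n) h))

∑-Fin-indicator : ∀ {n} (h : Fin n → ℚ) j → h j ≡ 1ℚ → (∀ i → i ≢ j → h i ≡ 0ℚ) → ∑ (List.allFin n) h ≡ 1ℚ
∑-Fin-indicator {suc n} h zero hj≡1 h≡0 = trans (∑-Fin-suc h) (cong₂ _+_ hj≡1
  (trans (∑-cong (List.allFin n) (λ i → h≡0 (suc i) λ ())) (∑-0 (List.allFin n))))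
∑-Fin-indicator {suc n} h (suc j) hj≡1 h≡0 = trans (∑-Fin-suc h) (cong₂ _+_ (h≡0 zero λ ())
  (∑-Fin-indicator (h ∘ suc) j hj≡1 (λ i i≢j → h≡0 (suc i) λ { refl → i≢j refl })))

∑-Fin-bit : ∀ {n} (y : Vec Bool n) → ∑ (List.allFin n) (λ j → bit (lookup y j)) ≡ weight y · 1ℚ
∑-Fin-bit []          = refl
∑-Fin-bit (true ∷ y)  = trans (∑-Fin-suc (λ j → bit (lookup (true ∷ y) j))) (cong (1ℚ +_) (∑-Fin-bit y))
∑-Fin-bit (false ∷ y) = trans (∑-Fin-suc (λ j → bit (lookup (false ∷ y) j))) (trans (+-identityˡ _) (∑-Fin-bit y))

∑-Fin-1 : ∀ n → ∑ (List.allFin n) (λ _ → 1ℚ) ≡ n · 1ℚ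
∑-Fin-1 zero    = refl
∑-Fin-1 (suc n) = trans (∑-Fin-suc {n} (λ _ → 1ℚ)) (cong (1ℚ +_) (∑-Fin-1 n))

∈-allFuns : ∀ {n} (p : Mass n) → Respects p → ∀ f → p f ≡ E p (λ g → [ f ≗? g ])
∈-allFuns {n} p resp f = trans (sym (∑-allFuns f p resp)) (∑-cong (allFuns n) (λ g → *-comm [ f ≗? g ] (p g)))

lookup-differs : ∀ {n} {y y′ : Vec Bool n} → y ≢ y′ → ∃[ j ] lookup y j ≢ lookup y′ j
lookup-differs {y = []} {[]} y≢y′ = ⊥-elim (y≢y′ refl)
lookup-differs {y = b ∷ y} {b′ ∷ y′} y≢y′ with b Bool.≟ b′
... | no b≢b′  = zero , b≢b′
... | yes refl = let j , differs = lookup-differs (λ y≡y′ → y≢y′ (cong (b ∷_) y≡y′)) in suc j , differs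

module Initial {n} {μ : Mass n} (uniform : UniformOn IsProjection μ) where

  open UniformOn uniform
  open IsDistribution isDistribution

  μ-projection-or-0 : ∀ f → IsProjection f ⊎ μ f ≡ 0ℚ
  μ-projection-or-0 f with μ f ≟ 0ℚ
  ... | yes μf≡0 = inj₂ μf≡0
  ... | no  μf≢0 = inj₁ (proj₁ support μf≢0)

  almostSurely-selfDual : AlmostSurely SelfDual μ
  almostSurely-selfDual f with μ-projection-or-0 f
  ... | inj₂ μf≡0       = inj₂ μf≡0
  ... | inj₁ (j , f≗πⱼ) = inj₁ (SelfDual-resp (λ y → sym (f≗πⱼ y))
    (λ y → sym (trans (cong not (Vecₚ.lookup-map j not y)) (not-involutive (lookup y j)))))

  -- The common mass of the projections; without variables there would be none.
  mass : ∃[ c ] 0ℚ < c × ∀ (j : Fin n) → μ (projection j) ≡ c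
  mass = go n refl
    where
    go : ∀ m → m ≡ n → ∃[ c ] 0ℚ < c × ∀ (j : Fin n) → μ (projection j) ≡ c
    go (suc m) refl = μ (projection zero)
      , ≢0∧0≤⇒0< (proj₂ support (zero , λ _ → refl)) (nonnegative (projection zero))
      , λ j → constant (j , λ _ → refl) (zero , λ _ → refl)
    go zero refl = ⊥-elim (1≢0 (trans (sym total) (trans (∑-cong (allFuns 0) μ≡0) (∑-0 (allFuns 0)))))
      where
      μ≡0 : ∀ f → μ f ≡ 0ℚ
      μ≡0 f with μ-projection-or-0 f
      ... | inj₁ (() , _)
      ... | inj₂ μf≡0 = μf≡0

  c : ℚ
  c = proj₁ mass

  0<c : 0ℚ < c
  0<c = proj₁ (proj₂ mass)

  μ-formula : ∀ f → μ f ≡ c * ∑ (List.allFin n) (λ j → [ projection j ≗? f ])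
  μ-formula f with μ-projection-or-0 f
  ... | inj₁ (j , f≗πⱼ) = trans (respects f≗πⱼ) (trans (proj₂ (proj₂ mass) j) (trans (sym (*-identityʳ c))
    (cong (c *_) (sym (∑-Fin-indicator (λ j → [ projection j ≗? f ]) j
      ([yes] (projection j ≗? f) (λ y → sym (f≗πⱼ y)))
      (λ i i≢j → [no] (projection i ≗? f) (λ πᵢ≗f → i≢j (projection-injective (λ y → trans (πᵢ≗f y) (f≗πⱼ y))))))))))
  ... | inj₂ μf≡0 = trans μf≡0 (sym (trans (cong (c *_) (trans
    (∑-cong (List.allFin n) (λ j → [no] (projection j ≗? f) (λ πⱼ≗f → proj₂ support (j , λ y → sym (πⱼ≗f y)) μf≡0)))
    (∑-0 (List.allFin n)))) (*-zeroʳ c)))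

  -- The initial mean is the average over the n projections.
  E-initial : ∀ (F : BoolFun n → ℚ) → Respects F → E μ F ≡ c * ∑ (List.allFin n) (λ j → F (projection j))
  E-initial F resp = begin
    E μ F
      ≡⟨ ∑-cong (allFuns n) (λ f → trans (cong (_* F f) (μ-formula f))
           (trans (*-assoc c (∑ (List.allFin n) (λ j → [ projection j ≗? f ])) (F f))
             (cong (c *_) (sym (∑-*ʳ (List.allFin n) (λ j → [ projection j ≗? f ]) (F f)))))) ⟩
    ∑ (allFuns n) (λ f → c * ∑ (List.allFin n) (λ j → [ projection j ≗? f ] * F f))
      ≡⟨ ∑-*ˡ c (allFuns n) (λ f → ∑ (List.allFin n) (λ j → [ projection j ≗? f ] * F f)) ⟩
    c * ∑ (allFuns n) (λ f → ∑ (List.allFin n) (λ j → [ projection j ≗? f ] * F f))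
      ≡⟨ cong (c *_) (∑-swap (allFuns n) (List.allFin n) (λ f j → [ projection j ≗? f ] * F f)) ⟩
    c * ∑ (List.allFin n) (λ j → ∑ (allFuns n) (λ f → [ projection j ≗? f ] * F f))
      ≡⟨ cong (c *_) (∑-cong (List.allFin n) (λ j → ∑-allFuns (projection j) F resp)) ⟩
    c * ∑ (List.allFin n) (λ j → F (projection j)) ∎
    where open ≡-Reasoning

  c*n≡1 : c * n · 1ℚ ≡ 1ℚ
  c*n≡1 = trans (cong (c *_) (sym (∑-Fin-1 n))) (trans (sym (E-initial (λ _ → 1ℚ) (λ _ → refl)))
    (𝔼-const (allFuns n) μ (isWeighting isDistribution) 1ℚ))

  E-bit : ∀ y → E μ (λ g → bit (g y)) ≡ c * weight y · 1ℚ
  E-bit y = trans (E-initial (λ g → bit (g y)) (λ f≗g → cong bit (f≗g y))) (cong (c *_) (∑-Fin-bit y))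

  0<E-initial : ∀ (F : BoolFun n → ℚ) → Respects F → (∀ f → 0ℚ ≤ F f) → ∀ j → 0ℚ < F (projection j) → 0ℚ < E μ F
  0<E-initial F resp 0≤F j 0<Fj = subst (0ℚ <_) (sym (E-initial F resp))
    (0<a*b 0<c (<-≤-trans 0<Fj (≤∑ {xs = List.allFin n} {h = λ j → F (projection j)} (λ j → 0≤F (projection j)) (∈-allFin j))))

  -- The signs of the coordinates of y and y′ agree somewhere and differ
  -- somewhere, so their correlation is neither 1 nor -1.
  ∣pair-moment∣<1 : ∀ {y y′} → y ≢ y′ × y ≢ Vec.map not y′ → ∣ moment μ (y ∷ y′ ∷ []) ∣ < 1ℚ
  ∣pair-moment∣<1 {y} {y′} (y≢y′ , y≢ȳ′) = ∣∣-<
    (0<-⇒< (subst (0ℚ <_) (trans (E-affine (- 1ℚ)) (lemma₁ M)) (0<E-initial (F (- 1ℚ)) (F-resp (- 1ℚ)) 0≤F₋ i (proj₂ differ))))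
    (0<-⇒< (subst (0ℚ <_) (trans (E-affine 1ℚ) (lemma₂ M)) (0<E-initial (F 1ℚ) (F-resp 1ℚ) 0≤F₊ j (proj₂ agree))))
    where
    M = moment μ (y ∷ y′ ∷ [])

    F : ℚ → BoolFun n → ℚ
    F s g = 1ℚ + s * (sgn (g y) * (sgn (g y′) * 1ℚ))

    F-resp : ∀ s → Respects (F s)
    F-resp s f≗g = cong₂ (λ a b → 1ℚ + s * (sgn a * (sgn b * 1ℚ))) (f≗g y) (f≗g y′)

    E-affine : ∀ s → E μ (F s) ≡ 1ℚ + s * M
    E-affine s = trans (𝔼-+ (allFuns n) μ (λ _ → 1ℚ) (λ g → s * (sgn (g y) * (sgn (g y′) * 1ℚ))))
      (cong₂ _+_ (𝔼-const (allFuns n) μ (isWeighting isDistribution) 1ℚ)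
        (𝔼-*ˡ (allFuns n) μ s (λ g → sgn (g y) * (sgn (g y′) * 1ℚ))))

    lemma₁ : ∀ x → 1ℚ + - 1ℚ * x ≡ 1ℚ - x
    lemma₁ = solve-∀ ℚ-ring
    lemma₂ : ∀ x → 1ℚ + 1ℚ * x ≡ 1ℚ - - x
    lemma₂ = solve-∀ ℚ-ring

    value : ℚ → Bool → Bool → ℚ
    value s a b = 1ℚ + s * (sgn a * (sgn b * 1ℚ))

    0<2 : 0ℚ < 1ℚ + 1ℚ
    0<2 = +-mono-< 0<1 0<1

    0≤F₋ : ∀ f → 0ℚ ≤ F (- 1ℚ) f
    0≤F₋ f = bits (f y) (f y′)
      where
      bits : ∀ a b → 0ℚ ≤ value (- 1ℚ) a b
      bits true  true  = ≤-refl
      bits true  false = <⇒≤ 0<2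
      bits false true  = <⇒≤ 0<2
      bits false false = ≤-refl

    0≤F₊ : ∀ f → 0ℚ ≤ F 1ℚ f
    0≤F₊ f = bits (f y) (f y′)
      where
      bits : ∀ a b → 0ℚ ≤ value 1ℚ a b
      bits true  true  = <⇒≤ 0<2
      bits true  false = ≤-refl
      bits false true  = ≤-refl
      bits false false = <⇒≤ 0<2

    differ : ∃[ j ] 0ℚ < F (- 1ℚ) (projection j)
    differ = let j , differs = lookup-differs y≢y′ in j , bits (lookup y j) (lookup y′ j) differs
      where
      bits : ∀ a b → a ≢ b → 0ℚ < value (- 1ℚ) a b
      bits true  true  a≢b = ⊥-elim (a≢b refl)
      bits true  false _   = 0<2
      bits false true  _   = 0<2
      bits false false a≢b = ⊥-elim (a≢b refl)

    agree : ∃[ j ] 0ℚ < F 1ℚ (projection j)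
    agree = let j , differs = lookup-differs y≢ȳ′ in
      j , bits (lookup y j) (lookup y′ j) (λ eq → differs (trans eq (sym (Vecₚ.lookup-map j not y′))))
      where
      bits : ∀ a b → a ≢ not b → 0ℚ < value 1ℚ a b
      bits true  true  _   = 0<2
      bits true  false a≢b = ⊥-elim (a≢b refl)
      bits false true  a≢b = ⊥-elim (a≢b refl)
      bits false false _   = 0<2

    i = proj₁ differ
    j = proj₁ agree

  module _ {m} (n≡m+m : n ≡ m ℕ.+ m) where

    half : c * m · 1ℚ ≡ ½
    half = trans (lemma (c * m · 1ℚ)) (cong (½ *_) (trans (sym (*-distribˡ-+ c (m · 1ℚ) (m · 1ℚ)))
      (trans (cong (c *_) (sym (·-+ m m 1ℚ))) (subst (λ n → c * n · 1ℚ ≡ 1ℚ) n≡m+m c*n≡1))))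
      where
      lemma : ∀ x → x ≡ ½ * (x + x)
      lemma = solve-∀ ℚ-ring

    E-bit<½ : ∀ {y} → weight y ℕ.< m → E μ (λ g → bit (g y)) < ½
    E-bit<½ {y} w<m = subst₂ _<_ (sym (E-bit y)) half (*-monoʳ-<-pos c {{ℚ.positive 0<c}} (·-mono-< w<m))

    middle-unbiased : ∀ {y} → weight y ≡ m → moment μ (y ∷ []) ≡ 0ℚ
    middle-unbiased {y} wy≡m = begin
      E μ (λ g → sgn (g y) * 1ℚ)
        ≡⟨ 𝔼-cong (allFuns n) μ (λ g → sgn-bit (g y)) ⟩
      E μ (λ g → 1ℚ + - (1ℚ + 1ℚ) * bit (g y))
        ≡⟨ trans (𝔼-+ (allFuns n) μ (λ _ → 1ℚ) (λ g → - (1ℚ + 1ℚ) * bit (g y)))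
             (cong₂ _+_ (𝔼-const (allFuns n) μ (isWeighting isDistribution) 1ℚ)
               (𝔼-*ˡ (allFuns n) μ (- (1ℚ + 1ℚ)) (λ g → bit (g y)))) ⟩
      1ℚ + - (1ℚ + 1ℚ) * E μ (λ g → bit (g y))
        ≡⟨ cong (λ x → 1ℚ + - (1ℚ + 1ℚ) * x) (trans (E-bit y) (trans (cong (λ w → c * w · 1ℚ) wy≡m) half)) ⟩
      0ℚ ∎
      where
      open ≡-Reasoning
      sgn-bit : ∀ b → sgn b * 1ℚ ≡ 1ℚ + - (1ℚ + 1ℚ) * bit b
      sgn-bit true  = refl
      sgn-bit false = refl

-- Marginals of the growth process

bit-resp : ∀ {n} (y : Vec Bool n) → Respects (λ g → bit (g y))
bit-resp y f≗g = cong bit (f≗g y)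

-- A step amplifies the probability that the value at y is true.
E^-amp : ∀ {n} {p : Mass n} → IsDistribution p → ∀ y {k} (α : BoolFun k) →
  E^ p k (λ gs → bit (compose α gs y)) ≡ amp α (E p (λ g → bit (g y)))
E^-amp {n} {p} isD y {zero}  α = 𝔼-const (tuples (allFuns n) 0) (joint p) (joint-isWeighting isD 0) (bit (α []))
E^-amp {n} {p} isD y {suc k} α = begin
  E^ p (suc k) (λ gs → bit (compose α gs y))
    ≡⟨ E^-suc′ p k (λ gs → bit (compose α gs y)) ⟩
  E^ p k (λ gs → E p (λ g → bit (α (g y ∷ Vec.map (λ g → g y) gs))))
    ≡⟨ 𝔼-cong (tuples (allFuns n) k) (joint p) average ⟩
  E^ p k (λ gs → (1ℚ - q) * u gs + q * v gs)
    ≡⟨ trans (𝔼-+ (tuples (allFuns n) k) (joint p) (λ gs → (1ℚ - q) * u gs) (λ gs → q * v gs))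
         (cong₂ _+_ (𝔼-*ˡ (tuples (allFuns n) k) (joint p) (1ℚ - q) u) (𝔼-*ˡ (tuples (allFuns n) k) (joint p) q v)) ⟩
  (1ℚ - q) * E^ p k u + q * E^ p k v
    ≡⟨ cong₂ (λ a b → (1ℚ - q) * a + q * b) (E^-amp isD y (cofactor false α)) (E^-amp isD y (cofactor true α)) ⟩
  amp α q ∎
  where
  open ≡-Reasoning
  q = E p (λ g → bit (g y))

  u v : Vec (BoolFun n) k → ℚ
  u gs = bit (compose (cofactor false α) gs y)
  v gs = bit (compose (cofactor true α) gs y)

  bit-cofactor : ∀ b z → bit (α (b ∷ z)) ≡ bit (α (false ∷ z)) + (bit (α (true ∷ z)) - bit (α (false ∷ z))) * bit b
  bit-cofactor true  z = lemma (bit (α (false ∷ z))) (bit (α (true ∷ z)))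
    where
    lemma : ∀ a b → b ≡ a + (b - a) * 1ℚ
    lemma = solve-∀ ℚ-ring
  bit-cofactor false z = lemma (bit (α (false ∷ z))) (bit (α (true ∷ z)))
    where
    lemma : ∀ a b → a ≡ a + (b - a) * 0ℚ
    lemma = solve-∀ ℚ-ring

  average : ∀ gs → E p (λ g → bit (α (g y ∷ Vec.map (λ g → g y) gs))) ≡ (1ℚ - q) * u gs + q * v gs
  average gs = trans (𝔼-cong (allFuns n) p (λ g → bit-cofactor (g y) (Vec.map (λ g → g y) gs)))
    (trans (𝔼-+ (allFuns n) p (λ _ → u gs) (λ g → (v gs - u gs) * bit (g y)))
      (trans (cong₂ _+_ (𝔼-const (allFuns n) p (isWeighting isD) (u gs)) (𝔼-*ˡ (allFuns n) p (v gs - u gs) (λ g → bit (g y))))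
        (lemma (u gs) (v gs) q)))
    where
    lemma : ∀ u v q → u + (v - u) * q ≡ (1ℚ - q) * u + q * v
    lemma = solve-∀ ℚ-ring

-- A function that is true at y has at most the probability of being true at y.
mass≤E : ∀ {n} {p : Mass n} → IsDistribution p → ∀ f y → f y ≡ true → p f ≤ E p (λ g → bit (g y))
mass≤E {n} {p} isD f y fy = subst (_≤ E p (λ g → bit (g y))) (sym (∈-allFuns p (IsDistribution.respects isD) f))
  (𝔼-mono (allFuns n) p (isWeighting isD) event)
  where
  event : ∀ g → [ f ≗? g ] ≤ bit (g y)
  event g = indicator (f ≗? g)
    where
    0≤bit : ∀ b → 0ℚ ≤ bit b
    0≤bit true  = 0≤1
    0≤bit false = ≤-refl
    indicator : (d : Dec (f ≗ g)) → [ d ] ≤ bit (g y)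
    indicator (yes f≗g) = ≤-reflexive (cong bit (trans (sym fy) (f≗g y)))
    indicator (no _)    = 0≤bit (g y)

-- The middle layer

weight-not : ∀ {n} (y : Vec Bool n) → weight (Vec.map not y) ℕ.+ weight y ≡ n
weight-not []          = refl
weight-not (true ∷ y)  = trans (ℕₚ.+-suc _ _) (cong suc (weight-not y))
weight-not (false ∷ y) = cong suc (weight-not y)

map-not-involutive : ∀ {n} (y : Vec Bool n) → Vec.map not (Vec.map not y) ≡ y
map-not-involutive []      = refl
map-not-involutive (b ∷ y) = cong₂ _∷_ (not-involutive b) (map-not-involutive y)

-- Distinct and not complementary: the values of a self-dual function at such
-- points are not tied to each other.
Independent : ∀ {n} → Vec Bool n → Vec Bool n → Set
Independent y y′ = y ≢ y′ × y ≢ Vec.map not y′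

-- One point from each complementary pair in the list, chosen greedily.
representatives : ∀ {n} (P : Vec Bool n → Set) → (∀ y → Dec (P y)) → (ys : List (Vec Bool n)) →
  ∃[ R ] All P R × AllPairs Independent R × (∀ {y} → y ∈ ys → P y → y ∈ R ⊎ Vec.map not y ∈ R)
representatives P P? []       = [] , [] , [] , λ ()
representatives P P? (y ∷ ys) = extend (representatives P P? ys)
  where
  tied? : ∀ y′ → Dec (y ≡ y′ ⊎ y ≡ Vec.map not y′)
  tied? y′ = (y ≟ᵛ y′) ⊎-dec (y ≟ᵛ Vec.map not y′)
    where
    _≟ᵛ_ = Vecₚ.≡-dec Bool._≟_

  tied⇒∈ : ∀ {R} → Any (λ y′ → y ≡ y′ ⊎ y ≡ Vec.map not y′) R → y ∈ R ⊎ Vec.map not y ∈ R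
  tied⇒∈ (here (inj₁ refl)) = inj₁ (here refl)
  tied⇒∈ (here (inj₂ refl)) = inj₂ (here (map-not-involutive _))
  tied⇒∈ (there any) with tied⇒∈ any
  ... | inj₁ y∈ = inj₁ (there y∈)
  ... | inj₂ ȳ∈ = inj₂ (there ȳ∈)

  extend : (∃[ R ] All P R × AllPairs Independent R × (∀ {y} → y ∈ ys → P y → y ∈ R ⊎ Vec.map not y ∈ R)) →
    ∃[ R ] All P R × AllPairs Independent R × (∀ {z} → z ∈ y ∷ ys → P z → z ∈ R ⊎ Vec.map not z ∈ R)
  extend (R , PR , indep , covers) with P? y | Any.any? tied? R
  ... | no ¬Py | _        = R , PR , indep , λ { (here refl) Py → ⊥-elim (¬Py Py) ; (there z∈) → covers z∈ }
  ... | yes _  | yes tied = R , PR , indep , λ { (here refl) _ → tied⇒∈ tied ; (there z∈) → covers z∈ }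
  ... | yes Py | no ¬tied = y ∷ R , Py ∷ PR
    , All.map (λ ¬t → ¬t ∘ inj₁ , ¬t ∘ inj₂) (¬Any⇒All¬ R ¬tied) ∷ indep
    , λ { (here refl) _ → inj₁ (here refl) ; (there z∈) Pz → weaken (covers z∈ Pz) }
    where
    weaken : ∀ {z} → z ∈ R ⊎ Vec.map not z ∈ R → z ∈ y ∷ R ⊎ Vec.map not z ∈ y ∷ R
    weaken (inj₁ z∈) = inj₁ (there z∈)
    weaken (inj₂ z̄∈) = inj₂ (there z̄∈)

-- A self-dual function is in the middle slice unless it is true somewhere
-- below the middle layer.
slice-or-low : ∀ {n m} → n ≡ m ℕ.+ m → (f : BoolFun n) → SelfDual f →
  Slice m f ⊎ ∃[ y ] weight y ℕ.< m × f y ≡ true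
slice-or-low {n} {m} n≡m+m f sd with Any.any? (λ y → (weight y ℕₚ.<? m) ×-dec (f y Bool.≟ true)) (cube n)
... | yes found = inj₂ (Any.satisfied found)
... | no ¬found = inj₁ (high , low)
  where
  low : ∀ y → weight y ℕ.< m → f y ≡ false
  low y w<m with f y in fy
  ... | false = refl
  ... | true  = ⊥-elim (¬found (Any.map (λ { refl → w<m , fy }) (∈-cube y)))

  high : ∀ y → m ℕ.< weight y → f y ≡ true
  high y m<w = trans (sd y) (cong not (low (Vec.map not y) (ℕₚ.+-cancelʳ-< (weight y) _ m
    (subst (ℕ._< m ℕ.+ weight y) (sym (trans (weight-not y) n≡m+m)) (ℕₚ.+-monoʳ-< m m<w)))))

-- Self-dual functions in the middle slice are determined by their values at
-- the representatives.
determined : ∀ {n m} {R : List (Vec Bool n)} → (∀ y → weight y ≡ m → y ∈ R ⊎ Vec.map not y ∈ R) →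
  {f g : BoolFun n} → SelfDual f × Slice m f → SelfDual g × Slice m g → (∀ {y} → y ∈ R → f y ≡ g y) → f ≗ g
determined {m = m} covers (sdf , f-high , f-low) (sdg , g-high , g-low) agree y with ℕₚ.<-cmp (weight y) m
... | tri< w<m _ _ = trans (f-low y w<m) (sym (g-low y w<m))
... | tri> _ _ m<w = trans (f-high y m<w) (sym (g-high y m<w))
... | tri≈ _ w≡m _ with covers y w≡m
... | inj₁ y∈R = agree y∈R
... | inj₂ ȳ∈R = trans (sdf y) (trans (cong not (agree ȳ∈R)) (sym (sdg y)))

-- The indicator of agreement with f at the points of R, as a product.
match : Bool → Bool → ℚ
match b c = ½ + sgn c * (½ * sgn b)

matches : ∀ {n} → List (Vec Bool n) → BoolFun n → BoolFun n → ℚ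
matches R f g = ∏ R (λ y → match (f y) (g y))

match-≡ : ∀ b → match b b ≡ 1ℚ
match-≡ true  = refl
match-≡ false = refl

match-≢ : ∀ b c → b ≢ c → match b c ≡ 0ℚ
match-≢ true  true  b≢c = ⊥-elim (b≢c refl)
match-≢ true  false _   = refl
match-≢ false true  _   = refl
match-≢ false false b≢c = ⊥-elim (b≢c refl)

matches-agree : ∀ {n} (R : List (Vec Bool n)) (f g : BoolFun n) →
  ((∀ {y} → y ∈ R → f y ≡ g y) × matches R f g ≡ 1ℚ) ⊎ ((¬ f ≗ g) × matches R f g ≡ 0ℚ)
matches-agree []      f g = inj₁ ((λ ()) , refl)
matches-agree (y ∷ R) f g = go (f y Bool.≟ g y) (matches-agree R f g)
  where
  go : Dec (f y ≡ g y) →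
    ((∀ {y} → y ∈ R → f y ≡ g y) × matches R f g ≡ 1ℚ) ⊎ ((¬ f ≗ g) × matches R f g ≡ 0ℚ) →
    ((∀ {z} → z ∈ y ∷ R → f z ≡ g z) × matches (y ∷ R) f g ≡ 1ℚ) ⊎ ((¬ f ≗ g) × matches (y ∷ R) f g ≡ 0ℚ)
  go (no fy≢gy)  _                    = inj₂ ((λ f≗g → fy≢gy (f≗g y))
    , trans (cong (_* matches R f g) (match-≢ (f y) (g y) fy≢gy)) (*-zeroˡ (matches R f g)))
  go (yes _)     (inj₂ (f≇g , m≡0))   = inj₂ (f≇g
    , trans (cong (match (f y) (g y) *_) m≡0) (*-zeroʳ (match (f y) (g y))))
  go (yes fy≡gy) (inj₁ (agree , m≡1)) = inj₁ ((λ { (here refl) → fy≡gy ; (there z∈) → agree z∈ })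
    , cong₂ _*_ (trans (cong (match (f y)) (sym fy≡gy)) (match-≡ (f y))) m≡1)

-- The limiting distribution

module Limit {k n m} {α : BoolFun k} {μ : Mass n} (mono : Monotone α) (sd : SelfDual α) (¬proj : ¬ IsProjection α)
  (n≡m+m : n ≡ m ℕ.+ m) (uniform : UniformOn IsProjection μ) where

  open Initial uniform using (almostSurely-selfDual; E-bit<½; middle-unbiased; ∣pair-moment∣<1)
  open Amplification mono sd ¬proj using (amp-iterates-vanish)

  private
    p : ℕ → Mass n
    p = growth μ α

    isDᵢ : ∀ i → IsDistribution (p i)
    isDᵢ = growth-isDistribution (UniformOn.isDistribution uniform) α

    respectsᵢ : ∀ i → Respects (p i)
    respectsᵢ i = IsDistribution.respects (isDᵢ i)

    nonnegativeᵢ : ∀ i f → 0ℚ ≤ p i f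
    nonnegativeᵢ i = IsDistribution.nonnegative (isDᵢ i)

  open Moments mono sd ¬proj (UniformOn.isDistribution uniform) (λ y → weight y ≡ m) Independent
    (middle-unbiased n≡m+m) (λ _ _ → ∣pair-moment∣<1) using (moment-vanishes)

  -- The functions that keep mass in the limit.
  Good : BoolFun n → Set
  Good f = SelfDual f × Slice m f

  Good-resp : ∀ {f g} → f ≗ g → Good f → Good g
  Good-resp f≗g (sdf , high , low) = SelfDual-resp f≗g sdf
    , (λ y m<w → trans (sym (f≗g y)) (high y m<w)) , (λ y w<m → trans (sym (f≗g y)) (low y w<m))

  low-vanishes : ∀ f y → weight y ℕ.< m → f y ≡ true → Vanishes (λ i → p i f)
  low-vanishes f y w<m fy = vanishes-≤ {x = q}
    (λ i → subst₂ _≤_ (sym (0≤p⇒∣p∣≡p (nonnegativeᵢ i f))) (sym (0≤p⇒∣p∣≡p (0≤q i))) (mass≤E (isDᵢ i) f y fy))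
    (amp-iterates-vanish q-suc (0≤q 0) (E-bit<½ n≡m+m w<m))
    where
    q : ℕ → ℚ
    q i = E (p i) (λ g → bit (g y))

    q-suc : ∀ i → q (suc i) ≡ amp α (q i)
    q-suc i = trans (E-step α (p i) (λ g → bit (g y)) (bit-resp y)) (E^-amp (isDᵢ i) y α)

    0≤q : ∀ i → 0ℚ ≤ q i
    0≤q i = ≤-trans (nonnegativeᵢ i f) (mass≤E (isDᵢ i) f y fy)

  not-selfDual-vanishes : ∀ f → ¬ SelfDual f → Vanishes (λ i → p i f)
  not-selfDual-vanishes f ¬sd = vanishes-≡ p≡0 vanishes-0
    where
    p≡0 : ∀ i → p i f ≡ 0ℚ
    p≡0 i = [ (λ sdf → ⊥-elim (¬sd sdf)) , id ]′ (growth-selfDual sd almostSurely-selfDual i f)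

  good-or-vanishes : ∀ f → Good f ⊎ ((¬ Good f) × Vanishes (λ i → p i f))
  good-or-vanishes f = go (f ≗? (λ y → not (f (Vec.map not y))))
    where
    slice : SelfDual f → Slice m f ⊎ ∃[ y ] weight y ℕ.< m × f y ≡ true → Good f ⊎ ((¬ Good f) × Vanishes (λ i → p i f))
    slice sdf (inj₁ sl)             = inj₁ (sdf , sl)
    slice sdf (inj₂ (y , w<m , fy)) = inj₂ ((λ (_ , _ , low) → true≢false (trans (sym fy) (low y w<m))) , low-vanishes f y w<m fy)
      where
      true≢false : true ≢ false
      true≢false ()

    go : Dec (SelfDual f) → Good f ⊎ ((¬ Good f) × Vanishes (λ i → p i f))
    go (yes sdf) = slice sdf (slice-or-low n≡m+m f sdf)
    go (no ¬sdf) = inj₂ (¬sdf ∘ proj₁ , not-selfDual-vanishes f ¬sdf)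

  good? : ∀ f → Dec (Good f)
  good? f = [ yes , no ∘ proj₁ ]′ (good-or-vanishes f)

  private
    reps = representatives (λ y → weight y ≡ m) (λ y → weight y ℕₚ.≟ m) (cube n)

  R : List (Vec Bool n)
  R = proj₁ reps

  R-middle : All (λ y → weight y ≡ m) R
  R-middle = proj₁ (proj₂ reps)

  R-independent : AllPairs Independent R
  R-independent = proj₁ (proj₂ (proj₂ reps))

  R-covers : ∀ y → weight y ≡ m → y ∈ R ⊎ Vec.map not y ∈ R
  R-covers y = proj₂ (proj₂ (proj₂ reps)) (∈-cube y)

  -- The mass of each good function in the limit: a factor 1/2 for each
  -- representative.
  u : ℚ
  u = ∏ R (λ _ → ½)

  0<u : 0ℚ < u
  0<u = 0<∏ R
    where
    0<∏ : ∀ (R : List (Vec Bool n)) → 0ℚ < ∏ R (λ _ → ½)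
    0<∏ []      = 0<1
    0<∏ (y ∷ R) = 0<a*b 0<½ (0<∏ R)

  -- The values at the representatives become independent and unbiased.
  matches-converges : ∀ f → Vanishes (λ i → E (p i) (matches R f) - u)
  matches-converges f = vanishes-≡ expand (∑-vanishes (nonempty R) term-vanishes)
    where
    weights : List (Vec Bool n) × List (Vec Bool n) → ℚ
    weights (S , T) = ∏ S (λ y → ½ * sgn (f y)) * ∏ T (λ _ → ½)

    term : ℕ → List (Vec Bool n) × List (Vec Bool n) → ℚ
    term i (S , T) = moment (p i) S * weights (S , T)

    expand : ∀ i → E (p i) (matches R f) - u ≡ ∑ (nonempty R) (term i)
    expand i = trans (cong (_- u) (trans (E-∏ (p i) R (λ _ → ½) (λ y → ½ * sgn (f y)))
      (trans (∑-splits-∅ R (term i)) (cong (λ x → x * (1ℚ * u) + ∑ (nonempty R) (term i)) (moment-∅ (isDᵢ i))))))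
      (lemma u (∑ (nonempty R) (term i)))
      where
      lemma : ∀ u s → 1ℚ * (1ℚ * u) + s - u ≡ s
      lemma = solve-∀ ℚ-ring

    term-vanishes : ∀ {x} → x ∈ nonempty R → Vanishes (λ i → term i x)
    term-vanishes {S , T} ST∈ = vanishes-≡ {x = λ i → weights (S , T) * moment (p i) S}
      (λ i → *-comm (moment (p i) S) (weights (S , T)))
      (vanishes-*ˡ (weights (S , T)) (moment-vanishes S (proj₂ S⊆R) (All-resp-⊆ (proj₁ S⊆R) R-middle)
        (AllPairs-resp-⊆ (proj₁ S⊆R) R-independent)))
      where
      S⊆R = nonempty-⊆ R ST∈

  -- The functions that match a good f without being equal to it are not good.
  good-converges : ∀ f → Good f → Vanishes (λ i → p i f - u)
  good-converges f good-f = vanishes-≡ split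
    (vanishes-+ (matches-converges f) (vanishes-*ˡ (- 1ℚ) (∑-vanishes (allFuns n) (λ {g} _ → others g))))
    where
    excess : BoolFun n → ℚ
    excess g = matches R f g - [ f ≗? g ]

    split : ∀ i → p i f - u ≡ E (p i) (matches R f) - u + - 1ℚ * ∑ (allFuns n) (λ g → p i g * excess g)
    split i = trans (lemma (p i f) u (E (p i) (matches R f)))
      (cong (λ x → E (p i) (matches R f) - u + - 1ℚ * x) (sym (trans
        (𝔼-+ (allFuns n) (p i) (matches R f) (λ g → - [ f ≗? g ]))
        (cong (E (p i) (matches R f) +_) (trans
          (𝔼-cong (allFuns n) (p i) (λ g → neg [ f ≗? g ]))
          (trans (𝔼-*ˡ (allFuns n) (p i) (- 1ℚ) (λ g → [ f ≗? g ])) (trans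
            (sym (neg (E (p i) (λ g → [ f ≗? g ])))) (cong -_ (sym (∈-allFuns (p i) (respectsᵢ i) f))))))))))
      where
      lemma : ∀ x u e → x - u ≡ e - u + - 1ℚ * (e - x)
      lemma = solve-∀ ℚ-ring
      neg : ∀ x → - x ≡ - 1ℚ * x
      neg = solve-∀ ℚ-ring

    others : ∀ g → Vanishes (λ i → p i g * excess g)
    others g = go (good-or-vanishes g)
      where
      excess≡0 : Good g → ((∀ {y} → y ∈ R → f y ≡ g y) × matches R f g ≡ 1ℚ) ⊎ ((¬ f ≗ g) × matches R f g ≡ 0ℚ) → excess g ≡ 0ℚ
      excess≡0 good-g (inj₁ (agree , m≡1)) = cong₂ _-_ m≡1 ([yes] (f ≗? g) (determined R-covers good-f good-g agree))
      excess≡0 good-g (inj₂ (f≇g , m≡0))   = cong₂ _-_ m≡0 ([no] (f ≗? g) f≇g)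

      go : Good g ⊎ ((¬ Good g) × Vanishes (λ i → p i g)) → Vanishes (λ i → p i g * excess g)
      go (inj₁ good-g)  = vanishes-≡ (λ i → trans (cong (p i g *_) (excess≡0 good-g (matches-agree R f g))) (*-zeroʳ (p i g))) vanishes-0
      go (inj₂ (_ , v)) = vanishes-≡ {x = λ i → excess g * p i g} (λ i → *-comm (p i g) (excess g)) (vanishes-*ˡ (excess g) v)

  -- Mass u on each good function.
  π : Mass n
  π f = [ good? f ] * u

  π-good : ∀ {f} → Good f → π f ≡ u
  π-good {f} good-f = trans (cong (_* u) ([yes] (good? f) good-f)) (*-identityˡ u)

  π-bad : ∀ {f} → ¬ Good f → π f ≡ 0ℚ
  π-bad {f} ¬good = trans (cong (_* u) ([no] (good? f) ¬good)) (*-zeroˡ u)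

  converges : ∀ f → Vanishes (λ i → p i f - π f)
  converges f = go (good-or-vanishes f)
    where
    go : Good f ⊎ ((¬ Good f) × Vanishes (λ i → p i f)) → Vanishes (λ i → p i f - π f)
    go (inj₁ good-f)      = vanishes-≡ (λ i → cong (λ x → p i f - x) (π-good good-f)) (good-converges f good-f)
    go (inj₂ (¬good , v)) = vanishes-≡ (λ i → trans (cong (λ x → p i f - x) (π-bad ¬good)) (+-identityʳ (p i f))) v

  isLimit : IsLimit p π
  isLimit = converges

  -- The total mass is the same constant 1 at all times, so it is 1 in the limit.
  π-total : ∑ (allFuns n) π ≡ 1ℚ
  π-total = trans (lemma₁ (∑ (allFuns n) π)) (trans
    (cong (λ x → 1ℚ - x) (vanishing-constant (vanishes-≡ total-difference (∑-vanishes (allFuns n) (λ {f} _ → converges f)))))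
    refl)
    where
    lemma₁ : ∀ x → x ≡ 1ℚ - (1ℚ - x)
    lemma₁ = solve-∀ ℚ-ring
    neg : ∀ x → - x ≡ - 1ℚ * x
    neg = solve-∀ ℚ-ring

    total-difference : ∀ i → 1ℚ - ∑ (allFuns n) π ≡ ∑ (allFuns n) (λ f → p i f - π f)
    total-difference i = sym (trans (∑-+ (allFuns n) (p i) (λ f → - π f))
      (cong₂ _+_ (IsDistribution.total (isDᵢ i))
        (trans (∑-cong (allFuns n) (λ f → neg (π f))) (trans (∑-*ˡ (- 1ℚ) (allFuns n) π) (sym (neg (∑ (allFuns n) π)))))))

  π-uniform : UniformOn Good π
  π-uniform = record
    { isDistribution = record
      { respects    = λ {f} {g} f≗g → cong (_* u) ([]-cong (good? f) (good? g)
                        (Good-resp f≗g) (Good-resp (λ y → sym (f≗g y))))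
      ; nonnegative = λ f → 0≤a*b (0≤[] (good? f)) (<⇒≤ 0<u)
      ; total       = π-total
      }
    ; support  = (λ {f} πf≢0 → [ id , (λ (¬good , _) → ⊥-elim (πf≢0 (π-bad ¬good))) ]′ (good-or-vanishes f))
               , (λ good-f πf≡0 → <⇒≢ 0<u (trans (sym πf≡0) (π-good good-f)))
    ; constant = λ good-f good-g → trans (π-good good-f) (sym (π-good good-g))
    }

theorem5p22 : ∀ {k n : ℕ} (α : BoolFun k) (μ : Mass n) →
    Monotone α → SelfDual α → ¬ IsProjection α →
    2 ∣ n →
    UniformOn IsProjection μ →
    ∃[ π ] (IsLimit (growth μ α) π × UniformOn (λ (f : BoolFun n) → SelfDual f × Slice (n / 2) f) π)
theorem5p22 {n = n} α μ mono sd ¬proj (divides m n≡m*2) uniform = π , isLimit , π-uniform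
  where
  n≡half+half : n ≡ n / 2 ℕ.+ n / 2
  n≡half+half = trans n≡m*2 (trans (ℕₚ.*-comm m 2) (cong₂ ℕ._+_ m≡n/2 (trans (ℕₚ.+-identityʳ m) m≡n/2)))
    where
    m≡n/2 : m ≡ n / 2
    m≡n/2 = sym (trans (cong (_/ 2) n≡m*2) (m*n/n≡m m 2))
  open Limit {m = n / 2} mono sd ¬proj n≡half+half uniform
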